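{- There is an algorithm which, given an undirected unweighted graph $G$ with $n$ vertices, $m$ edges and diameter $D$, runs in $\tilde O(m^{2/3}n^{4/3})$ time and outputs an estimate $\hat D$ with $\lfloor 4D/5\rfloor\le \hat D\le D$.
   Context: The diameter is the maximum shortest-path distance over pairs of vertices. $\tilde O$ hides polylogarithmic factors. -}

module Defs where

open import Data.Bool using (Bool; true; false; if_then_else_)
open import Data.Fin using (Fin; toℕ)
open import Data.List using (List; []; _∷_; length)
open import Data.List.Membership.Propositional using (_∈_)
open import Data.List.Relation.Unary.All using (All)
open import Data.List.Relation.Unary.AllPairs using (AllPairs)
open import Data.Nat using (ℕ; zero; suc; _+_; _*_; _∸_; _^_; _/_; _≤_; _<ᵇ_; _≡ᵇ_)
open import Data.Nat.Logarithm using (⌊log₂_⌋)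
open import Data.Product using (_×_; _,_; proj₁; proj₂; ∃-syntax; swap)
open import Data.Sum using (_⊎_)
open import Relation.Binary.PropositionalEquality using (_≡_; _≢_)

-- A finite simple undirected graph on Fin n, presented by a list of its
-- edges: every edge occurs once, in an arbitrary position and with an
-- arbitrary order of its two endpoints.
record Graph (n : ℕ) : Set where
  field
    edges    : List (Fin n × Fin n)
    loopless : All (λ e → proj₁ e ≢ proj₂ e) edges
    distinct : AllPairs (λ e f → e ≢ f × e ≢ swap f) edges

  edgeCount : ℕ
  edgeCount = length edges

  Adj : Fin n → Fin n → Set
  Adj u v = (u , v) ∈ edges ⊎ (v , u) ∈ edges

  data Walk : Fin n → Fin n → ℕ → Set where
    []  : ∀ {u} → Walk u u 0
    _∷_ : ∀ {u v w k} → Adj u v → Walk v w k → Walk u w (suc k)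

  IsDistance : Fin n → Fin n → ℕ → Set
  IsDistance u v d = Walk u v d × (∀ k → Walk u v k → d ≤ k)

  -- The maximum of all distances is D.  In particular all distances are
  -- finite (the graph is connected) and there is at least one vertex.
  IsDiameter : ℕ → Set
  IsDiameter D =
      (∀ u v → ∃[ d ] (IsDistance u v d × d ≤ D))
    × ∃[ u ] ∃[ v ] IsDistance u v D

open Graph public

-- A random access machine with logarithmic cost: structured programs over
-- scalar variables and unbounded arrays, both holding natural numbers.
-- Names of variables and arrays are part of the program text, so a program
-- uses only finitely many of them; indices into arrays are computed.
-- Numbers are unbounded, so operations are charged by bit length; for
-- values polynomial in the input size this differs from unit cost on a
-- word RAM by a logarithmic factor only.
data Op : Set where
  add sub mul div lt eq : Op

data Expr : Set where
  lit : ℕ → Expr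
  var : (x : ℕ) → Expr
  get : (a : ℕ) (i : Expr) → Expr
  bin : Op → Expr → Expr → Expr

infixr 5 _⨾_

data Program : Set where
  skip   : Program
  assign : (x : ℕ) (e : Expr) → Program
  put    : (a : ℕ) (i e : Expr) → Program
  _⨾_    : Program → Program → Program
  ite    : (e : Expr) (p q : Program) → Program
  while  : (e : Expr) (p : Program) → Program

record State : Set where
  constructor mkState
  field
    scalar : ℕ → ℕ
    array  : ℕ → ℕ → ℕ

open State public

update : {A : Set} → ℕ → A → (ℕ → A) → ℕ → A
update x v f y = if x ≡ᵇ y then v else f y

setScalar : ℕ → ℕ → State → State
setScalar x v (mkState s r) = mkState (update x v s) r

setCell : ℕ → ℕ → ℕ → State → State
setCell a i v (mkState s r) = mkState s (update a (update i v (r a)) r)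

bit : Bool → ℕ
bit true  = 1
bit false = 0

-- Subtraction is truncated and division by zero yields zero.
⟦_⟧op : Op → ℕ → ℕ → ℕ
⟦ add ⟧op m n       = m + n
⟦ sub ⟧op m n       = m ∸ n
⟦ mul ⟧op m n       = m * n
⟦ div ⟧op m zero    = 0
⟦ div ⟧op m (suc n) = m / suc n
⟦ lt  ⟧op m n       = bit (m <ᵇ n)
⟦ eq  ⟧op m n       = bit (m ≡ᵇ n)

eval : Expr → State → ℕ
eval (lit k)     σ = k
eval (var x)     σ = scalar σ x
eval (get a i)   σ = array σ a (eval i σ)
eval (bin o d e) σ = ⟦ o ⟧op (eval d σ) (eval e σ)

bitLength : ℕ → ℕ
bitLength n = suc ⌊log₂ n ⌋

-- Each node is charged the bit length of its value.  Operands and array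
-- indices are nodes themselves, so their bit lengths are charged as well.
cost : Expr → State → ℕ
cost e@(lit _)     σ = bitLength (eval e σ)
cost e@(var _)     σ = bitLength (eval e σ)
cost e@(get _ i)   σ = cost i σ + bitLength (eval e σ)
cost e@(bin _ c d) σ = cost c σ + cost d σ + bitLength (eval e σ)

infix 4 _▷_⇓[_]_

-- p ▷ σ ⇓[ t ] τ : started in σ, the program p halts in τ after time t.
-- A condition holds when its value is nonzero.
data _▷_⇓[_]_ : Program → State → ℕ → State → Set where
  skip⇓   : ∀ {σ} → skip ▷ σ ⇓[ 1 ] σ
  assign⇓ : ∀ {x e σ} →
            assign x e ▷ σ ⇓[ suc (cost e σ) ] setScalar x (eval e σ) σ
  put⇓    : ∀ {a i e σ} →
            put a i e ▷ σ ⇓[ suc (cost i σ + cost e σ) ]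
              setCell a (eval i σ) (eval e σ) σ
  seq⇓    : ∀ {p q ρ σ τ s t} → p ▷ ρ ⇓[ s ] σ → q ▷ σ ⇓[ t ] τ →
            p ⨾ q ▷ ρ ⇓[ s + t ] τ
  then⇓   : ∀ {e p q σ τ t} → eval e σ ≢ 0 → p ▷ σ ⇓[ t ] τ →
            ite e p q ▷ σ ⇓[ suc (cost e σ + t) ] τ
  else⇓   : ∀ {e p q σ τ t} → eval e σ ≡ 0 → q ▷ σ ⇓[ t ] τ →
            ite e p q ▷ σ ⇓[ suc (cost e σ + t) ] τ
  stop⇓   : ∀ {e p σ} → eval e σ ≡ 0 →
            while e p ▷ σ ⇓[ suc (cost e σ) ] σ
  loop⇓   : ∀ {e p ρ σ τ s t} → eval e ρ ≢ 0 → p ▷ ρ ⇓[ s ] σ →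
            while e p ▷ σ ⇓[ t ] τ →
            while e p ▷ ρ ⇓[ suc (cost e ρ + s + t) ] τ

endpoints : ∀ {n} → List (Fin n × Fin n) → ℕ → ℕ × ℕ
endpoints []             _       = 0 , 0
endpoints ((u , v) ∷ es) zero    = toℕ u , toℕ v
endpoints (e ∷ es)       (suc i) = endpoints es i

-- Variables 0 and 1 hold the numbers of vertices and edges; cell i of
-- arrays 0 and 1 holds the two endpoints of the i-th edge; all other
-- memory is zero.
input : ∀ {n} → Graph n → State
input {n} G = mkState scalars arrays
  where
  scalars : ℕ → ℕ
  scalars 0 = n
  scalars 1 = edgeCount G
  scalars _ = 0

  arrays : ℕ → ℕ → ℕ
  arrays 0 i = proj₁ (endpoints (edges G) i)
  arrays 1 i = proj₂ (endpoints (edges G) i)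
  arrays _ _ = 0

output : State → ℕ
output σ = scalar σ 2

-- t ≤ c · (log n)ᵏ · m^(2/3) · n^(4/3), with both sides cubed.
-- Meaningful for n ≥ 2 only: for n = 1 there are no edges and log n = 0.
TimeBound : (c k n m t : ℕ) → Set
TimeBound c k n m t = t ^ 3 ≤ (c * ⌊log₂ n ⌋ ^ k) ^ 3 * (m ^ 2 * n ^ 4)

{-# OPTIONS --safe #-}
-- A greedy clustering picks centers that each have at least s neighbours outside all earlier
-- clusters, so there are at most n / s of them, and every vertex keeps at most s unclustered
-- neighbours.  Exact searches from all centers settle the case that an endpoint of a diametral
-- pair is clustered: its center has eccentricity at least D − 1.  For an unclustered u we search
-- the graph of the at most 2ns edges with an unclustered endpoint.  That search starts from u at
-- level 0, from the vertices two steps away from u at level 2, and from every clustered w at level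
-- d(center of w, u) + 1.  The resulting labels T satisfy d ≤ T ≤ d + 2, and T = d for unclustered
-- targets with d ≤ 3; hence max (T − 2) (min 4 T) is a lower bound for d, and for T ≥ D it is at
-- least ⌊4D/5⌋.  With s³ ≈ m / n the total time is Õ(n² s + m n / s) = Õ(m^(2/3) n^(4/3)).
module Submission where

open import Data.Bool using (Bool; true; false; T; not; _∧_)
open import Data.Empty using (⊥; ⊥-elim)
open import Data.Fin as Fin using (Fin; toℕ; fromℕ<; combine)
open import Data.Fin.Properties using (toℕ<n; toℕ-injective; toℕ-fromℕ<; injective⇒≤; combine-injective)
open import Data.List using (List; []; _∷_; length; lookup)
open import Data.List.Membership.Propositional using (_∈_)
open import Data.List.Membership.Propositional.Properties using (∈-lookup)
open import Data.List.Relation.Unary.All as All using ([]; _∷_)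
open import Data.List.Relation.Unary.AllPairs using (AllPairs; []; _∷_)
open import Data.List.Relation.Unary.Any using (here; there)
open import Data.Nat
open import Data.Nat.DivMod using (m/n≤m; m<n*o⇒m/o<n)
open import Data.Nat.Logarithm using (⌊log₂_⌋; ⌊log₂⌋-mono-≤; ⌊log₂[2^n]⌋≡n)
open import Data.Nat.Properties
open import Data.Nat.Tactic.RingSolver using (solve-∀)
open import Data.Product using (_×_; _,_; proj₁; proj₂; Σ-syntax; ∃-syntax)
open import Data.Sum using (_⊎_; inj₁; inj₂)
open import Data.Unit using (⊤; tt)
open import Function using (_∘_)
open import Relation.Binary.Definitions using (tri<; tri≈; tri>)
open import Relation.Binary.PropositionalEquality
open import Relation.Nullary using (¬_; yes; no)
open import Defs

-- Finite sums

-- For `D` from 2 to 5 the bound `T ∸ 2` alone falls short of ⌊4D/5⌋. The two-step seeds close this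
-- gap: on a path of length 3 between unclustered vertices only the middle edge can join two
-- clustered ones. Since seeds enter at various levels, a plain breadth-first queue does not
-- suffice, and buckets indexed by level replace it. Every search owns a row of the label and queue
-- arrays, addressed by its graph and its source, so a fresh row is zero and nothing is ever
-- cleared.
--
-- The machine charges bit lengths. All stored numbers stay within a power `W` of 2 that is
-- polynomial in n, hence an elementary step costs at most `unit`, which is of order log n, and the
-- remaining analysis counts steps as credits. Unspent credits are visible to the postcondition;
-- this permits amortisation over adjacency lists instead of a worst case for each vertex. Cube
-- roots never occur: the program finds s by counting upwards, and the time bound is proved with
-- both sides cubed.

S : (ℕ → ℕ) → ℕ → ℕ
S f zero    = 0
S f (suc n) = S f n + f n

S-mono : ∀ {f g} n → (∀ i → i < n → f i ≤ g i) → S f n ≤ S g n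
S-mono zero    h = z≤n
S-mono (suc n) h = +-mono-≤ (S-mono n (λ i i<n → h i (m<n⇒m<1+n i<n))) (h n ≤-refl)

S-cong : ∀ {f g} n → (∀ i → i < n → f i ≡ g i) → S f n ≡ S g n
S-cong n h = ≤-antisym (S-mono n (λ i l → ≤-reflexive (h i l)))
                       (S-mono n (λ i l → ≤-reflexive (sym (h i l))))

S-const : ∀ c n → S (λ _ → c) n ≡ n * c
S-const c zero    = refl
S-const c (suc n) = trans (+-comm (S (λ _ → c) n) c) (cong (c +_) (S-const c n))

S-≤-const : ∀ {f} c n → (∀ i → i < n → f i ≤ c) → S f n ≤ n * c
S-≤-const c n h = ≤-trans (S-mono n h) (≤-reflexive (S-const c n))

S-+ : ∀ f g n → S (λ i → f i + g i) n ≡ S f n + S g n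
S-+ f g zero    = refl
S-+ f g (suc n) rewrite S-+ f g n = lem (S f n) (S g n) (f n) (g n)
  where
  lem : ∀ a b c d → a + b + (c + d) ≡ a + c + (b + d)
  lem = solve-∀

S-*ʳ : ∀ f c n → S (λ i → f i * c) n ≡ S f n * c
S-*ʳ f c zero    = refl
S-*ʳ f c (suc n) rewrite S-*ʳ f c n = sym (*-distribʳ-+ c (S f n) (f n))

S-swap : ∀ (f : ℕ → ℕ → ℕ) m n → S (λ i → S (f i) n) m ≡ S (λ j → S (λ i → f i j) m) n
S-swap f zero    n = sym (trans (S-const 0 n) (*-zeroʳ n))
S-swap f (suc m) n rewrite S-swap f m n = sym (S-+ (λ j → S (λ i → f i j) m) (f m) n)

S-zero : ∀ {f} n → (∀ i → i < n → f i ≡ 0) → S f n ≡ 0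
S-zero n h = trans (S-cong n h) (trans (S-const 0 n) (*-zeroʳ n))

S-prefix : ∀ f {m n} → m ≤ n → S f m ≤ S f n
S-prefix f {n = zero}  z≤n = z≤n
S-prefix f {m} {suc n} m≤1+n with m ≟ suc n
... | yes refl = ≤-refl
... | no  m≢   = ≤-trans (S-prefix f (≤-pred (≤∧≢⇒< m≤1+n m≢))) (m≤m+n _ _)

S-term : ∀ f {i n} → i < n → f i ≤ S f n
S-term f {i} i<n = ≤-trans (m≤n+m (f i) (S f i)) (S-prefix f i<n)

S-inc : ∀ {f g} l d n → (∀ i → i ≢ l → g i ≡ f i) → g l ≤ f l + d → S g n ≤ S f n + d
S-inc l d zero    h p = z≤n
S-inc {f} {g} l d (suc n) h p with n ≟ l
... | yes refl = ≤-trans (+-mono-≤ (≤-reflexive (S-cong n (λ i i<n → h i (<⇒≢ i<n)))) p)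
                         (≤-reflexive (sym (+-assoc (S f n) (f n) d)))
... | no n≢l   = ≤-trans (+-mono-≤ (S-inc l d n h p) (≤-reflexive (h n n≢l)))
                         (≤-reflexive (lem (S f n) d (f n)))
  where
  lem : ∀ a b c → a + b + c ≡ a + c + b
  lem = solve-∀

-- Additive form, since subtraction is truncated. It accounts for the degree that leaves
-- `unlabelled` when a vertex receives its label.
S-dec : ∀ {f g} l d n → l < n → (∀ i → i ≢ l → g i ≡ f i) → g l + d ≡ f l → S g n + d ≡ S f n
S-dec {f} {g} l d (suc n) l<n h p with n ≟ l
... | yes refl = trans (+-assoc (S g n) (g n) d)
                       (cong₂ _+_ (S-cong n (λ i i<n → h i (<⇒≢ i<n))) p)
... | no n≢l   = trans (lem (S g n) (g n) d)
                       (cong₂ _+_ (S-dec l d n (≤∧≢⇒< (≤-pred l<n) (n≢l ∘ sym)) h p) (h n n≢l))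
  where
  lem : ∀ a b c → a + b + c ≡ a + c + b
  lem = solve-∀

-- Updates and pairing

update-same : ∀ {A : Set} i (v : A) f → update i v f i ≡ v
update-same i v f with i ≡ᵇ i | ≡⇒≡ᵇ i i refl
... | true | _ = refl

update-other : ∀ {A : Set} {i j} (v : A) f → i ≢ j → update i v f j ≡ f j
update-other {i = i} {j} v f i≢j with i ≡ᵇ j | ≡ᵇ⇒≡ i j
... | false | _ = refl
... | true  | e = ⊥-elim (i≢j (e tt))

-- Unlike Cantor's pairing this needs no division and leaves gaps. Only injectivity matters, and
-- `pairE` computes it with a constant number of operations.
pair : ℕ → ℕ → ℕ
pair a b = (a + b) * (a + b) + a

-- The codes of pairs with sum x lie between x² and x² + x, and this interval ends before (x + 1)².
pair-< : ∀ {a b c d} → a + b < c + d → pair a b < pair c d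
pair-< {a} {b} {c} {d} l = begin-strict
  (a + b) * (a + b) + a             ≤⟨ +-monoʳ-≤ ((a + b) * (a + b)) (m≤m+n a b) ⟩
  (a + b) * (a + b) + (a + b)       <⟨ n<1+n _ ⟩
  suc ((a + b) * (a + b) + (a + b)) ≤⟨ ≤-trans (m≤m+n _ (a + b)) (≤-reflexive (lem (a + b))) ⟩
  suc (a + b) * suc (a + b)         ≤⟨ *-mono-≤ l l ⟩
  (c + d) * (c + d)                 ≤⟨ m≤m+n _ c ⟩
  pair c d                          ∎
  where
  open ≤-Reasoning
  lem : ∀ x → suc (x * x + x) + x ≡ suc x * suc x
  lem = solve-∀

pair-sum : ∀ {a b c d} → pair a b ≡ pair c d → a + b ≡ c + d
pair-sum {a} {b} {c} {d} e with <-cmp (a + b) (c + d)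
... | tri< l _ _ = ⊥-elim (<⇒≢ (pair-< {a} {b} {c} {d} l) e)
... | tri≈ _ p _ = p
... | tri> _ _ g = ⊥-elim (<⇒≢ (pair-< {c} {d} {a} {b} g) (sym e))

pair-inj₁ : ∀ {a b c d} → pair a b ≡ pair c d → a ≡ c
pair-inj₁ {a} {b} {c} {d} e = +-cancelˡ-≡ ((a + b) * (a + b)) a c
  (trans e (cong (λ x → x * x + c) (sym (pair-sum {a} {b} {c} {d} e))))

pair-inj₂ : ∀ {a b c d} → pair a b ≡ pair c d → b ≡ d
pair-inj₂ {a} {b} {c} {d} e = +-cancelˡ-≡ a b d
  (trans (pair-sum {a} {b} {c} {d} e) (cong (_+ d) (sym (pair-inj₁ {a} {b} {c} {d} e))))

-- Buckets: c b is the size of bucket b, and its elements are it (pair b j) for j < c b.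

module Bucket (c it : ℕ → ℕ) (b x : ℕ) where

  c′ it′ : ℕ → ℕ
  c′  = update b (suc (c b)) c
  it′ = update (pair b (c b)) x it

  c-here : c′ b ≡ suc (c b)
  c-here = update-same b _ c

  c-other : ∀ {b′} → b ≢ b′ → c′ b′ ≡ c b′
  c-other = update-other _ c

  it-new : it′ (pair b (c b)) ≡ x
  it-new = update-same (pair b (c b)) x it

  it-old : ∀ {b′ j} → j < c b′ → it′ (pair b′ j) ≡ it (pair b′ j)
  it-old {b′} {j} j<c = update-other x it λ e →
    <⇒≢ (subst (λ y → j < c y) (sym (pair-inj₁ {b} {c b} {b′} {j} e)) j<c)
        (sym (pair-inj₂ {b} {c b} {b′} {j} e))

  c-grows : ∀ {b′ j} → j < c b′ → j < c′ b′
  c-grows {b′} j<c with b ≟ b′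
  ... | yes refl = subst (_ <_) (sym c-here) (m<n⇒m<1+n j<c)
  ... | no b≢b′  = subst (_ <_) (sym (c-other b≢b′)) j<c

  -- The new element owes `P` only if it enters the bucket in question, so `P` may vary with the
  -- bucket, for instance with the level.
  all-push : (P : ℕ → Set) → ∀ {b′} → (∀ j → j < c b′ → P (it (pair b′ j))) → (b ≡ b′ → P x) →
             ∀ j → j < c′ b′ → P (it′ (pair b′ j))
  all-push P {b′} old new j j<c′ with b ≟ b′
  ... | no b≢b′ = subst P (sym (it-old j<c)) (old j j<c)
    where j<c = subst (j <_) (c-other b≢b′) j<c′
  ... | yes refl with j ≟ c b
  ...   | yes refl = subst P (sym it-new) (new refl)
  ...   | no j≢c   = subst P (sym (it-old j<c)) (old j j<c)
    where j<c = ≤∧≢⇒< (≤-pred (subst (j <_) c-here j<c′)) j≢c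

-- A program logic with time credits

keepsScalar keepsArray : ℕ → Program → Bool
keepsScalar y skip         = true
keepsScalar y (assign x e) = not (x ≡ᵇ y)
keepsScalar y (put a i e)  = true
keepsScalar y (p ⨾ q)      = keepsScalar y p ∧ keepsScalar y q
keepsScalar y (ite e p q)  = keepsScalar y p ∧ keepsScalar y q
keepsScalar y (while e p)  = keepsScalar y p

keepsArray b skip         = true
keepsArray b (assign x e) = true
keepsArray b (put a i e)  = not (a ≡ᵇ b)
keepsArray b (p ⨾ q)      = keepsArray b p ∧ keepsArray b q
keepsArray b (ite e p q)  = keepsArray b p ∧ keepsArray b q
keepsArray b (while e p)  = keepsArray b p

∧-left : ∀ {a b} → T (a ∧ b) → T a
∧-left {true} _ = tt

∧-right : ∀ {a b} → T (a ∧ b) → T b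
∧-right {true} h = h

update-kept : ∀ {A : Set} x y (v : A) f → T (not (x ≡ᵇ y)) → update x v f y ≡ f y
update-kept x y v f h with x ≡ᵇ y
... | false = refl

scalar-kept : ∀ {p σ t τ} y → p ▷ σ ⇓[ t ] τ → T (keepsScalar y p) → scalar τ y ≡ scalar σ y
scalar-kept y skip⇓ h = refl
scalar-kept y (assign⇓ {x} {e} {σ}) h = update-kept x y _ (scalar σ) h
scalar-kept y put⇓ h = refl
scalar-kept y (seq⇓ d d′) h = trans (scalar-kept y d′ (∧-right h)) (scalar-kept y d (∧-left h))
scalar-kept y (then⇓ _ d) h = scalar-kept y d (∧-left h)
scalar-kept y (else⇓ _ d) h = scalar-kept y d (∧-right h)
scalar-kept y (stop⇓ _) h = refl
scalar-kept y (loop⇓ _ d d′) h = trans (scalar-kept y d′ h) (scalar-kept y d h)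

array-kept : ∀ {p σ t τ} b → p ▷ σ ⇓[ t ] τ → T (keepsArray b p) → array τ b ≡ array σ b
array-kept b skip⇓ h = refl
array-kept b assign⇓ h = refl
array-kept b (put⇓ {a} {i} {e} {σ}) h = update-kept a b _ (array σ) h
array-kept b (seq⇓ d d′) h = trans (array-kept b d′ (∧-right h)) (array-kept b d (∧-left h))
array-kept b (then⇓ _ d) h = array-kept b d (∧-left h)
array-kept b (else⇓ _ d) h = array-kept b d (∧-right h)
array-kept b (stop⇓ _) h = refl
array-kept b (loop⇓ _ d d′) h = trans (array-kept b d′ h) (array-kept b d h)

-- The side conditions are implicit because they compute: for a concrete program and name they
-- reduce to `⊤` and are solved by eta.
record Frame (p : Program) (σ τ : State) : Set where
  constructor frame
  field
    scalarOf : ∀ y → {T (keepsScalar y p)} → scalar τ y ≡ scalar σ y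
    arrayOf  : ∀ b → {T (keepsArray b p)} → array τ b ≡ array σ b
open Frame public

-- Counted loops; the bound e is evaluated again before every round.

for : ℕ → Expr → Program → Program
for x e p = assign x (lit 0) ⨾ while (bin lt (var x) e) (p ⨾ assign x (bin add (var x) (lit 1)))

-- Frames refer to the state before the whole loop, so a body can look up any untouched cell without
-- going through the earlier rounds.
frame-seq : ∀ {p σ t τ} x e σ₀ i → Frame (for x e p) σ₀ σ → p ▷ setScalar x i σ ⇓[ t ] τ →
            Frame (for x e p) σ₀ τ
frame-seq {p} {σ} x e σ₀ i fr d = frame
  (λ y {h} → trans (scalar-kept y d (∧-left (∧-right {not (x ≡ᵇ y)} h)))
              (trans (update-kept x y i (scalar σ) (∧-left h)) (scalarOf fr y {h})))
  (λ b {h} → trans (array-kept b d (∧-left h)) (arrayOf fr b {h}))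

-- In memory bounded by W, the value of e is at most W ^ degree e.

degree weight : Expr → ℕ
degree (lit k)     = suc k
degree (var x)     = 1
degree (get a i)   = 1
degree (bin o c d) = degree c + degree d

weight (lit k)     = suc k
weight (var x)     = 1
weight (get a i)   = weight i + 1
weight (bin o c d) = weight c + weight d + (degree c + degree d)

degree>0 : ∀ e → 1 ≤ degree e
degree>0 (lit k)     = s≤s z≤n
degree>0 (var x)     = ≤-refl
degree>0 (get a i)   = ≤-refl
degree>0 (bin o c d) = ≤-trans (degree>0 c) (m≤m+n _ _)

bit≤1 : ∀ b → bit b ≤ 1
bit≤1 true  = ≤-refl
bit≤1 false = z≤n

k<2^k : ∀ k → k < 2 ^ k
k<2^k zero    = s≤s z≤n
k<2^k (suc k) = ≤-trans (+-mono-≤ (m^n>0 2 k) (k<2^k k)) (≤-reflexive (cong (2 ^ k +_) (sym (+-identityʳ _))))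

-- Lets addition be treated like multiplication: the bounds on both operands are at least 2, so the
-- exponents add up in either case.
sum≤product : ∀ {m n} → 2 ≤ m → 2 ≤ n → m + n ≤ m * n
sum≤product {suc (suc m)} {suc (suc n)} (s≤s (s≤s _)) (s≤s (s≤s _)) =
  ≤-trans (m≤m+n _ (m * n + m + n)) (≤-reflexive (lem m n))
  where
  lem : ∀ m n → suc (suc m) + suc (suc n) + (m * n + m + n) ≡ suc (suc m) * suc (suc n)
  lem = solve-∀

bit-≡0 : ∀ m n → ⟦ lt ⟧op m n ≡ 0 → n ≤ m
bit-≡0 m n h with m <ᵇ n | <⇒<ᵇ {m} {n}
... | false | f = ≮⇒≥ f

bit-≢0 : ∀ m n → ⟦ lt ⟧op m n ≢ 0 → m < n
bit-≢0 m n h with m <ᵇ n | <ᵇ⇒< m n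
... | true  | f = f tt
... | false | f = ⊥-elim (h refl)

bit-<  : ∀ {m n} → m < n → ⟦ lt ⟧op m n ≢ 0
bit-< {m} {n} l h = <⇒≱ l (bit-≡0 m n h)

bit-≥  : ∀ {m n} → n ≤ m → ⟦ lt ⟧op m n ≡ 0
bit-≥ {m} {n} l with ⟦ lt ⟧op m n ≟ 0
... | yes p = p
... | no  p = ⊥-elim (<⇒≱ (bit-≢0 m n p) l)

-- The bound 1024 exceeds the weight of every expression in the algorithm.
module Logic (q : ℕ) (1≤q : 1 ≤ q) (unit : ℕ) (unit≥ : 1024 * suc q ≤ unit) where

  W : ℕ
  W = 2 ^ q

  record Bounded (σ : State) : Set where
    constructor bounded
    field
      scalar≤ : ∀ x → scalar σ x ≤ W
      array≤  : ∀ a i → array σ a i ≤ W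
  open Bounded public

  2≤power : ∀ {l} → 1 ≤ l → 2 ≤ 2 ^ (q * l)
  2≤power {l} 1≤l = ^-monoʳ-≤ 2 {1} {q * l} (*-mono-≤ 1≤q 1≤l)

  W≤power : ∀ {v} → v ≤ W → v ≤ 2 ^ (q * 1)
  W≤power {v} h = ≤-trans h (≤-reflexive (cong (2 ^_) (sym (*-identityʳ q))))

  op≤ : ∀ o {m n l r} → 1 ≤ l → 1 ≤ r → m ≤ 2 ^ (q * l) → n ≤ 2 ^ (q * r) →
        ⟦ o ⟧op m n ≤ 2 ^ (q * (l + r))
  op≤ o {m} {n} {l} {r} 1≤l 1≤r hm hn = ≤-trans (go o n hn) (≤-reflexive split)
    where
    a = 2 ^ (q * l)
    b = 2 ^ (q * r)
    split : a * b ≡ 2 ^ (q * (l + r))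
    split = trans (sym (^-distribˡ-+-* 2 (q * l) (q * r))) (cong (2 ^_) (sym (*-distribˡ-+ q l r)))
    1≤ab : 1 ≤ a * b
    1≤ab = *-mono-≤ (m^n>0 2 (q * l)) (m^n>0 2 (q * r))
    m≤ab : m ≤ a * b
    m≤ab = ≤-trans hm (≤-trans (≤-reflexive (sym (*-identityʳ a))) (*-monoʳ-≤ a (m^n>0 2 (q * r))))
    go : ∀ o n → n ≤ b → ⟦ o ⟧op m n ≤ a * b
    go add n       hn = ≤-trans (+-mono-≤ hm hn) (sum≤product (2≤power 1≤l) (2≤power 1≤r))
    go sub n       hn = ≤-trans (m∸n≤m m n) m≤ab
    go mul n       hn = *-mono-≤ hm hn
    go div zero    hn = z≤n
    go div (suc n) hn = ≤-trans (m/n≤m m (suc n)) m≤ab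
    go lt  n       hn = ≤-trans (bit≤1 _) 1≤ab
    go eq  n       hn = ≤-trans (bit≤1 _) 1≤ab

  eval≤ : ∀ e {σ} → Bounded σ → eval e σ ≤ 2 ^ (q * degree e)
  eval≤ (lit k)     B = ≤-trans (<⇒≤ (k<2^k k)) (^-monoʳ-≤ 2 (≤-trans (n≤1+n k)
                          (≤-trans (≤-reflexive (sym (*-identityˡ (suc k)))) (*-monoˡ-≤ (suc k) 1≤q))))
  eval≤ (var x)     B = W≤power (scalar≤ B x)
  eval≤ (get a i)   B = W≤power (array≤ B a _)
  eval≤ (bin o c d) B = op≤ o (degree>0 c) (degree>0 d) (eval≤ c B) (eval≤ d B)

  bits≤ : ∀ {v l} → 1 ≤ l → v ≤ 2 ^ (q * l) → bitLength v ≤ l * suc q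
  bits≤ {v} {l} 1≤l h = ≤-trans (+-mono-≤ 1≤l (≤-trans (⌊log₂⌋-mono-≤ h) (≤-reflexive (⌊log₂[2^n]⌋≡n (q * l)))))
    (≤-reflexive (lem l q))
    where
    lem : ∀ l q → l + q * l ≡ l * suc q
    lem = solve-∀

  bits-eval : ∀ e {σ} → Bounded σ → bitLength (eval e σ) ≤ degree e * suc q
  bits-eval e B = bits≤ (degree>0 e) (eval≤ e B)

  cost≤ : ∀ e {σ} → Bounded σ → cost e σ ≤ weight e * suc q
  cost≤ (lit k)     B = bits-eval (lit k) B
  cost≤ (var x)     B = bits-eval (var x) B
  cost≤ (get a i)   B = ≤-trans (+-mono-≤ (cost≤ i B) (bits-eval (get a i) B))
                          (≤-reflexive (sym (*-distribʳ-+ (suc q) (weight i) 1)))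
  cost≤ e@(bin o c d) B = ≤-trans (+-mono-≤ (+-mono-≤ (cost≤ c B) (cost≤ d B)) (bits-eval e B))
                          (≤-reflexive (lem (weight c) (weight d) (degree e) (suc q)))
    where
    lem : ∀ a b c u → a * u + b * u + c * u ≡ (a + b + c) * u
    lem = solve-∀

  -- The extra 1 is the charge of the statement itself. The comparison with 1024 is a Boolean test,
  -- decided by computation for each concrete expression.
  step≤ : ∀ {t} w → t ≤ w * suc q → T (w <ᵇ 1024) → suc t ≤ unit
  step≤ {t} w h w< = begin
    suc t               ≤⟨ s≤s h ⟩
    1 + w * suc q       ≤⟨ +-monoˡ-≤ (w * suc q) (s≤s z≤n) ⟩
    suc w * suc q       ≤⟨ *-monoˡ-≤ (suc q) (<ᵇ⇒< w 1024 w<) ⟩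
    1024 * suc q        ≤⟨ unit≥ ⟩
    unit                ∎
    where open ≤-Reasoning

  -- One credit pays for one elementary step, whose cost is at most unit.

  record Run (p : Program) (σ : State) (k : ℕ) (Q : ℕ → State → Set) : Set where
    constructor run
    field
      exec : Bounded σ → Σ[ t ∈ ℕ ] Σ[ τ ∈ State ] Σ[ k′ ∈ ℕ ]
             (p ▷ σ ⇓[ t ] τ) × t + k′ * unit ≤ k * unit × Bounded τ × Q k′ τ
  open Run public

  skipR : ∀ {σ k Q} → Q k σ → Run skip σ (suc k) Q
  exec (skipR {σ} {k} h) B = _ , σ , k , skip⇓ , +-monoˡ-≤ (k * unit) (step≤ 0 z≤n tt) , B , h

  setScalar-bounded : ∀ {σ} x {v} → v ≤ W → Bounded σ → Bounded (setScalar x v σ)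
  setScalar-bounded {σ} x {v} h B = bounded go (array≤ B)
    where
    go : ∀ y → update x v (scalar σ) y ≤ W
    go y with x ≡ᵇ y
    ... | true  = h
    ... | false = scalar≤ B y

  setCell-bounded : ∀ {σ} a i {v} → v ≤ W → Bounded σ → Bounded (setCell a i v σ)
  setCell-bounded {σ} a i {v} h B = bounded (scalar≤ B) go
    where
    go : ∀ b j → update a (update i v (array σ a)) (array σ) b j ≤ W
    go b j with a ≡ᵇ b
    ... | false = array≤ B b j
    ... | true with i ≡ᵇ j
    ...   | true  = h
    ...   | false = array≤ B a j

  -- Intermediate values may reach powers of `W`; only what is stored has to stay within `W`. The
  -- value `v` is passed along with an equation so that the postcondition shows the intended number
  -- and not an unfolded evaluation.
  assignR : ∀ {x e σ k Q} v {_ : T (weight e <ᵇ 1024)} → eval e σ ≡ v → (Bounded σ → v ≤ W) →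
            Q k (setScalar x v σ) → Run (assign x e) σ (suc k) Q
  exec (assignR {x} {e} {σ} {k} v {w} refl h Qv) B =
    _ , _ , k , assign⇓ , +-monoˡ-≤ (k * unit) (step≤ (weight e) (cost≤ e B) w) ,
    setScalar-bounded x (h B) B , Qv

  putR : ∀ {a i e σ k Q} j v {_ : T (weight i + weight e <ᵇ 1024)} → eval i σ ≡ j → eval e σ ≡ v →
         (Bounded σ → v ≤ W) → Q k (setCell a j v σ) → Run (put a i e) σ (suc k) Q
  exec (putR {a} {i} {e} {σ} {k} j v {w} refl refl h Qv) B =
    _ , _ , k , put⇓ , +-monoˡ-≤ (k * unit) (step≤ (weight i + weight e)
      (≤-trans (+-mono-≤ (cost≤ i B) (cost≤ e B))
        (≤-reflexive (sym (*-distribʳ-+ (suc q) (weight i) (weight e))))) w) ,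
    setCell-bounded a j (h B) B , Qv

  seqR : ∀ {p r σ k Q} → Run p σ k (λ k′ τ → Run r τ k′ Q) → Run (p ⨾ r) σ k Q
  exec (seqR h) B with exec h B
  ... | t , τ , k′ , d , l , B′ , h′ with exec h′ B′
  ... | t′ , τ′ , k″ , d′ , l′ , B″ , Qτ =
    _ , τ′ , k″ , seq⇓ d d′ ,
    ≤-trans (≤-reflexive (+-assoc t t′ _)) (≤-trans (+-monoʳ-≤ t l′) l) , B″ , Qτ

  ite-cost : ∀ {c t x y} → suc c ≤ unit → t + x ≤ y → suc (c + t) + x ≤ unit + y
  ite-cost {c} {t} {x} {y} h l = ≤-trans (≤-reflexive (cong suc (+-assoc c t x))) (+-mono-≤ h l)

  iteR : ∀ {e p r σ k Q} {_ : T (weight e <ᵇ 1024)} → (eval e σ ≢ 0 → Run p σ k Q) →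
         (eval e σ ≡ 0 → Run r σ k Q) → Run (ite e p r) σ (suc k) Q
  exec (iteR {e} {p} {r} {σ} {k} {Q} {w} ht he) B with eval e σ ≟ 0
  ... | yes z with exec (he z) B
  ...   | t , τ , k′ , d , l , B′ , Qτ = _ , τ , k′ , else⇓ z d , ite-cost
        (step≤ (weight e) (cost≤ e B) w) l , B′ , Qτ
  exec (iteR {e} {p} {r} {σ} {k} {Q} {w} ht he) B | no nz with exec (ht nz) B
  ...   | t , τ , k′ , d , l , B′ , Qτ = _ , τ , k′ , then⇓ nz d , ite-cost
        (step≤ (weight e) (cost≤ e B) w) l , B′ , Qτ

  weakR : ∀ {p σ k k′ Q} → k′ ≤ k → Run p σ k′ Q → Run p σ k Q
  exec (weakR h r) B with exec r B
  ... | t , τ , k′ , d , l , B′ , Qτ = t , τ , k′ , d , ≤-trans l (*-monoˡ-≤ unit h) , B′ , Qτ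

  frameR : ∀ {p σ k Q Q′} → Run p σ k Q → (∀ k′ τ → Frame p σ τ → Q k′ τ → Q′ k′ τ) → Run p σ k Q′
  exec (frameR r h) B with exec r B
  ... | t , τ , k′ , d , l , B′ , Qτ =
    t , τ , k′ , d , l , B′ , h k′ τ (frame (λ y {w} → scalar-kept y d w) (λ b {w} → array-kept b d w)) Qτ

  -- Round i brings `a i` fresh credits on top of those recorded by the invariant, which may
  -- therefore save or spend credits across rounds. Two more credits per round pay for the test and
  -- the increment.
  module _ (x : ℕ) (e : Expr) (p : Program) (σ : State) (N : ℕ) (a : ℕ → ℕ) (I : ℕ → ℕ → State → Set)
           (wt : T (weight (bin lt (var x) e) <ᵇ 1024)) (x-kept : T (keepsScalar x p)) (N≤W : N ≤ W)
           (bound : ∀ i k τ → i ≤ N → Frame (for x e p) σ τ → I i k τ → eval e (setScalar x i τ) ≡ N)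
           (body : ∀ i k τ → i < N → Frame (for x e p) σ τ → I i k τ →
                   Run p (setScalar x i τ) (a i + k) (I (suc i))) where

    private
      test = bin lt (var x) e
      next = assign x (bin add (var x) (lit 1))

    rounds : ℕ → ℕ → ℕ
    rounds i zero    = 0
    rounds i (suc j) = 2 + a i + rounds (suc i) j

    rounds-S : ∀ i j → S (λ i → 2 + a i) i + rounds i j ≡ S (λ i → 2 + a i) (i + j)
    rounds-S i zero    = trans (+-identityʳ _) (cong (S (λ i → 2 + a i)) (sym (+-identityʳ i)))
    rounds-S i (suc j) = trans (sym (+-assoc (S (λ i → 2 + a i) i) (2 + a i) (rounds (suc i) j)))
      (trans (rounds-S (suc i) j) (cong (S (λ i → 2 + a i)) (sym (+-suc i j))))

    eval-test : ∀ i k τ → i ≤ N → Frame (for x e p) σ τ → I i k τ →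
                eval test (setScalar x i τ) ≡ ⟦ lt ⟧op i N
    eval-test i k τ i≤N fr Iτ = cong₂ ⟦ lt ⟧op (update-same x i (scalar τ)) (bound i k τ i≤N fr Iτ)

    -- Loop states have the form `setScalar x i τ` with the invariant stated for `τ`, so no
    -- invariant has to mention the counter.
    iterate : ∀ j i k τ → j + i ≡ N → Frame (for x e p) σ τ → I i k τ → Bounded (setScalar x i τ) →
              Σ[ t ∈ ℕ ] Σ[ τ′ ∈ State ] Σ[ k′ ∈ ℕ ]
              (while test (p ⨾ next) ▷ setScalar x i τ ⇓[ t ] setScalar x N τ′) ×
              t + k′ * unit ≤ (1 + rounds i j + k) * unit ×
              Bounded (setScalar x N τ′) × Frame (for x e p) σ τ′ × I N k′ τ′
    iterate zero i k τ refl fr Iτ B =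
      _ , τ , k , stop⇓ (trans (eval-test i k τ ≤-refl fr Iτ) (bit-≥ {i} {i} ≤-refl)) ,
      +-monoˡ-≤ (k * unit) (step≤ (weight test) (cost≤ test B) wt) , B , fr , Iτ
    iterate (suc j) i k τ j+i≡N fr Iτ B
      with exec (body i k τ i<N fr Iτ) B
      where i<N = ≤-trans (s≤s (m≤n+m i j)) (≤-reflexive j+i≡N)
    ... | t , τ₁ , k₁ , d , l , B₁ , I₁ with x≡i ← trans (scalar-kept x d x-kept) (update-same x i (scalar τ))
        with exec (assignR {x} {bin add (var x) (lit 1)}
          {τ₁} {k₁} {λ k′ τ′ → τ′ ≡ setScalar x (suc i) τ₁ × k₁ ≡ k′} (suc i) (trans (cong (_+ 1) x≡i) (+-comm i 1))
                    (λ _ → ≤-trans (≤-trans (s≤s (m≤n+m i j)) (≤-reflexive j+i≡N)) N≤W) (refl , refl)) B₁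
    ... | t₂ , _ , _ , d₂ , l₂ , B₂ , refl , refl
        with iterate j (suc i) k₁ τ₁ (trans (+-suc j i) j+i≡N) (frame-seq x e σ i fr d) I₁ B₂
    ... | t₃ , τ₃ , k₃ , d₃ , l₃ , B₃ , fr₃ , I₃ =
      _ , τ₃ , k₃ , loop⇓ (λ z → bit-< i<N (trans (sym (eval-test i k τ (<⇒≤ i<N) fr Iτ)) z)) (seq⇓ d d₂) d₃ ,
      total , B₃ , fr₃ , I₃
      where
      i<N = ≤-trans (s≤s (m≤n+m i j)) (≤-reflexive j+i≡N)
      c = cost test (setScalar x i τ)
      c≤ : suc c ≤ unit
      c≤ = step≤ (weight test) (cost≤ test B) wt
      R = rounds (suc i) j
      open ≤-Reasoning
      t₂≤ : t₂ ≤ unit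
      t₂≤ = +-cancelʳ-≤ (k₁ * unit) t₂ unit l₂
      lem₁ : ∀ c t t₂ t₃ k → suc (c + (t + t₂) + t₃) + k ≡ suc c + (t + t₂) + (t₃ + k)
      lem₁ = solve-∀
      lem₂ : ∀ u t R k → u + (t + u) + (1 + R + k) * u ≡ u + u + u + R * u + (t + k * u)
      lem₂ = solve-∀
      lem₃ : ∀ u R a k → u + u + u + R * u + (a + k) * u ≡ (1 + (2 + a + R) + k) * u
      lem₃ = solve-∀
      total : suc (c + (t + t₂) + t₃) + k₃ * unit ≤ (1 + (2 + a i + R) + k) * unit
      total = begin
        suc (c + (t + t₂) + t₃) + k₃ * unit             ≡⟨ lem₁ c t t₂ t₃ (k₃ * unit) ⟩
        suc c + (t + t₂) + (t₃ + k₃ * unit)             ≤⟨ +-mono-≤ (+-mono-≤ c≤ (+-monoʳ-≤ t t₂≤)) l₃ ⟩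
        unit + (t + unit) + (1 + R + k₁) * unit         ≡⟨ lem₂ unit t R k₁ ⟩
        unit + unit + unit + R * unit + (t + k₁ * unit) ≤⟨ +-monoʳ-≤ _ l ⟩
        unit + unit + unit + R * unit + (a i + k) * unit ≡⟨ lem₃ unit R (a i) k ⟩
        (1 + (2 + a i + R) + k) * unit                  ∎

    loop : ∀ {Q k} → I 0 k σ →
           (∀ k′ τ → Frame (for x e p) σ τ → I N k′ τ → Q k′ (setScalar x N τ)) →
           Run (for x e p) σ (2 + S (λ i → 2 + a i) N + k) Q
    exec (loop {Q} {k} I₀ done) B
      with iterate N 0 k σ (+-identityʳ N) (frame (λ _ → refl) (λ _ → refl)) I₀ (setScalar-bounded x z≤n B)
    ... | t , τ , k′ , d , l , B′ , fr , Iτ = _ , _ , k′ , seq⇓ assign⇓ d , total , B′ , done k′ τ fr Iτ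
      where
      open ≤-Reasoning
      total : suc (cost (lit 0) σ) + t + k′ * unit ≤ (2 + S (λ i → 2 + a i) N + k) * unit
      total = begin
        suc (cost (lit 0) σ) + t + k′ * unit    ≡⟨ +-assoc (suc (cost (lit 0) σ)) t _ ⟩
        suc (cost (lit 0) σ) + (t + k′ * unit)  ≤⟨ +-mono-≤ (step≤ 1 (cost≤ (lit 0) B) tt) l ⟩
        unit + (1 + rounds 0 N + k) * unit      ≡⟨ cong (λ r → unit + (1 + r + k) * unit) (rounds-S 0 N) ⟩
        (2 + S (λ i → 2 + a i) N + k) * unit    ∎

  forR : ∀ {x e p σ k Q} (N : ℕ) (a : ℕ → ℕ) (I : ℕ → ℕ → State → Set)
         {_ : T (weight (bin lt (var x) e) <ᵇ 1024)} {_ : T (keepsScalar x p)} → N ≤ W →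
         (∀ i k τ → i ≤ N → Frame (for x e p) σ τ → I i k τ → eval e (setScalar x i τ) ≡ N) →
         I 0 k σ →
         (∀ i k τ → i < N → Frame (for x e p) σ τ → I i k τ → Run p (setScalar x i τ) (a i + k) (I (suc i))) →
         (∀ k′ τ → Frame (for x e p) σ τ → I N k′ τ → Q k′ (setScalar x N τ)) →
         Run (for x e p) σ (2 + S (λ i → 2 + a i) N + k) Q
  forR {x} {e} {p} {σ} N a I {wt} {kept} N≤W bound I₀ body done =
    loop x e p σ N a I wt kept N≤W bound body I₀ done

  forC : ∀ {x e p σ k Q} (N a : ℕ) (I : ℕ → ℕ → State → Set)
         {_ : T (weight (bin lt (var x) e) <ᵇ 1024)} {_ : T (keepsScalar x p)} → N ≤ W →
         (∀ i k τ → i ≤ N → Frame (for x e p) σ τ → I i k τ → eval e (setScalar x i τ) ≡ N) →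
         I 0 k σ →
         (∀ i k τ → i < N → Frame (for x e p) σ τ → I i k τ → Run p (setScalar x i τ) (a + k) (I (suc i))) →
         (∀ k′ τ → Frame (for x e p) σ τ → I N k′ τ → Q k′ (setScalar x N τ)) →
         Run (for x e p) σ (2 + (N * (2 + a) + k)) Q
  forC {k = k} N a I {wt} {kept} N≤W bound I₀ body done =
    weakR (≤-reflexive (cong (λ c → 2 + (c + k)) (S-const (2 + a) N)))
      (forR N (λ _ → a) I {wt} {kept} N≤W bound I₀ body done)

  -- Postconditions name an exact number of remaining credits. A surplus can be discarded, because
  -- fewer credits only weaken the inequality on time.
  dropR : ∀ {p σ k Q} k₀ → Run p σ k (λ k′ τ → k₀ ≤ k′ × Q k₀ τ) → Run p σ k Q
  exec (dropR k₀ r) B with exec r B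
  ... | t , τ , k′ , d , l , B′ , k₀≤ , Qτ =
    t , τ , k₀ , d , ≤-trans (+-monoʳ-≤ t (*-monoˡ-≤ unit k₀≤)) l , B′ , Qτ

-- Bucket queues

-- Scalars: 3 the cluster size s; 4 the row of the current search; 5 its graph; 6, 7 the level and
-- the vertex to push; 10–13 and 20–23 loop variables and temporaries.  Arrays: 2 the adjacency
-- matrix; 3 one plus the center of a vertex; 4 the indicator of centers; 5, 6 lengths and items of
-- adjacency lists; 7 one plus the label of a vertex; 8, 9 lengths and items of the queue.

pairE : Expr → Expr → Expr
pairE a b = bin add (bin mul (bin add a b) (bin add a b)) a

push : Program
push = put 9 (pairE (pairE (var 4) (var 6)) (get 8 (pairE (var 4) (var 6)))) (var 7)
     ⨾ put 8 (pairE (var 4) (var 6)) (bin add (get 8 (pairE (var 4) (var 6))) (lit 1))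

scan : Program
scan = for 23 (get 5 (pairE (var 5) (var 22)))
         ( assign 6 (bin add (var 20) (lit 1))
         ⨾ assign 7 (get 6 (pairE (pairE (var 5) (var 22)) (var 23)))
         ⨾ push )

-- A vertex may wait in several buckets. A stale copy is recognised by its nonzero label and
-- skipped, which replaces any operation that would move a vertex to an earlier bucket.
visit : Program
visit = assign 22 (get 9 (pairE (pairE (var 4) (var 20)) (var 21)))
      ⨾ ite (get 7 (pairE (var 4) (var 22))) skip
          ( put 7 (pairE (var 4) (var 22)) (bin add (var 20) (lit 1)) ⨾ scan )

-- Levels up to `n + 2` cover every distance with an error of 2, and also the levels up to 3 needed
-- for exactness when n is tiny.
dial : Program
dial = for 20 (bin add (var 0) (lit 3)) (for 21 (get 8 (pairE (var 4) (var 20))) visit)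

-- Invariant and potential of a bucket queue search

isZero : ℕ → ℕ
isZero zero    = 1
isZero (suc _) = 0

pushed : State → ℕ → ℕ → ℕ → State
pushed σ row k x = setCell 8 b (suc (array σ 8 b)) (setCell 9 (pair b (array σ 8 b)) x σ)
  where b = pair row k

-- `Good k v` stands for a walk of length k from the source to v, and `Ob k x` for x being seeded at
-- level k. Both stay abstract, so that one invariant serves the searches from centers and those in
-- the sparse graph.
module Queue (row g n cap : ℕ) (dg ad : ℕ → ℕ) (Good Ob : ℕ → ℕ → Set)
  (good-step : ∀ {k v i} → Good k v → i < dg (pair g v) → Good (suc k) (ad (pair (pair g v) i)))
  where

  at : ℕ → ℕ
  at = pair row

  at-inj : ∀ {k l} → at k ≡ at l → k ≡ l
  at-inj {k} {l} = pair-inj₂ {row} {k} {row} {l}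

  Reach : (d : ℕ → ℕ) → ℕ → ℕ → Set
  Reach d k x = Σ[ l ∈ ℕ ] l ≤ k × d (at x) ≡ suc l

  Pending : (ℓ j : ℕ) (c it : ℕ → ℕ) → ℕ → ℕ → Set
  Pending ℓ j c it k x = Σ[ i ∈ ℕ ] i < c (at k) × it (pair (at k) i) ≡ x × (ℓ < k ⊎ (ℓ ≡ k × j ≤ i))

  -- A promise that x gets a label of at most k: either kept already, or backed by a queue entry
  -- that is still to be popped. When the levels run out, only the first case is left for levels
  -- below the last.
  Sat : (ℓ j : ℕ) (d c it : ℕ → ℕ) → ℕ → ℕ → Set
  Sat ℓ j d c it k x = Reach d k x ⊎ Pending ℓ j c it k x

  Scanned : Set₁
  Scanned = ℕ → ℕ → Set

  everything : Scanned
  everything _ _ = ⊤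

  -- Invariant while element j of bucket ℓ is next, except that only the list positions allowed
  -- by Scan have been pushed.
  record Inv (ℓ j : ℕ) (Scan : Scanned) (d c it : ℕ → ℕ) : Set where
    constructor inv
    field
      buckets : ∀ k i → i < c (at k) → Good k (it (pair (at k) i))
      labels  : ∀ v k → d (at v) ≡ suc k → Good k v × k ≤ ℓ
      oblig   : ∀ k x → Ob k x → Sat ℓ j d c it k x
      closed  : ∀ v k i → d (at v) ≡ suc k → i < dg (pair g v) → Scan v i →
                Sat ℓ j d c it (suc k) (ad (pair (pair g v) i))
  open Inv public

  except : ℕ → ℕ → Scanned
  except v i v′ i′ = v ≡ v′ → i′ < i

  -- Only the entry just popped stops backing a promise, and its vertex then has a label of at most
  -- ℓ.
  pop-sat : ∀ {ℓ j d d′ c it} → (∀ {k x} → Reach d k x → Reach d′ k x) → Reach d′ ℓ (it (pair (at ℓ) j)) →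
            ∀ {k x} → Sat ℓ j d c it k x → Sat ℓ (suc j) d′ c it k x
  pop-sat mono new (inj₁ r) = inj₁ (mono r)
  pop-sat mono new (inj₂ (i , i< , e , inj₁ ℓ<k)) = inj₂ (i , i< , e , inj₁ ℓ<k)
  pop-sat {j = j} {d′ = d′} mono new (inj₂ (i , i< , e , inj₂ (refl , j≤i))) with j ≟ i
  ... | yes refl = inj₁ (subst (Reach d′ _) e new)
  ... | no j≢i   = inj₂ (i , i< , e , inj₂ (refl , ≤∧≢⇒< j≤i j≢i))

  -- This is where `labels` must bound labels by the current level: the label found on a stale copy
  -- then satisfies the promise that the copy was backing.
  inv-skip : ∀ {ℓ j d c it l} → Inv ℓ j everything d c it → d (at (it (pair (at ℓ) j))) ≡ suc l →
             Inv ℓ (suc j) everything d c it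
  inv-skip {ℓ} {j} {d} {c} {it} {l} I e = inv (buckets I) (labels I)
    (λ k x o → next (oblig I k x o)) (λ v k i e i< s → next (closed I v k i e i< s))
    where
    next = pop-sat {ℓ} {j} {d} {d} {c} {it} (λ r → r) (l , proj₂ (labels I _ l e) , e)

  mark : (ℕ → ℕ) → ℕ → ℕ → ℕ → ℕ
  mark d v ℓ = update (at v) (suc ℓ) d

  mark-cases : ∀ {d v ℓ} v′ k → mark d v ℓ (at v′) ≡ suc k → (v ≡ v′ × ℓ ≡ k) ⊎ (v ≢ v′ × d (at v′) ≡ suc k)
  mark-cases {d} {v} {ℓ} v′ k e with v ≟ v′
  ... | yes refl = inj₁ (refl , suc-injective (trans (sym (update-same (at v) (suc ℓ) d)) e))
  ... | no v≢    = inj₂ (v≢ , trans (sym (update-other (suc ℓ) d (v≢ ∘ at-inj))) e)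

  inv-mark : ∀ {ℓ j d c it} → Inv ℓ j everything d c it → let v = it (pair (at ℓ) j) in
             d (at v) ≡ 0 → j < c (at ℓ) → Inv ℓ (suc j) (except v 0) (mark d v ℓ) c it
  inv-mark {ℓ} {j} {d} {c} {it} I e j<c = inv (buckets I) labels′ (λ k x o → next (oblig I k x o)) closed′
    where
    v = it (pair (at ℓ) j)
    mono : ∀ {k x} → Reach d k x → Reach (mark d v ℓ) k x
    mono {k} {x} (l , l≤ , r) = l , l≤ , trans (update-other (suc ℓ) d v≢x) r
      where
      v≢x : at v ≢ at x
      v≢x p = 1+n≢0 (trans (sym r) (trans (cong d (sym p)) e))
    next = pop-sat {ℓ} {j} {d} {mark d v ℓ} {c} {it} mono (ℓ , ≤-refl , update-same (at v) (suc ℓ) d)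
    labels′ : ∀ v′ k → mark d v ℓ (at v′) ≡ suc k → Good k v′ × k ≤ ℓ
    labels′ v′ k p with mark-cases {d} {v} {ℓ} v′ k p
    ... | inj₁ (refl , refl) = buckets I ℓ j j<c , ≤-refl
    ... | inj₂ (_ , p′)      = labels I v′ k p′
    closed′ : ∀ v′ k i → mark d v ℓ (at v′) ≡ suc k → i < dg (pair g v′) → except v 0 v′ i →
              Sat ℓ (suc j) (mark d v ℓ) c it (suc k) (ad (pair (pair g v′) i))
    closed′ v′ k i p i< s with mark-cases {d} {v} {ℓ} v′ k p
    ... | inj₁ (v≡ , _) with () ← s v≡
    ... | inj₂ (_ , p′) = next (closed I v′ k i p′ i< tt)

  push-sat : ∀ {ℓ j d c it b x k y} → Sat ℓ j d c it k y →
             Sat ℓ j d (Bucket.c′ c it b x) (Bucket.it′ c it b x) k y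
  push-sat (inj₁ r) = inj₁ r
  push-sat {c = c} {it} {b} {x} {k} (inj₂ (i , i< , e , o)) =
    inj₂ (i , Bucket.c-grows c it b x i< , trans (Bucket.it-old c it b x i<) e , o)

  push-new : ∀ {ℓ j d c it x k} → ℓ < k → Sat ℓ j d (Bucket.c′ c it (at k) x) (Bucket.it′ c it (at k) x) k x
  push-new {c = c} {it} {x} {k} ℓ<k =
    inj₂ (c (at k) , subst (c (at k) <_) (sym (Bucket.c-here c it (at k) x)) ≤-refl , Bucket.it-new c it
      (at k) x , inj₁ ℓ<k)

  buckets-push : ∀ {c it k x} → (∀ k i → i < c (at k) → Good k (it (pair (at k) i))) → Good k x →
                 ∀ k′ i → i < Bucket.c′ c it (at k) x (at k′) → Good k′ (Bucket.it′ c it (at k) x (pair (at k′) i))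
  buckets-push {c} {it} {k} {x} old new k′ =
    Bucket.all-push c it (at k) x (Good k′) (old k′) (λ e → subst (λ l → Good l x) (at-inj e) new)

  inv-push : ∀ {ℓ j d c it v i} → Inv ℓ j (except v i) d c it → d (at v) ≡ suc ℓ → i < dg (pair g v) →
             let x = ad (pair (pair g v) i) in
             Inv ℓ j (except v (suc i)) d (Bucket.c′ c it (at (suc ℓ)) x) (Bucket.it′ c it (at (suc ℓ)) x)
  inv-push {ℓ} {j} {d} {c} {it} {v} {i} I e i< =
    inv (buckets-push {c} {it} (buckets I) (good-step (proj₁ (labels I v ℓ e)) i<)) (labels I)
        (λ k x o → push-sat {d = d} {c} {it} (oblig I k x o)) closed′
    where
    x = ad (pair (pair g v) i)
    closed′ : ∀ v′ k i′ → d (at v′) ≡ suc k → i′ < dg (pair g v′) → except v (suc i) v′ i′ →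
              Sat ℓ j d (Bucket.c′ c it (at (suc ℓ)) x) (Bucket.it′ c it (at (suc ℓ)) x) (suc k)
                (ad (pair (pair g v′) i′))
    closed′ v′ k i′ e′ i′< s with v ≟ v′
    ... | no v≢ = push-sat {d = d} {c} {it} (closed I v′ k i′ e′ i′< (λ v≡ → ⊥-elim (v≢ v≡)))
    ... | yes refl with i′ ≟ i
    ...   | no i≢ = push-sat {d = d} {c} {it} (closed I v k i′ e′ i′< (λ _ → ≤∧≢⇒< (≤-pred (s refl)) i≢))
    ...   | yes refl with refl ← suc-injective (trans (sym e) e′) = push-new {d = d} {c} {it} ≤-refl

  inv-scanned : ∀ {ℓ j d c it v} → Inv ℓ j (except v (dg (pair g v))) d c it → Inv ℓ j everything d c it
  inv-scanned I = inv (buckets I) (labels I) (oblig I) (λ v k i e i< _ → closed I v k i e i< (λ { refl → i< }))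

  inv-next : ∀ {ℓ d c it} → Inv ℓ (c (at ℓ)) everything d c it → Inv (suc ℓ) 0 everything d c it
  inv-next {ℓ} {d} {c} {it} I = inv (buckets I)
    (λ v k e → proj₁ (labels I v k e) , m≤n⇒m≤1+n (proj₂ (labels I v k e)))
    (λ k x o → next (oblig I k x o)) (λ v k i e i< s → next (closed I v k i e i< s))
    where
    next : ∀ {k x} → Sat ℓ (c (at ℓ)) d c it k x → Sat (suc ℓ) 0 d c it k x
    next (inj₁ r) = inj₁ r
    next {k} (inj₂ (i , i< , e , inj₂ (refl , c≤i))) = ⊥-elim (<⇒≱ i< c≤i)
    next {k} (inj₂ (i , i< , e , inj₁ ℓ<k)) with suc ℓ ≟ k
    ... | yes p = inj₂ (i , i< , e , inj₂ (p , z≤n))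
    ... | no p  = inj₂ (i , i< , e , inj₁ (≤∧≢⇒< ℓ<k p))

  reached : ∀ {ℓ d c it k x} → Sat ℓ 0 d c it k x → k < ℓ → Reach d k x
  reached (inj₁ r) _ = r
  reached (inj₂ (_ , _ , _ , inj₁ ℓ<k)) k<ℓ = ⊥-elim (<-asym ℓ<k k<ℓ)
  reached (inj₂ (_ , _ , _ , inj₂ (refl , _))) k<ℓ = ⊥-elim (<-irrefl refl k<ℓ)

  -- Every further push comes from scanning a vertex that is still unlabelled, so the sum of these
  -- two never grows; it bounds the queue for good. Bucket `cap` is included since the last level
  -- still pushes into it.
  entries unlabelled : (ℕ → ℕ) → ℕ
  entries c    = S (λ k → c (at k)) (suc cap)
  unlabelled d = S (λ v → isZero (d (at v)) * dg (pair g v)) n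

  entries-push : ∀ c it k x → entries (Bucket.c′ c it (at k) x) ≤ suc (entries c)
  entries-push c it k x = ≤-trans
    (S-inc k 1 (suc cap) (λ i i≢ → Bucket.c-other c it (at k) x (λ e → i≢ (sym (at-inj e))))
      (≤-reflexive (trans (Bucket.c-here c it (at k) x) (+-comm 1 (c (at k))))))
    (≤-reflexive (+-comm (entries c) 1))

  entry≤ : ∀ c k → k ≤ cap → c (at k) ≤ entries c
  entry≤ c k k≤ = S-term (λ k → c (at k)) (s≤s k≤)

  unlabelled-mark : ∀ d v ℓ → v < n → d (at v) ≡ 0 → unlabelled (mark d v ℓ) + dg (pair g v) ≡ unlabelled d
  unlabelled-mark d v ℓ v<n e = S-dec v (dg (pair g v)) n v<n
    (λ i i≢ → cong (λ y → isZero y * dg (pair g i)) (update-other (suc ℓ) d (λ p → i≢ (sym (at-inj p)))))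
    (trans (cong (λ y → isZero y * dg (pair g v) + dg (pair g v)) (update-same (at v) (suc ℓ) d))
      (trans (sym (+-identityʳ _)) (cong (λ y → isZero y * dg (pair g v)) (sym e))))

  -- The isolation between searches: finished rows keep their labels, and rows not yet started stay
  -- blank.
  SameOff : (f f₀ : ℕ → ℕ) → Set
  SameOff f f₀ = ∀ r k → r ≢ row → f (pair r k) ≡ f₀ (pair r k)

  off-update : ∀ {f f₀ k v} → SameOff f f₀ → SameOff (update (at k) v f) f₀
  off-update {f} {f₀} {k} {v} h r l r≢ = trans (update-other v f (λ e → r≢ (sym (pair-inj₁ {row} {k} {r} {l} e))))
    (h r l r≢)

-- Credits for a bucket queue search

module DialRun (q : ℕ) (1≤q : 1 ≤ q) (unit : ℕ) (unit≥ : 1024 * suc q ≤ unit) where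
  open Logic q 1≤q unit unit≥

  pushR : ∀ {σ k Q} row l x → scalar σ 4 ≡ row → scalar σ 6 ≡ l → scalar σ 7 ≡ x →
          suc (array σ 8 (pair row l)) ≤ W → Q k (pushed σ row l x) → Run push σ (2 + k) Q
  pushR {σ} row l x refl refl refl fits h =
    seqR (putR {a = 9} _ _ refl refl (λ B → scalar≤ B 7)
      (putR {a = 8} _ _ refl (+-comm (array σ 8 (pair row l)) 1) (λ _ → fits) h))

  module _ (row g n : ℕ) (dg ad : ℕ → ℕ) (Good Ob : ℕ → ℕ → Set)
    (good-step : ∀ {k v i} → Good k v → i < dg (pair g v) → Good (suc k) (ad (pair (pair g v) i)))
    (good-< : ∀ {k v} → Good k v → v < n) (dg≤ : ∀ v → dg (pair g v) ≤ n)
    (total : ℕ) (total≤ : total ≤ W) (cap≤ : n + 3 ≤ W) where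

    open Queue row g n (n + 3) dg ad Good Ob good-step

    Fixed : State → Set
    Fixed σ = scalar σ 0 ≡ n × scalar σ 4 ≡ row × scalar σ 5 ≡ g × array σ 5 ≡ dg × array σ 6 ≡ ad

    fixed : ∀ {p σ τ} → Frame p σ τ → {T (keepsScalar 0 p)} → {T (keepsScalar 4 p)} → {T (keepsScalar 5 p)} →
            {T (keepsArray 5 p)} → {T (keepsArray 6 p)} → Fixed σ → Fixed τ
    fixed fr {h₀} {h₄} {h₅} {k₅} {k₆} (e₀ , e₄ , e₅ , a₅ , a₆) =
      trans (scalarOf fr 0 {h₀}) e₀ , trans (scalarOf fr 4 {h₄}) e₄ , trans (scalarOf fr 5 {h₅}) e₅ ,
      trans (arrayOf fr 5 {k₅}) a₅ , trans (arrayOf fr 6 {k₆}) a₆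

    module _ (d₀ c₀ : ℕ → ℕ) where

      scanR : ∀ {σ Q} ℓ j v k → ℓ < n + 3 → Fixed σ → scalar σ 20 ≡ ℓ → scalar σ 22 ≡ v →
        Inv ℓ j (except v 0) (array σ 7) (array σ 8) (array σ 9) → array σ 7 (at v) ≡ suc ℓ →
        entries (array σ 8) + (unlabelled (array σ 7) + dg (pair g v)) ≤ total →
        SameOff (array σ 8) c₀ →
        (∀ τ → Frame scan σ τ → Inv ℓ j everything (array τ 7) (array τ 8) (array τ 9) →
          entries (array τ 8) + unlabelled (array τ 7) ≤ total →
          SameOff (array τ 8) c₀ → (∀ l → l ≤ ℓ → array τ 8 (at l) ≡ array σ 8 (at l)) → Q k τ) →
        Run scan σ (2 + (dg (pair g v) * 6 + k)) Q
      scanR {σ} {Q} ℓ j v k ℓ< fx e₂₀ e₂₂ I₀ lab ent off done = frameR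
        (forC {Q = L N} N 4 L (≤-trans (dg≤ v) (≤-trans (m≤m+n n 3) cap≤)) bound
          (refl , I₀ , ≤-trans ent (m≤m+n total 0) , off , λ _ _ → refl) body (λ _ _ _ h → h))
        finish
        where
        N = dg (pair g v)
        d = array σ 7
        Post : ℕ → State → Set
        -- The list length `N` left `unlabelled` at once when v was marked, while the entries appear
        -- one at a time. The slack `i` keeps count, and at `i = N` both cancel.
        Post i τ = Inv ℓ j (except v i) d (array τ 8) (array τ 9)
               × entries (array τ 8) + (unlabelled d + N) ≤ total + i
               × SameOff (array τ 8) c₀ × (∀ l → l ≤ ℓ → array τ 8 (at l) ≡ array σ 8 (at l))
        L : ℕ → ℕ → State → Set
        L i k′ τ = k′ ≡ k × Post i τ
        sc = ( assign 6 (bin add (var 20) (lit 1)) ⨾ assign 7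
          (get 6 (pairE (pairE (var 5) (var 22)) (var 23))) ⨾ push )
        bound : ∀ i k τ → i ≤ N → Frame scan σ τ → L i k τ →
                array τ 5 (pair (scalar τ 5) (scalar τ 22)) ≡ N
        bound i k τ _ fr _ with fixed fr fx
        ... | _ , _ , e₅ , a₅ , _ = trans (cong (λ f → f _) a₅)
              (cong₂ (λ x y → dg (pair x y)) e₅ (trans (scalarOf fr 22) e₂₂))
        body : ∀ i k τ → i < N → Frame scan σ τ → L i k τ → Run sc (setScalar 23 i τ) (4 + k) (L (suc i))
        body i k τ i< fr (refl , I , ent , off , low) with fixed fr fx
        ... | e₀ , e₄ , e₅ , a₅ , a₆ =
          seqR (assignR (suc ℓ) (trans (cong (_+ 1) (trans (scalarOf fr 20) e₂₀)) (+-comm ℓ 1))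
            (λ _ → ≤-trans ℓ< cap≤)
          (seqR (assignR x (trans (cong (λ f → f _) a₆)
                   (cong₂ (λ y z → ad (pair (pair y z) i)) e₅ (trans (scalarOf fr 22) e₂₂)))
                   (λ _ → ≤-trans (<⇒≤ (good-< (good-step (proj₁ (labels I v ℓ lab)) i<))) (≤-trans (m≤m+n n 3) cap≤))
          (pushR row (suc ℓ) x e₄ refl refl fits
          (refl , inv-push {c = c} {it} I lab i< , ent′ , off-update {c} {c₀} off ,
            λ l l≤ → trans (Bucket.c-other c it (at (suc ℓ)) x (λ e → <⇒≢ (s≤s l≤) (sym (at-inj e)))) (low l l≤))))))
          where
          x = ad (pair (pair g v) i)
          c = array τ 8
          it = array τ 9
          c< : suc (entries c) ≤ total
          c< = +-cancelʳ-≤ N (suc (entries c)) total (≤-trans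
                 (≤-trans (s≤s (+-monoʳ-≤ (entries c) (m≤n+m N (unlabelled d)))) (s≤s ent))
                 (≤-trans (≤-reflexive (sym (+-suc total i))) (+-monoʳ-≤ total i<)))
          fits : suc (c (at (suc ℓ))) ≤ W
          fits = ≤-trans (s≤s (entry≤ c (suc ℓ) ℓ<)) (≤-trans c< total≤)
          ent′ : entries (Bucket.c′ c it (at (suc ℓ)) x) + (unlabelled d + N) ≤ total + suc i
          ent′ = ≤-trans (+-monoˡ-≤ _ (entries-push c it (suc ℓ) x))
                   (≤-trans (s≤s ent) (≤-reflexive (sym (+-suc total i))))
        finish : ∀ k′ τ → Frame scan σ τ → L N k′ τ → Q k′ τ
        finish k′ τ fr (refl , I , ent , off , low) = done τ fr
          (subst (λ d → Inv ℓ j everything d (array τ 8) (array τ 9)) (sym (arrayOf fr 7)) (inv-scanned I))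
          (subst (λ d → entries (array τ 8) + unlabelled d ≤ total) (sym (arrayOf fr 7))
            (+-cancelʳ-≤ N _ total (≤-trans (≤-reflexive (+-assoc (entries (array τ 8)) (unlabelled d) N)) ent)))
          off low

      Level : ℕ → State → Set
      Level ℓ τ = Inv ℓ 0 everything (array τ 7) (array τ 8) (array τ 9)
                × entries (array τ 8) + unlabelled (array τ 7) ≤ total
                × SameOff (array τ 7) d₀ × SameOff (array τ 8) c₀

      level = for 21 (get 8 (pairE (var 4) (var 20))) visit

      -- A queue entry costs 7: two for its round, five for `visit` apart from the rounds of `scan`.
      -- A list entry of an unlabelled vertex holds 6 in reserve, two for its round of `scan` and
      -- four for the body; labelling the vertex releases them. Pushes go to bucket `suc ℓ`, so the
      -- loop bound, although evaluated again in every round, stays fixed.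
      levelR : ∀ {σ Q} ℓ k → ℓ < n + 3 → Fixed σ → scalar σ 20 ≡ ℓ → Level ℓ σ →
        (∀ τ → Level (suc ℓ) τ → (∀ l → l ≤ ℓ → array τ 8 (at l) ≡ array σ 8 (at l)) →
          Q (unlabelled (array τ 7) * 6 + k) τ) →
        Run level σ (2 + (array σ 8 (at ℓ) * 7 + (unlabelled (array σ 7) * 6 + k))) Q
      levelR {σ} {Q} ℓ k ℓ< fx e₂₀ (I₀ , ent₀ , offd₀ , offc₀) done =
        forC N 5 L (≤-trans (entry≤ (array σ 8) ℓ (<⇒≤ ℓ<)) (≤-trans (m≤m+n _ _) (≤-trans ent₀ total≤)))
          bound (refl , I₀ , ent₀ , offd₀ , offc₀ , λ _ _ → refl) body
          (λ { k′ τ fr (refl , I , ent , offd , offc , low) → done (setScalar 21 N τ)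
            (inv-next (subst (λ j → Inv ℓ j everything (array τ 7) (array τ 8) (array τ 9)) (sym (low ℓ ≤-refl)) I) ,
             ent , offd , offc) low })
        where
        N = array σ 8 (at ℓ)
        L : ℕ → ℕ → State → Set
        L j k′ τ = k′ ≡ unlabelled (array τ 7) * 6 + k × Inv ℓ j everything (array τ 7) (array τ 8) (array τ 9)
                 × entries (array τ 8) + unlabelled (array τ 7) ≤ total
                 × SameOff (array τ 7) d₀ × SameOff (array τ 8) c₀
                 × (∀ l → l ≤ ℓ → array τ 8 (at l) ≡ array σ 8 (at l))
        bound : ∀ j k τ → j ≤ N → Frame level σ τ → L j k τ → array τ 8 (pair (scalar τ 4) (scalar τ 20)) ≡ N
        bound j k τ _ fr (_ , _ , _ , _ , _ , low) with fixed fr fx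
        ... | _ , e₄ , _ = trans (cong₂ (λ x y → array τ 8 (pair x y)) e₄ (trans (scalarOf fr 20) e₂₀)) (low ℓ ≤-refl)
        body : ∀ j k τ → j < N → Frame level σ τ → L j k τ → Run visit (setScalar 21 j τ) (5 + k) (L (suc j))
        body j k′ τ j<N fr (refl , I , ent , offd , offc , low) with fixed fr fx
        ... | fxτ@(e₀ , e₄ , e₅ , a₅ , a₆) =
          seqR (assignR v (cong₂ (λ x y → array τ 9 (pair (pair x y) j)) e₄ e₂₀′) (λ B → array≤ B 9 (pair (at ℓ) j))
          (iteR
            (λ nz → weakR (s≤s (m≤n+m _ 2)) (skipR (refl ,
              inv-skip I (sym (proj₂ (nonzero (λ z → nz (trans (cong (λ r → d (pair r v)) e₄) z)))))
                , ent , offd , offc , low)))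
            (λ z → visited (trans (cong (λ r → d (pair r v)) (sym e₄)) z))))
          where
          d = array τ 7
          v = array τ 9 (pair (at ℓ) j)
          e₂₀′ = trans (scalarOf fr 20) e₂₀
          j<c : j < array τ 8 (at ℓ)
          j<c = subst (j <_) (sym (low ℓ ≤-refl)) j<N
          v<n : v < n
          v<n = good-< (buckets I ℓ j j<c)
          nonzero : ∀ {x} → x ≢ 0 → Σ[ y ∈ ℕ ] suc y ≡ x
          nonzero {zero}  h = ⊥-elim (h refl)
          nonzero {suc y} h = y , refl
          D = dg (pair g v)
          d′ = mark d v ℓ
          lem : ∀ D U k → 3 + (D * 6 + (U * 6 + k)) ≡ 3 + ((U + D) * 6 + k)
          lem = solve-∀
          visited : d (at v) ≡ 0 →
            Run (put 7 (pairE (var 4) (var 22)) (bin add (var 20) (lit 1)) ⨾ scan)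
                (setScalar 22 v (setScalar 21 j τ)) (3 + (unlabelled d * 6 + k)) (L (suc j))
          visited z = weakR
            (≤-reflexive (trans (lem D (unlabelled d′) k)
              (cong (λ u → 3 + (u * 6 + k)) (unlabelled-mark d v ℓ v<n z))))
            (seqR (putR {a = 7} (at v) (suc ℓ) (cong (λ r → pair r v) e₄) (trans (cong (_+ 1) e₂₀′) (+-comm ℓ 1))
                    (λ _ → ≤-trans ℓ< cap≤)
            (scanR ℓ (suc j) v (unlabelled d′ * 6 + k) ℓ< fxτ e₂₀′ refl (inv-mark I z j<c)
              (update-same (at v) (suc ℓ) d)
              (subst (λ u → entries (array τ 8) + u ≤ total) (sym (unlabelled-mark d v ℓ v<n z)) ent) offc
              (λ τ′ fr′ I′ ent′ offc′ low′ →
                cong (λ d → unlabelled d * 6 + k) (sym (arrayOf fr′ 7)) , I′ , ent′ ,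
                (λ r l r≢ → trans (cong (λ f → f (pair r l)) (arrayOf fr′ 7)) (off-update {d} {d₀} offd r l r≢))
                  , offc′ ,
                (λ l l≤ → trans (low′ l l≤) (low l l≤))))))

      -- The bucket sizes are unknown beforehand, so credits for `total` entries are provided at
      -- once. The part `rem` belongs to entries outside the buckets already processed, which no
      -- longer change; whatever is left in the end is dropped.
      dialR : ∀ {σ Q} k → Fixed σ → Level 0 σ →
        (∀ τ → Frame dial σ τ → Level (n + 3) τ → Q k τ) →
        Run dial σ (2 + ((n + 3) * 4 + (total * 7 + (unlabelled (array σ 7) * 6 + k)))) Q
      dialR {σ} {Q} k fx L₀ done = dropR k (frameR
        (forC {Q = λ k′ τ → Level (n + 3) τ × k ≤ k′} (n + 3) 2 L cap≤
          (λ i k τ _ fr _ → cong (_+ 3) (proj₁ (fixed fr fx)))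
          (total , refl , +-identityʳ total , L₀) body
          (λ { k′ τ fr (rem , refl , _ , h) → h , ≤-trans (m≤n+m k _) (m≤n+m _ (rem * 7)) }))
        (λ k′ τ fr h → proj₂ h , done τ fr (proj₁ h)))
        where
        L : ℕ → ℕ → State → Set
        L ℓ k′ τ = Σ[ rem ∈ ℕ ] k′ ≡ rem * 7 + (unlabelled (array τ 7) * 6 + k)
                 × rem + S (λ l → array τ 8 (at l)) ℓ ≡ total × Level ℓ τ
        body : ∀ ℓ k τ → ℓ < n + 3 → Frame dial σ τ → L ℓ k τ → Run level (setScalar 20 ℓ τ) (2 + k) (L (suc ℓ))
        body ℓ k′ τ ℓ< fr (rem , refl , sum , lv@(_ , ent , _)) =
          weakR (≤-reflexive (cong (2 +_) (trans (lem N rem′ U k) (cong (λ r → r * 7 + (U * 6 + k)) (sym rem≡)))))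
            (levelR ℓ (rem′ * 7 + k) ℓ< (fixed fr fx) refl lv
              (λ τ′ lv′ low → rem′ , lem′ rem′ (unlabelled (array τ′ 7)) k ,
                trans (cong (rem′ +_) (S-cong (suc ℓ) (λ l l< → low l (≤-pred l<)))) (m∸n+n≡m used) , lv′))
          where
          c = array τ 8
          N = c (at ℓ)
          U = unlabelled (array τ 7)
          used : S (λ l → c (at l)) (suc ℓ) ≤ total
          used = ≤-trans (S-prefix (λ l → c (at l)) (m<n⇒m<1+n ℓ<)) (≤-trans (m≤m+n _ _) ent)
          rem′ = total ∸ S (λ l → c (at l)) (suc ℓ)
          rem≡ : rem ≡ N + rem′
          rem≡ = +-cancelʳ-≡ (S (λ l → c (at l)) ℓ) rem (N + rem′)
            (trans sum (trans (sym (m∸n+n≡m used)) (lem″ rem′ (S (λ l → c (at l)) ℓ) N)))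
            where
            lem″ : ∀ r s n → r + (s + n) ≡ n + r + s
            lem″ = solve-∀
          lem : ∀ N r U k → N * 7 + (U * 6 + (r * 7 + k)) ≡ (N + r) * 7 + (U * 6 + k)
          lem = solve-∀
          lem′ : ∀ r U k → U * 6 + (r * 7 + k) ≡ r * 7 + (U * 6 + k)
          lem′ = solve-∀

-- Preprocessing

threshold : Program
threshold = assign 3 (lit 1)
  ⨾ for 10 (var 0) (ite (bin lt (bin mul (bin mul (bin mul (var 3) (var 3)) (var 3)) (var 0)) (var 1))
      (assign 3 (bin add (var 3) (lit 1))) skip)

matrix : Program
matrix = for 10 (var 1)
  ( put 2 (pairE (get 0 (var 10)) (get 1 (var 10))) (lit 1)
  ⨾ put 2 (pairE (get 1 (var 10)) (get 0 (var 10))) (lit 1) )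

countP : Program
countP = for 12 (var 0) (ite (get 2 (pairE (var 10) (var 12)))
  (ite (get 3 (var 12)) skip (assign 11 (bin add (var 11) (lit 1)))) skip)

-- Neighbours that are clustered already are moved to the new cluster as well. This is harmless: all
-- that is ever used is that a clustered vertex is adjacent to its recorded center.
markP : Program
markP = for 12 (var 0) (ite (get 2 (pairE (var 10) (var 12)))
  (put 3 (var 12) (bin add (var 10) (lit 1))) skip)

clusters : Program
clusters = for 10 (var 0)
  (assign 11 (lit 0) ⨾ countP ⨾ ite (bin lt (var 11) (var 3)) skip (put 4 (var 10) (lit 1) ⨾ markP))

-- Adjacency matrix and greedy clustering

module _ (n : ℕ) where

  S² : (ℕ → ℕ) → ℕ
  S² a = S (λ v → S (λ x → a (pair v x)) n) n

  S²-set : ∀ a x y → S² (update (pair x y) 1 a) ≤ suc (S² a)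
  S²-set a x y = ≤-trans
    (S-inc x 1 n (λ i i≢ → S-cong n (λ j _ → update-other 1 a (λ e → i≢ (sym (pair-inj₁ {x} {y} {i} {j} e)))))
      (S-inc y 1 n (λ j j≢ → update-other 1 a (λ e → j≢ (sym (pair-inj₂ {x} {y} {x} {j} e))))
        (≤-trans (≤-reflexive (update-same (pair x y) 1 a)) (m≤n+m 1 _))))
    (≤-reflexive (+-comm (S² a) 1))

-- That every edge has been entered is tracked outside this record, by position in the edge list.
record Matrix (n : ℕ) (R : ℕ → ℕ → Set) (t : ℕ) (a : ℕ → ℕ) : Set where
  field
    entry : ∀ v x → a (pair v x) ≡ 0 ⊎ (a (pair v x) ≡ 1 × R v x)
    total : S² n a ≤ t
open Matrix public

matrix-set : ∀ {n R t a x y} → R x y → Matrix n R t a → Matrix n R (suc t) (update (pair x y) 1 a)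
entry (matrix-set {a = a} {x} {y} r M) v z with pair x y ≟ pair v z
... | yes e with refl ← pair-inj₁ {x} {y} {v} {z} e | refl ← pair-inj₂ {x} {y} {v} {z} e =
  inj₂ (update-same (pair x y) 1 a , r)
... | no ne with entry M v z
...   | inj₁ p       = inj₁ (trans (update-other 1 a ne) p)
...   | inj₂ (p , h) = inj₂ (trans (update-other 1 a ne) p , h)
total (matrix-set {n} {a = a} {x} {y} r M) = ≤-trans (S²-set n a x y) (s≤s (total M))

set-one : ∀ (a : ℕ → ℕ) i j → a j ≡ 1 → update i 1 a j ≡ 1
set-one a i j h with i ≟ j
... | yes refl = update-same i 1 a
... | no ne    = trans (update-other 1 a ne) h

isPos : ℕ → ℕ
isPos zero    = 0
isPos (suc _) = 1

record Clustering (n s : ℕ) (A : ℕ → ℕ → ℕ) (w : ℕ) (cen isC : ℕ → ℕ) : Set where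
  field
    member : ∀ x p → cen x ≡ suc p → isC p ≡ 1 × A p x ≡ 1
    later  : ∀ h → w ≤ h → isC h ≡ 0
    isC≤1  : ∀ h → isC h ≤ 1
    few    : S isC n * s ≤ S (λ x → isPos (cen x)) n
    sparse : ∀ v → v < w → S (λ x → A v x * isZero (cen x)) n ≤ s
open Clustering public

module _ {n s : ℕ} {A : ℕ → ℕ → ℕ} (A01 : ∀ v x → A v x ≡ 0 ⊎ A v x ≡ 1) where

  clustering-skip : ∀ {w cen isC} → Clustering n s A w cen isC →
    S (λ x → A w x * isZero (cen x)) n < s → Clustering n s A (suc w) cen isC
  clustering-skip {w} {cen} C c< = record
    { member = member C ; later = λ h w< → later C h (<⇒≤ w<) ; isC≤1 = isC≤1 C ; few = few C ; sparse = sp }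
    where
    sp : ∀ v → v < suc w → S (λ x → A v x * isZero (cen x)) n ≤ s
    sp v v< with v ≟ w
    ... | yes refl = <⇒≤ c<
    ... | no v≢    = sparse C v (≤∧≢⇒< (≤-pred v<) v≢)

  Marked : (w j : ℕ) (cen cen′ : ℕ → ℕ) → Set
  Marked w j cen cen′ = ∀ x → (x < j × A w x ≡ 1 × cen′ x ≡ suc w) ⊎ (¬ (x < j × A w x ≡ 1) × cen′ x ≡ cen x)

  marked-zero : ∀ {w cen} → Marked w 0 cen cen
  marked-zero x = inj₂ ((λ { (() , _) }) , refl)

  marked-skip : ∀ {w j cen cen′} → A w j ≡ 0 → Marked w j cen cen′ → Marked w (suc j) cen cen′
  marked-skip {w} {j} z M x with M x
  ... | inj₁ (x< , a , e) = inj₁ (m<n⇒m<1+n x< , a , e)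
  ... | inj₂ (¬m , e) = inj₂ ((λ { (x< , a) → ¬m (≤∧≢⇒< (≤-pred x<) (λ { refl → 1+n≢0 (trans (sym a) z) }) , a) })
        , e)

  marked-put : ∀ {w j cen cen′} → A w j ≡ 1 → Marked w j cen cen′ → Marked w (suc j) cen (update j (suc w) cen′)
  marked-put {w} {j} {cen} {cen′} o M x with j ≟ x
  ... | yes refl = inj₁ (≤-refl , o , update-same j (suc w) cen′)
  ... | no j≢ with M x
  ...   | inj₁ (x< , a , e) = inj₁ (m<n⇒m<1+n x< , a , trans (update-other (suc w) cen′ j≢) e)
  ...   | inj₂ (¬m , e) = inj₂ ((λ { (x< , a) → ¬m (≤∧≢⇒< (≤-pred x<) (j≢ ∘ sym) , a) }) , trans
        (update-other (suc w) cen′ j≢) e)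

  -- At least s newly clustered neighbours pay for the new center, and moved vertices remain
  -- clustered, so nothing paid earlier is lost. Afterwards `w` has no unclustered neighbour at all;
  -- for earlier vertices the number of unclustered neighbours can only drop.
  clustering-mark : ∀ {w cen cen′ isC} → w < n → Clustering n s A w cen isC →
    s ≤ S (λ x → A w x * isZero (cen x)) n → Marked w n cen cen′ → Clustering n s A (suc w) cen′ (update w 1 isC)
  clustering-mark {w} {cen} {cen′} {isC} w<n C s≤ M = record
    { member = mem ; later = lat ; isC≤1 = le1 ; few = fw ; sparse = sp }
    where
    isC′ = update w 1 isC
    mem : ∀ x p → cen′ x ≡ suc p → isC′ p ≡ 1 × A p x ≡ 1
    mem x p e with M x
    ... | inj₁ (_ , a , e′) with refl ← suc-injective (trans (sym e′) e) = update-same w 1 isC , a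
    ... | inj₂ (_ , e′) with member C x p (trans (sym e′) e)
    ...   | i , a = set-one isC w p i , a
    lat : ∀ h → suc w ≤ h → isC′ h ≡ 0
    lat h w< = trans (update-other 1 isC (<⇒≢ w<)) (later C h (<⇒≤ w<))
    le1 : ∀ h → isC′ h ≤ 1
    le1 h with w ≟ h
    ... | yes refl = ≤-reflexive (update-same w 1 isC)
    ... | no ne    = ≤-trans (≤-reflexive (update-other 1 isC ne)) (isC≤1 C h)
    more : ∀ x → x < n → isPos (cen x) + A w x * isZero (cen x) ≤ isPos (cen′ x)
    more x x< with M x | A01 w x
    ... | inj₁ (_ , a , e) | _ rewrite e | a = lemma (cen x)
      where
      lemma : ∀ c → isPos c + (isZero c + 0) ≤ 1
      lemma zero    = ≤-refl
      lemma (suc _) = ≤-refl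
    ... | inj₂ (¬m , e) | inj₂ a = ⊥-elim (¬m (x< , a))
    ... | inj₂ (¬m , e) | inj₁ a rewrite e | a = ≤-reflexive (+-identityʳ _)
    fw : S isC′ n * s ≤ S (λ x → isPos (cen′ x)) n
    fw = begin
      S isC′ n * s        ≤⟨ *-monoˡ-≤ s (S-inc w 1 n (λ i i≢ → update-other 1 isC (i≢ ∘ sym))
                               (≤-trans (≤-reflexive (update-same w 1 isC)) (m≤n+m 1 _))) ⟩
      (S isC n + 1) * s   ≡⟨ *-distribʳ-+ s (S isC n) 1 ⟩
      S isC n * s + (s + 0) ≡⟨ cong (S isC n * s +_) (+-identityʳ s) ⟩
      S isC n * s + s     ≤⟨ +-mono-≤ (few C) s≤ ⟩
      S (λ x → isPos (cen x)) n + S (λ x → A w x * isZero (cen x)) n ≡⟨ sym (S-+ _ _ n) ⟩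
      S (λ x → isPos (cen x) + A w x * isZero (cen x)) n ≤⟨ S-mono n more ⟩
      S (λ x → isPos (cen′ x)) n ∎
      where open ≤-Reasoning
    isZero≤ : ∀ x → isZero (cen′ x) ≤ isZero (cen x)
    isZero≤ x with M x
    ... | inj₁ (_ , _ , e) rewrite e = z≤n
    ... | inj₂ (_ , e)     rewrite e = ≤-refl
    sp : ∀ v → v < suc w → S (λ x → A v x * isZero (cen′ x)) n ≤ s
    sp v v< with v ≟ w
    ... | no v≢    = ≤-trans (S-mono n (λ x _ → *-monoʳ-≤ (A v x) (isZero≤ x))) (sparse C v (≤∧≢⇒< (≤-pred v<) v≢))
    ... | yes refl = ≤-trans (≤-reflexive (S-zero n none)) z≤n
      where
      none : ∀ x → x < n → A w x * isZero (cen′ x) ≡ 0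
      none x x< with M x | A01 w x
      ... | inj₁ (_ , a , e) | _ rewrite e = *-zeroʳ (A w x)
      ... | inj₂ (¬m , _) | inj₂ a = ⊥-elim (¬m (x< , a))
      ... | inj₂ _ | inj₁ a rewrite a = refl

-- Here s is the least positive number with s³n at least m, and r its predecessor. The bound on m
-- limits the work of the searches from centers, the failure of r limits the size of the sparse
-- graph.
Threshold : (n m s : ℕ) → Set
Threshold n m s = Σ[ r ∈ ℕ ] s ≡ suc r × m ≤ s * s * s * n × (r ≡ 0 ⊎ r * r * r * n < m)

-- Credits for threshold, matrix and clusters

module Phases (q : ℕ) (1≤q : 1 ≤ q) (unit : ℕ) (unit≥ : 1024 * suc q ≤ unit) where
  open Logic q 1≤q unit unit≥

  thresholdR : ∀ {σ Q} n m k → scalar σ 0 ≡ n → scalar σ 1 ≡ m → 1 ≤ n → m ≤ n * n → suc n ≤ W →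
    (∀ τ → Frame threshold σ τ → Threshold n m (scalar τ 3) → Q k τ) →
    Run threshold σ (3 + (n * 4 + k)) Q
  thresholdR {σ} {Q} n m k e₀ e₁ 1≤n m≤ n≤W done = frameR {Q = λ k′ τ → k′ ≡ k × L n k′ τ}
    (seqR (assignR 1 refl (λ _ → ≤-trans (s≤s z≤n) n≤W)
      (forC n 2 L (≤-trans (n≤1+n n) n≤W) (λ i k τ _ fr _ → trans (scalarOf fr 0) e₀)
        (refl , 0 , refl , z≤n , inj₁ refl , inj₁ refl) body (λ { k′ τ fr (refl , h) → refl , refl , h }))))
    (λ { k′ τ fr (refl , _ , r , e , r≤ , big , small) → done τ fr (r , e , large r big e r≤ , small) })
    where
    cube : ℕ → ℕ
    cube s = s * s * s * n
    L : ℕ → ℕ → State → Set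
    L i k′ τ = k′ ≡ k × Σ[ r ∈ ℕ ] scalar τ 3 ≡ suc r × r ≤ i × (r ≡ i ⊎ m ≤ cube (suc r)) × (r ≡ 0 ⊎ cube r < m)
    large : ∀ r {s} → (r ≡ n ⊎ m ≤ cube (suc r)) → s ≡ suc r → r ≤ n → m ≤ cube s
    large r (inj₂ h) refl _ = h
    -- The counter was raised in every round, so it is now `suc n`; since m is at most n², n rounds
    -- are enough.
    large r (inj₁ refl) refl _ = begin
      m                 ≤⟨ m≤ ⟩
      n * n             ≤⟨ *-monoˡ-≤ n (≤-trans (n≤1+n n) (m≤n*m (suc n) (suc n * suc n))) ⟩
      cube (suc n)      ∎
      where open ≤-Reasoning
    body : ∀ i k τ → i < n → Frame _ _ τ → L i k τ → Run _ (setScalar 10 i τ) (2 + k) (L (suc i))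
    body i k′ τ i<n fr (refl , r , e , r≤i , big , small) = iteR
      (λ nz → let l = bit-≢0 (cube (suc r)) m (λ z → nz (trans (test≡) z)) in
        assignR (suc (suc r)) (trans (cong (_+ 1) e) (+-comm (suc r) 1))
          (λ _ → ≤-trans (s≤s (≤-trans (s≤s r≤i) i<n)) n≤W)
          (refl , suc r , refl , s≤s r≤i , grow l big , inj₂ l))
      (λ z → skipR (refl , r , e , m≤n⇒m≤1+n r≤i , inj₂ (bit-≡0 (cube (suc r)) m (trans (sym test≡) z)) , small))
      where
      test≡ = cong₂ (λ x y → ⟦ lt ⟧op x y)
        (cong₂ (λ x y → x * x * x * y) e (trans (scalarOf fr 0) e₀)) (trans (scalarOf fr 1) e₁)
      grow : cube (suc r) < m → (r ≡ i ⊎ m ≤ cube (suc r)) → (suc r ≡ suc i ⊎ m ≤ cube (suc (suc r)))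
      grow l (inj₁ refl) = inj₁ refl
      grow l (inj₂ h)    = ⊥-elim (<⇒≱ l h)

  matrixR : ∀ {σ Q} n m k (R : ℕ → ℕ → Set) (e₀ e₁ : ℕ → ℕ) →
    scalar σ 1 ≡ m → array σ 0 ≡ e₀ → array σ 1 ≡ e₁ → (∀ i → array σ 2 i ≡ 0) →
    (∀ i → i < m → R (e₀ i) (e₁ i)) → (∀ {v x} → R v x → R x v) → m ≤ W → 1 ≤ W →
    (∀ τ → Frame matrix σ τ → Matrix n R (m + m) (array τ 2) →
      (∀ i → i < m → array τ 2 (pair (e₀ i) (e₁ i)) ≡ 1 × array τ 2 (pair (e₁ i) (e₀ i)) ≡ 1) → Q k τ) →
    Run matrix σ (2 + (m * 4 + k)) Q
  matrixR {σ} {Q} n m k R e₀ e₁ s₁ a₀ a₁ zero₂ edge Rsym m≤W 1≤W done = frameR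
    (forC {Q = L m} m 2 L m≤W (λ i k τ _ fr _ → trans (scalarOf fr 1) s₁)
      (refl , record { entry = λ v x → inj₁ (zero₂ (pair v x))
                     ; total = ≤-reflexive (S-zero n (λ v _ → S-zero n (λ x _ → zero₂ (pair v x)))) } , λ _ ())
      body (λ _ _ _ h → h))
    (λ { k′ τ fr (refl , M , c) → done τ fr M c })
    where
    L : ℕ → ℕ → State → Set
    L i k′ τ = k′ ≡ k × Matrix n R (i + i) (array τ 2) ×
      (∀ j → j < i → array τ 2 (pair (e₀ j) (e₁ j)) ≡ 1 × array τ 2 (pair (e₁ j) (e₀ j)) ≡ 1)
    body : ∀ i k τ → i < m → Frame matrix σ τ → L i k τ → Run _ (setScalar 10 i τ) (2 + k) (L (suc i))
    body i k′ τ i<m fr (refl , M , c) =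
      seqR (putR {a = 2} (pair u v) 1 (cong₂ pair u≡ v≡) refl (λ _ → 1≤W)
           (putR {a = 2} (pair v u) 1 (cong₂ pair v≡ u≡) refl (λ _ → 1≤W)
           (refl , subst (λ t → Matrix n R t (update (pair v u) 1 a′)) (cong suc (sym (+-suc i i)))
             (matrix-set (Rsym (edge i i<m)) (matrix-set (edge i i<m) M)) , c′)))
      where
      u = e₀ i
      v = e₁ i
      u≡ : array τ 0 i ≡ u
      u≡ = cong (λ f → f i) (trans (arrayOf fr 0) a₀)
      v≡ : array τ 1 i ≡ v
      v≡ = cong (λ f → f i) (trans (arrayOf fr 1) a₁)
      a = array τ 2
      a′ = update (pair u v) 1 a
      c′ : ∀ j → j < suc i → update (pair v u) 1 a′ (pair (e₀ j) (e₁ j)) ≡ 1 × update (pair v u) 1 a′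
        (pair (e₁ j) (e₀ j)) ≡ 1
      c′ j j< with j ≟ i
      ... | yes refl = set-one a′ (pair v u) (pair u v) (update-same (pair u v) 1 a) , update-same (pair v u) 1 a′
      ... | no j≢ with c j (≤∧≢⇒< (≤-pred j<) j≢)
      ...   | p , p′ = set-one a′ (pair v u) _ (set-one a (pair u v) _ p) , set-one a′ (pair v u) _
            (set-one a (pair u v) _ p′)

  module _ (n s : ℕ) (a : ℕ → ℕ) (A01 : ∀ v x → a (pair v x) ≡ 0 ⊎ a (pair v x) ≡ 1) (n≤W : suc n ≤ W) where

    A : ℕ → ℕ → ℕ
    A v x = a (pair v x)

    A≢0 : ∀ v x → A v x ≢ 0 → A v x ≡ 1
    A≢0 v x h with A01 v x
    ... | inj₁ z = ⊥-elim (h z)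
    ... | inj₂ o = o

    countR : ∀ {σ Q} w k (cen : ℕ → ℕ) → scalar
      σ 0 ≡ n → scalar σ 10 ≡ w → scalar σ 11 ≡ 0 → array σ 2 ≡ a → array σ 3 ≡ cen →
      (∀ τ → Frame countP σ τ → scalar τ 11 ≡ S (λ x → A w x * isZero (cen x)) n → Q k τ) →
      Run countP σ (2 + (n * 5 + k)) Q
    countR {σ} {Q} w k cen s₀ s₁₀ s₁₁ a₂ a₃ done = frameR
      (forC {Q = L n} n 3 L (≤-trans (n≤1+n n) n≤W) (λ i k τ _ fr _ → trans (scalarOf fr 0) s₀) (refl , s₁₁) body
        (λ _ _ _ h → h))
      (λ { k′ τ fr (refl , h) → done τ fr h })
      where
      f = λ x → A w x * isZero (cen x)
      L : ℕ → ℕ → State → Set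
      L i k′ τ = k′ ≡ k × scalar τ 11 ≡ S f i
      f≤1 : ∀ x → f x ≤ 1
      f≤1 x with A01 w x | cen x
      ... | inj₁ z | _ rewrite z = z≤n
      ... | inj₂ o | zero rewrite o = ≤-refl
      ... | inj₂ o | suc _ rewrite o = z≤n
      body : ∀ i k τ → i < n → Frame countP σ τ → L i k τ → Run _ (setScalar 12 i τ) (3 + k) (L (suc i))
      body i k′ τ i<n fr (refl , c) = iteR
        (λ nz → let o = A≢0 w i (λ z → nz (trans a≡ z)) in iteR
          (λ nc → skipR (refl , trans c (same (trans (cong₂ _*_ o (isZero≢0 (λ z → nc (trans c≡ z)))) refl))))
          (λ z → assignR (S f (suc i)) (trans (cong (_+ 1) c)
            (cong (S f i +_) (sym (cong₂ _*_ o (cong isZero (trans (sym c≡) z))))))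
            (λ _ → ≤-trans (S-≤-const 1 (suc i) (λ x _ → f≤1 x))
              (≤-trans (≤-reflexive (*-identityʳ (suc i))) (≤-trans (≤-trans i<n (n≤1+n n)) n≤W)))
            (refl , refl)))
        (λ z → weakR (s≤s (n≤1+n k)) (skipR (refl , trans c (same (cong (_* isZero (cen i)) (trans (sym a≡) z))))))
        where
        a≡ : array τ 2 (pair (scalar τ 10) i) ≡ A w i
        a≡ = trans (cong (λ f → f _) (trans (arrayOf fr 2) a₂))
          (cong (λ y → a (pair y i)) (trans (scalarOf fr 10) s₁₀))
        c≡ : array τ 3 i ≡ cen i
        c≡ = cong (λ f → f i) (trans (arrayOf fr 3) a₃)
        same : f i ≡ 0 → S f i ≡ S f (suc i)
        same z = sym (trans (cong (S f i +_) z) (+-identityʳ _))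
        isZero≢0 : ∀ {c} → c ≢ 0 → isZero c ≡ 0
        isZero≢0 {zero}  h = ⊥-elim (h refl)
        isZero≢0 {suc _} h = refl

    markR : ∀ {σ Q} w k (cen : ℕ → ℕ) → w < n → scalar σ 0 ≡ n → scalar σ 10 ≡ w → array σ 2 ≡ a → array σ 3 ≡ cen →
      (∀ τ → Frame markP σ τ → Marked {n} {s} A01 w n cen (array τ 3) → Q k τ) →
      Run markP σ (2 + (n * 4 + k)) Q
    markR {σ} {Q} w k cen w<n s₀ s₁₀ a₂ refl done = frameR
      (forC {Q = L n} n 2 L (≤-trans (n≤1+n n) n≤W) (λ i k τ _ fr _ → trans (scalarOf fr 0) s₀)
        (refl , marked-zero {n} {s} A01) body (λ _ _ _ h → h))
      (λ { k′ τ fr (refl , h) → done τ fr h })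
      where
      L : ℕ → ℕ → State → Set
      L i k′ τ = k′ ≡ k × Marked {n} {s} A01 w i cen (array τ 3)
      body : ∀ i k τ → i < n → Frame markP σ τ → L i k τ → Run _ (setScalar 12 i τ) (2 + k) (L (suc i))
      body i k′ τ i<n fr (refl , M) = iteR
        (λ nz → putR {a = 3} i (suc w) refl (trans (cong (_+ 1) (trans (scalarOf fr 10) s₁₀)) (+-comm w 1))
          (λ _ → ≤-trans (s≤s (<⇒≤ w<n)) n≤W) (refl , marked-put {n} {s} A01 (A≢0 w i (λ z → nz (trans a≡ z))) M))
        (λ z → skipR (refl , marked-skip {n} {s} A01 (trans (sym a≡) z) M))
        where
        a≡ : array τ 2 (pair (scalar τ 10) i) ≡ A w i
        a≡ = trans (cong (λ f → f _) (trans (arrayOf fr 2) a₂))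
          (cong (λ y → a (pair y i)) (trans (scalarOf fr 10) s₁₀))

    clustersR : ∀ {σ Q} k → scalar σ 0 ≡ n → scalar σ 3 ≡ s → array σ 2 ≡ a →
      (∀ i → array σ 3 i ≡ 0) → (∀ i → array σ 4 i ≡ 0) →
      (∀ τ → Frame clusters σ τ → Clustering n s A n (array τ 3) (array τ 4) → Q k τ) →
      Run clusters σ (2 + (n * (9 + n * 9) + k)) Q
    clustersR {σ} {Q} k s₀ s₃ a₂ z₃ z₄ done = frameR
      (forC {Q = L n} n (7 + n * 9) L (≤-trans (n≤1+n n) n≤W) (λ i k τ _ fr _ → trans (scalarOf fr 0) s₀)
        (refl , record { member = λ x p e → ⊥-elim (1+n≢0 (trans (sym e) (z₃ x))) ; later = λ h _ → z₄ h
                       ; isC≤1 = λ h → ≤-trans (≤-reflexive (z₄ h)) z≤n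
                       ; few = ≤-trans (≤-reflexive (cong (_* s) (S-zero n (λ h _ → z₄ h)))) z≤n ; sparse = λ _ () })
        body (λ _ _ _ h → h))
      (λ { k′ τ fr (refl , h) → done τ fr h })
      where
      L : ℕ → ℕ → State → Set
      L i k′ τ = k′ ≡ k × Clustering n s A i (array τ 3) (array τ 4)
      body : ∀ w k τ → w < n → Frame clusters σ τ → L w k τ → Run _ (setScalar 10 w τ) (7 + n * 9 + k) (L (suc w))
      body w k′ τ w<n fr (refl , C) = weakR (≤-reflexive (lem n k))
        (seqR (assignR 0 refl (λ _ → z≤n)
        (seqR (countR w (4 + (n * 4 + k)) cen s₀′ refl refl a₂′ refl
        (λ τ₁ fr₁ c≡ → iteR
          (λ nz → weakR (s≤s (≤-trans (m≤n+m k (n * 4)) (m≤n+m _ 2))) (skipR (refl ,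
            subst₂ (λ f g → Clustering n s A (suc w) f g) (sym (arrayOf fr₁ 3)) (sym (arrayOf fr₁ 4))
              (clustering-skip A01 C (subst₂ _<_ c≡ (s₃′ fr₁) (bit-≢0 _ _ nz))))))
          (λ z → seqR (putR {a = 4} w 1 (scalarOf fr₁ 10) refl (λ _ → ≤-trans (s≤s z≤n) n≤W)
            (markR w k cen w<n (trans (scalarOf fr₁ 0) s₀′) (scalarOf fr₁ 10) (trans (arrayOf fr₁ 2) a₂′)
              (arrayOf fr₁ 3)
              (λ τ₂ fr₂ M → refl ,
                subst (Clustering n s A (suc w) (array τ₂ 3))
                  (sym (trans (arrayOf fr₂ 4) (cong (update w 1) (arrayOf fr₁ 4))))
                  (clustering-mark A01 w<n C (subst₂ _≤_ (s₃′ fr₁) c≡ (bit-≡0 _ _ z)) M))))))))))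
        where
        cen = array τ 3
        s₀′ = trans (scalarOf fr 0) s₀
        a₂′ = trans (arrayOf fr 2) a₂
        s₃′ : ∀ {τ₁} → Frame countP (setScalar 11 0 (setScalar 10 w τ)) τ₁ → scalar τ₁ 3 ≡ s
        s₃′ fr₁ = trans (scalarOf fr₁ 3) (trans (scalarOf fr 3) s₃)
        lem : ∀ n k → 1 + (2 + (n * 5 + (4 + (n * 4 + k)))) ≡ 7 + n * 9 + k
        lem = solve-∀

-- Adjacency lists of the full and of the sparse graph

append : ℕ → Program
append g = put 6 (pairE (pairE (lit g) (var 10)) (get 5 (pairE (lit g) (var 10)))) (var 11)
         ⨾ put 5 (pairE (lit g) (var 10)) (bin add (get 5 (pairE (lit g) (var 10))) (lit 1))

listRow : Program
listRow = for 11 (var 0) (ite (get 2 (pairE (var 10) (var 11)))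
    (append 0 ⨾ ite (get 3 (var 10)) (ite (get 3 (var 11)) skip (append 1)) (append 1)) skip)

lists : Program
lists = for 10 (var 0) listRow

sparseEdge : ℕ → ℕ → ℕ
sparseEdge (suc _) (suc _) = 0
sparseEdge zero    _       = 1
sparseEdge (suc _) zero    = 1

module Lists (n : ℕ) (A : ℕ → ℕ → ℕ) (A01 : ∀ v x → A v x ≡ 0 ⊎ A v x ≡ 1) (cen : ℕ → ℕ) where

  -- The graph 0 has all edges, the graph 1 only those with an endpoint outside the clusters.
  E : ℕ → ℕ → ℕ → ℕ
  E zero    v x = A v x
  E (suc _) v x = A v x * sparseEdge (cen v) (cen x)

  sparseEdge≤1 : ∀ c d → sparseEdge c d ≤ 1
  sparseEdge≤1 zero    _       = ≤-refl
  sparseEdge≤1 (suc _) zero    = ≤-refl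
  sparseEdge≤1 (suc _) (suc _) = z≤n

  A≤1 : ∀ v x → A v x ≤ 1
  A≤1 v x with A01 v x
  ... | inj₁ z = ≤-trans (≤-reflexive z) z≤n
  ... | inj₂ o = ≤-reflexive o

  E≤1 : ∀ g v x → E g v x ≤ 1
  E≤1 zero    v x = A≤1 v x
  E≤1 (suc _) v x = *-mono-≤ (A≤1 v x) (sparseEdge≤1 (cen v) (cen x))

  -- The list of `v` set against the first `X` columns of its row. `len` serves the running time,
  -- `sound` the walks behind labels, `full` the upper bounds on labels.
  record RowOK (dg ad : ℕ → ℕ) (g v X : ℕ) : Set where
    field
      len   : dg (pair g v) ≡ S (E g v) X
      sound : ∀ i → i < dg (pair g v) → E g v (ad (pair (pair g v) i)) ≡ 1 × ad (pair (pair g v) i) < X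
      full  : ∀ x → x < X → E g v x ≡ 1 → Σ[ i ∈ ℕ ] i < dg (pair g v) × ad (pair (pair g v) i) ≡ x
  open RowOK public

  row-zero : ∀ {dg ad g v} → dg (pair g v) ≡ 0 → RowOK dg ad g v 0
  len   (row-zero z) = z
  sound (row-zero z) i i< = ⊥-elim (n≮0 (subst (i <_) z i<))
  full  (row-zero z) x ()

  row-len : ∀ {dg ad g v X} → RowOK dg ad g v X → dg (pair g v) ≤ X
  row-len {g = g} {v} {X} r = ≤-trans (≤-reflexive (len r))
    (≤-trans (S-≤-const 1 X (λ x _ → E≤1 g v x)) (≤-reflexive (*-identityʳ X)))

  row-skip : ∀ {dg ad g v X} → E g v X ≡ 0 → RowOK dg ad g v X → RowOK dg ad g v (suc X)
  len   (row-skip {g = g} {v} {X} z r) = trans (len r) (sym (trans (cong (S (E g v) X +_) z) (+-identityʳ _)))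
  sound (row-skip z r) i i< = proj₁ (sound r i i<) , m<n⇒m<1+n (proj₂ (sound r i i<))
  full  (row-skip z r) x x< o = full r x (≤∧≢⇒< (≤-pred x<) (λ { refl → 1+n≢0 (trans (sym o) z) })) o

  module _ (dg ad : ℕ → ℕ) (g v x : ℕ) where
    open Bucket dg ad (pair g v) x

    row-append : E g v x ≡ 1 → RowOK dg ad g v x → RowOK c′ it′ g v (suc x)
    len   (row-append o r) = trans c-here (trans (cong suc (len r))
      (trans (+-comm 1 _) (cong (S (E g v) x +_) (sym o))))
    sound (row-append o r) = all-push (λ y → E g v y ≡ 1 × y < suc x)
      (λ i i< → proj₁ (sound r i i<) , m<n⇒m<1+n (proj₂ (sound r i i<))) (λ _ → o , ≤-refl)
    full  (row-append o r) y y< o′ with y ≟ x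
    ... | yes refl = dg (pair g v) , subst (dg (pair g v) <_) (sym c-here) ≤-refl , it-new
    ... | no y≢ with full r y (≤∧≢⇒< (≤-pred y<) y≢) o′
    ...   | i , i< , e = i , c-grows i< , trans (it-old i<) e

    row-other : ∀ {g′ v′ X} → pair g v ≢ pair g′ v′ → RowOK dg ad g′ v′ X → RowOK c′ it′ g′ v′ X
    len   (row-other ne r) = trans (c-other ne) (len r)
    sound (row-other ne r) i i< with subst (i <_) (c-other ne) i<
    ... | i<′ rewrite it-old i<′ = sound r i i<′
    full  (row-other ne r) y y< o with full r y y< o
    ... | i , i< , e = i , c-grows i< , trans (it-old i<) e

  record Rows (g v X : ℕ) (dg ad : ℕ → ℕ) : Set where
    field
      before  : ∀ v′ → v′ < v → RowOK dg ad g v′ n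
      current : RowOK dg ad g v X
      after   : ∀ v′ → v < v′ → RowOK dg ad g v′ 0
  open Rows public

  rows-append : ∀ {g v x dg ad} → E g v x ≡ 1 → Rows g v x dg ad →
    Rows g v (suc x) (Bucket.c′ dg ad (pair g v) x) (Bucket.it′ dg ad (pair g v) x)
  before (rows-append {g} {v} {x} {dg} {ad} o r) v′ v< =
    row-other dg ad g v x (λ e → <⇒≢ v< (sym (pair-inj₂ {g} {v} {g} {v′} e))) (before r v′ v<)
  current   (rows-append {g} {v} {x} {dg} {ad} o r) = row-append dg ad g v x o (current r)
  after  (rows-append {g} {v} {x} {dg} {ad} o r) v′ v< =
    row-other dg ad g v x (λ e → <⇒≢ v< (pair-inj₂ {g} {v} {g} {v′} e)) (after r v′ v<)

  rows-other : ∀ {g g′ v x y dg ad} → g ≢ g′ → Rows g′ v y dg ad →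
    Rows g′ v y (Bucket.c′ dg ad (pair g v) x) (Bucket.it′ dg ad (pair g v) x)
  rows-other {g} {g′} {v} {x} {y} {dg} {ad} g≢ r = record
    { before = λ v′ v< → other v′ (before r v′ v<) ; current = other v (current r) ; after = λ v′ v< → other v′
      (after r v′ v<) }
    where
    other : ∀ v′ {X} → RowOK dg ad g′ v′ X →
            RowOK (Bucket.c′ dg ad (pair g v) x) (Bucket.it′ dg ad (pair g v) x) g′ v′ X
    other v′ = row-other dg ad g v x (λ e → g≢ (pair-inj₁ {g} {v} {g′} {v′} e))

  rows-skip : ∀ {g v x dg ad} → E g v x ≡ 0 → Rows g v x dg ad → Rows g v (suc x) dg ad
  rows-skip z r = record { before = before r ; current = row-skip z (current r) ; after = after r }

  rows-next : ∀ {g v dg ad} → Rows g v n dg ad → Rows g (suc v) 0 dg ad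
  before (rows-next {v = v} r) v′ v< with v′ ≟ v
  ... | yes refl = current r
  ... | no v≢    = before r v′ (≤∧≢⇒< (≤-pred v<) v≢)
  current   (rows-next {v = v} r) = after r (suc v) ≤-refl
  after  (rows-next {v = v} r) v′ v< = after r v′ (<⇒≤ v<)

  rows-len : ∀ {g dg ad} → Rows g n 0 dg ad → ∀ v → dg (pair g v) ≤ n
  rows-len r v with <-cmp v n
  ... | tri< v< _ _  = row-len (before r v v<)
  ... | tri≈ _ refl _ = ≤-trans (row-len (current r)) z≤n
  ... | tri> _ _ v>  = ≤-trans (row-len (after r v v>)) z≤n

  rows-sum : ∀ {g dg ad} → Rows g n 0 dg ad → S (λ v → dg (pair g v)) n ≡ S (λ v → S (E g v) n) n
  rows-sum r = S-cong n (λ v v< → len (before r v v<))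

  -- For an ordered pair (v, x) of the sparse graph, x is one of the unclustered neighbours of v, or
  -- else v is one of those of x. Exchanging the order of summation turns the second count into the
  -- first.
  sparse-sum : ∀ s → (∀ v x → A v x ≡ A x v) → (∀ v → v < n → S (λ x → A v x * isZero (cen x)) n ≤ s) →
               S (λ v → S (E 1 v) n) n ≤ n * s + n * s
  sparse-sum s A-sym sp = begin
    S (λ v → S (E 1 v) n) n
      ≤⟨ S-mono n (λ v _ → S-mono n (λ x _ → split v x)) ⟩
    S (λ v → S (λ x → A v x * isZero (cen x) + A x v * isZero (cen v)) n) n
      ≡⟨ S-cong n (λ v _ → S-+ (λ x → A v x * isZero (cen x)) (λ x → A x v * isZero (cen v)) n) ⟩
    S (λ v → S (λ x → A v x * isZero (cen x)) n + S (λ x → A x v * isZero (cen v)) n) n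
      ≡⟨ S-+ _ _ n ⟩
    S (λ v → S (λ x → A v x * isZero (cen x)) n) n + S (λ v → S (λ x → A x v * isZero (cen v)) n) n
      ≡⟨ cong (S (λ v → S (λ x → A v x * isZero (cen x)) n) n +_) (S-swap (λ v x → A x v * isZero (cen v)) n n) ⟩
    S (λ v → S (λ x → A v x * isZero (cen x)) n) n + S (λ v → S (λ x → A v x * isZero (cen x)) n) n
      ≤⟨ +-mono-≤ (S-≤-const s n sp) (S-≤-const s n sp) ⟩
    n * s + n * s ∎
    where
    open ≤-Reasoning
    split : ∀ v x → E 1 v x ≤ A v x * isZero (cen x) + A x v * isZero (cen v)
    split v x rewrite A-sym x v with cen v | cen x
    ... | zero  | d     = m≤n+m (A v x * 1) (A v x * isZero d)
    ... | suc _ | zero  = m≤m+n (A v x * 1) _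
    ... | suc _ | suc _ = ≤-trans (≤-reflexive (*-zeroʳ (A v x))) z≤n

module ListsRun (q : ℕ) (1≤q : 1 ≤ q) (unit : ℕ) (unit≥ : 1024 * suc q ≤ unit)
  (n : ℕ) (a : ℕ → ℕ) (A01 : ∀ v x → a (pair v x) ≡ 0 ⊎ a (pair v x) ≡ 1) (cen : ℕ → ℕ)
  (n≤W : suc n ≤ 2 ^ q) where
  open Logic q 1≤q unit unit≥
  open Lists n (λ v x → a (pair v x)) A01 cen

  appendR : ∀ {σ k Q} g {_ : T (weight (pairE (pairE (lit g) (var 10)) (get 5 (pairE (lit g) (var 10)))) + 1 <ᵇ 1024)}
            {_ : T (weight (pairE (lit g) (var 10)) + weight
              (bin add (get 5 (pairE (lit g) (var 10))) (lit 1)) <ᵇ 1024)} v x →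
            scalar σ 10 ≡ v → scalar σ 11 ≡ x → suc (array σ 5 (pair g v)) ≤ W →
            let c = array σ 5 in
            Q k (setCell 5 (pair g v) (suc (c (pair g v))) (setCell 6 (pair (pair g v) (c (pair g v))) x σ)) →
            Run (append g) σ (2 + k) Q
  appendR {σ} g {w} {w′} v x refl refl fits h =
    seqR (putR {a = 6} _ _ {w} refl refl (λ B → scalar≤ B 11)
      (putR {a = 5} _ _ {w′} refl (+-comm (array σ 5 (pair g v)) 1) (λ _ → fits) h))

  Rows₂ : ℕ → ℕ → State → Set
  Rows₂ v x τ = Rows 0 v x (array τ 5) (array τ 6) × Rows 1 v x (array τ 5) (array τ 6)

  listRowR : ∀ {σ Q} v k → scalar σ 0 ≡ n → scalar σ 10 ≡ v → array σ 2 ≡ a → array σ 3 ≡ cen → Rows₂ v 0 σ →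
    (∀ τ → Rows₂ v n τ → Q k τ) → Run listRow σ (2 + (n * 9 + k)) Q
  listRowR {σ} {Q} v k s₀ s₁₀ a₂ a₃ R₀ done =
    forC n 7 L (≤-trans (n≤1+n n) n≤W) (λ i k τ _ fr _ → trans (scalarOf fr 0) s₀) (refl , R₀) body
      (λ { k′ τ fr (refl , R) → done (setScalar 11 n τ) R })
    where
    L : ℕ → ℕ → State → Set
    L x k′ τ = k′ ≡ k × Rows₂ v x τ
    body : ∀ x k τ → x < n → Frame listRow σ τ → L x k τ → Run _ (setScalar 11 x τ) (7 + k) (L (suc x))
    body x k′ τ x<n fr (refl , R₀ , R₁) = iteR edge
      (λ z → weakR (s≤s (m≤n+m k 5)) (skipR (refl , rows-skip (z′ z) R₀ , rows-skip
        (cong (_* sparseEdge (cen v) (cen x)) (z′ z)) R₁)))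
      where
      dg = array τ 5
      ad = array τ 6
      s₁₀′ = trans (scalarOf fr 10) s₁₀
      a≡ : array τ 2 (pair (scalar τ 10) x) ≡ a (pair v x)
      a≡ = trans (cong (λ f → f _) (trans (arrayOf fr 2) a₂)) (cong (λ y → a (pair y x)) s₁₀′)
      z′ : array τ 2 (pair (scalar τ 10) x) ≡ 0 → a (pair v x) ≡ 0
      z′ z = trans (sym a≡) z
      c≡ : ∀ y → array τ 3 y ≡ cen y
      c≡ y = cong (λ f → f y) (trans (arrayOf fr 3) a₃)
      fits : ∀ {dg ad g} → Rows g v x dg ad → suc (dg (pair g v)) ≤ W
      fits R = ≤-trans (s≤s (≤-trans (row-len (current R)) (<⇒≤ x<n))) n≤W
      dg₁ = Bucket.c′ dg ad (pair 0 v) x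
      ad₁ = Bucket.it′ dg ad (pair 0 v) x
      τ₁ = setCell 5 (pair 0 v) (suc (dg (pair 0 v)))
        (setCell 6 (pair (pair 0 v) (dg (pair 0 v))) x (setScalar 11 x τ))
      edge : array τ 2 (pair (scalar τ 10) x) ≢ 0 →
             Run (append 0 ⨾ ite (get 3 (var 10)) (ite (get 3 (var 11)) skip (append 1)) (append 1))
               (setScalar 11 x τ) (6 + k) (L (suc x))
      edge nz = seqR (appendR 0 v x s₁₀′ refl (fits R₀)
        (iteR (λ cv → iteR
                 (λ cx → weakR (s≤s (n≤1+n k)) (skipR
                   (refl , R₀′ , rows-skip (trans (cong (a (pair v x) *_)
                   (both (λ z → cv (trans cv≡ z)) (λ z → cx (trans (c≡ x) z)))) (*-zeroʳ (a (pair v x)))) R₁′)))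
                 (λ cx → add₁ (trans (cong (λ d → sparseEdge (cen v) d) (trans (sym (c≡ x)) cx)) (right (cen v)))))
              (λ cv → weakR (m≤n+m (2 + k) 1) (add₁ (cong (λ d → sparseEdge d (cen x)) (trans (sym cv≡) cv))))))
        where
        o : a (pair v x) ≡ 1
        o with A01 v x
        ... | inj₁ z = ⊥-elim (nz (trans a≡ z))
        ... | inj₂ p = p
        cv≡ : array τ 3 (scalar τ 10) ≡ cen v
        cv≡ = trans (c≡ _) (cong cen s₁₀′)
        both : ∀ {c d} → c ≢ 0 → d ≢ 0 → sparseEdge c d ≡ 0
        both {zero} {d} h _ = ⊥-elim (h refl)
        both {suc c} {zero} _ h = ⊥-elim (h refl)
        both {suc c} {suc d} _ _ = refl
        right : ∀ c → sparseEdge c 0 ≡ 1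
        right zero    = refl
        right (suc _) = refl
        R₀′ : Rows 0 v (suc x) dg₁ ad₁
        R₀′ = rows-append o R₀
        R₁′ : Rows 1 v x dg₁ ad₁
        R₁′ = rows-other {0} {1} (λ ()) R₁
        add₁ : sparseEdge (cen v) (cen x) ≡ 1 → Run (append 1) τ₁ (2 + k) (L (suc x))
        add₁ e = appendR 1 v x s₁₀′ refl (fits R₁′)
          (refl , rows-other {1} {0} (λ ()) R₀′ , rows-append (cong₂ _*_ o e) R₁′)

  listsR : ∀ {σ Q} k → scalar σ 0 ≡ n → array σ 2 ≡ a → array σ 3 ≡ cen → (∀ i → array σ 5 i ≡ 0) →
    (∀ τ → Frame lists σ τ → Rows₂ n 0 τ → Q k τ) → Run lists σ (2 + (n * (4 + n * 9) + k)) Q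
  listsR {σ} {Q} k s₀ a₂ a₃ z₅ done = frameR
    (forC {Q = L n} n (2 + n * 9) L (≤-trans (n≤1+n n) n≤W) (λ i k τ _ fr _ → trans (scalarOf fr 0) s₀)
      (refl , start 0 , start 1)
      (λ { v k′ τ v<n fr (refl , R) → listRowR v k (trans (scalarOf fr 0) s₀) refl (trans (arrayOf fr 2) a₂)
        (trans (arrayOf fr 3) a₃) R
          (λ τ′ R′ → refl , rows-next (proj₁ R′) , rows-next (proj₂ R′)) })
      (λ _ _ _ h → h))
    (λ { k′ τ fr (refl , h) → done τ fr h })
    where
    L : ℕ → ℕ → State → Set
    L v k′ τ = k′ ≡ k × Rows₂ v 0 τ
    start : ∀ g → Rows g 0 0 (array σ 5) (array σ 6)
    start g = record { before = λ _ () ; current = row-zero (z₅ _) ; after = λ v′ _ → row-zero (z₅ _) }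

-- Searches and the estimate

start : ℕ → Program
start g = assign 4 (pairE (lit g) (var 10)) ⨾ assign 5 (lit g) ⨾ assign 6 (lit 0) ⨾ assign 7 (var 10) ⨾ push

centers : Program
centers = for 10 (var 0) (ite (get 4 (var 10)) (start 0 ⨾ dial) skip)

-- A label cell holds one plus the distance between the center and the source, which is already the
-- level wanted for a vertex next to that center; nothing is added.
hubs : Program
hubs = for 11 (var 0) (ite (get 3 (var 11))
  ( assign 6 (get 7 (pairE (pairE (lit 0) (bin sub (get 3 (var 11)) (lit 1))) (var 10)))
  ⨾ assign 7 (var 11) ⨾ push ) skip)

hopP : Program
hopP = for 12 (get 5 (pairE (lit 0) (var 13)))
  ( assign 6 (lit 2) ⨾ assign 7 (get 6 (pairE (pairE (lit 0) (var 13)) (var 12))) ⨾ push )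

twoHops : Program
twoHops = for 11 (get 5 (pairE (lit 1) (var 10)))
  ( assign 13 (get 6 (pairE (pairE (lit 1) (var 10)) (var 11))) ⨾ hopP )

sparseSearch : Program
sparseSearch = for 10 (var 0) (ite (get 3 (var 10)) skip (start 1 ⨾ hubs ⨾ twoHops ⨾ dial))

-- Truncated subtraction makes this the maximum of the current output and `e`.
maxE : Expr → Expr
maxE e = bin add (var 2) (bin sub e (var 2))

reportRow : Program
reportRow = for 11 (var 0)
  -- Rows of vertices that are not centers were never searched; their zero cells yield the harmless
  -- estimate 0.
  ( assign 2 (maxE (bin sub (get 7 (pairE (pairE (lit 0) (var 10)) (var 11))) (lit 1)))
  ⨾ ite (get 3 (var 10)) skip (ite (get 3 (var 11)) skip
      ( assign 12 (bin sub (get 7 (pairE (pairE (lit 1) (var 10)) (var 11))) (lit 1))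
      ⨾ assign 2 (maxE (bin sub (var 12) (lit 2)))
      -- The double subtraction computes the minimum of 4 and the estimate.
      ⨾ assign 2 (maxE (bin sub (lit 4) (bin sub (lit 4) (var 12)))) )) )

report : Program
report = for 10 (var 0) reportRow

-- Paths and the guarantees of a finished search

infixl 5 _▸_

-- Grows at its far end, as the labels of a search do, whereas `Walk` grows at its start.
data Path (A : ℕ → ℕ → ℕ) (u : ℕ) : ℕ → ℕ → Set where
  []   : Path A u u 0
  _▸_  : ∀ {v x k} → Path A u v k → A v x ≡ 1 → Path A u x (suc k)

module _ {A : ℕ → ℕ → ℕ} (A-sym : ∀ v x → A v x ≡ A x v) where

  path-cons : ∀ {u v x k} → A u v ≡ 1 → Path A v x k → Path A u x (suc k)
  path-cons e []      = [] ▸ e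
  path-cons e (p ▸ f) = path-cons e p ▸ f

  path-rev : ∀ {u v k} → Path A u v k → Path A v u k
  path-rev []      = []
  path-rev (p ▸ e) = path-cons (trans (A-sym _ _) e) (path-rev p)

module Tasks (q : ℕ) (1≤q : 1 ≤ q) (unit : ℕ) (unit≥ : 1024 * suc q ≤ unit) (n : ℕ)
  (a : ℕ → ℕ) (A01 : ∀ v x → a (pair v x) ≡ 0 ⊎ a (pair v x) ≡ 1) (cen isC dg ad : ℕ → ℕ) where

  A : ℕ → ℕ → ℕ
  A v x = a (pair v x)

  open Logic q 1≤q unit unit≥
  open DialRun q 1≤q unit unit≥
  open Lists n A A01 cen

  Reaches : (d : ℕ → ℕ) (row k x : ℕ) → Set
  Reaches d row k x = Σ[ l ∈ ℕ ] l ≤ k × d (pair row x) ≡ suc l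

  -- Labels are nowhere claimed to be minimal. `walk` keeps them from falling below distances, while
  -- `seed` and `close` bound them from above as far as the queue runs.
  record Labelled (g u : ℕ) (Ob : ℕ → ℕ → Set) (d : ℕ → ℕ) : Set where
    field
      walk  : ∀ v k → d (pair (pair g u) v) ≡ suc k → v < n × Path A u v k
      seed  : ∀ k x → Ob k x → k < n + 3 → Reaches d (pair g u) k x
      close : ∀ v k i → d (pair (pair g u) v) ≡ suc k → suc k < n + 3 → i < dg (pair g v) →
              Reaches d (pair g u) (suc k) (ad (pair (pair g v) i))
  open Labelled public

  labelled-cong : ∀ {g u Ob d d′} → (∀ v → d′ (pair (pair g u) v) ≡ d (pair (pair g u) v)) →
                  Labelled g u Ob d → Labelled g u Ob d′
  labelled-cong {g} {u} {Ob} {d} {d′} h L = record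
    { walk = λ v k e → walk L v k (trans (sym (h v)) e)
    ; seed = λ k x o k< → back k x (seed L k x o k<)
    ; close = λ v k i e k< i< → back (suc k) _ (close L v k i (trans (sym (h v)) e) k< i<) }
    where
    back : ∀ k x → Reaches d (pair g u) k x → Reaches d′ (pair g u) k x
    back k x (l , l≤ , e) = l , l≤ , trans (h x) e

  module _ (A< : ∀ v x → A v x ≡ 1 → v < n × x < n) (A-sym : ∀ v x → A v x ≡ A x v)
    (R₀ : Rows 0 n 0 dg ad) (R₁ : Rows 1 n 0 dg ad)
    (member : ∀ x p → cen x ≡ suc p → isC p ≡ 1 × A p x ≡ 1) (isC≤1 : ∀ h → isC h ≤ 1)
    (diam : ℕ) (diam<n : diam < n)
    (conn : ∀ u v → u < n → v < n → Σ[ k ∈ ℕ ] k ≤ diam × Path A u v k)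
    -- Room for the largest queue: one source, n hubs, at most n² two-step seeds and a degree sum of
    -- at most n². The 4 also covers the small constants.
    (W≥ : 4 + (n + (n * n + n * n)) ≤ W) where

    Σdeg : ℕ → ℕ
    Σdeg g = S (λ v → dg (pair g v)) n

    E⇒A : ∀ g v x → E g v x ≡ 1 → A v x ≡ 1
    E⇒A zero    v x e = e
    E⇒A (suc g) v x e with A01 v x
    ... | inj₂ o = o
    ... | inj₁ z = ⊥-elim (1+n≢0 (trans (sym e) (cong (_* sparseEdge (cen v) (cen x)) z)))

    n≤W : n ≤ W
    n≤W = ≤-trans (≤-trans (m≤m+n n _) (m≤n+m _ 4)) W≥

    cap≤W : n + 3 ≤ W
    cap≤W = ≤-trans (≤-trans (≤-reflexive (+-comm n 3)) (≤-trans (+-monoʳ-≤ 3 (m≤m+n n _)) (n≤1+n _))) W≥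

    module Source (g u : ℕ) (u<n : u < n) (rows : Rows g n 0 dg ad) (Ob : ℕ → ℕ → Set) (c₀ : ℕ → ℕ) where

      row : ℕ
      row = pair g u

      Good : ℕ → ℕ → Set
      Good k v = v < n × Path A u v k

      good-step : ∀ {k v i} → Good k v → i < dg (pair g v) → Good (suc k) (ad (pair (pair g v) i))
      good-step {k} {v} {i} (v<n , p) i< with sound (before rows v v<n) i i<
      ... | e , x<n = x<n , p ▸ E⇒A g v _ e

      open Queue row g n (n + 3) dg ad Good Ob good-step public

      Σdeg≤ : Σdeg g ≤ n * n
      Σdeg≤ = S-≤-const n n (λ v _ → rows-len rows v)

      record Seeded (Ob′ : ℕ → ℕ → Set) (t : ℕ) (c it : ℕ → ℕ) : Set where
        constructor seeded
        field
          goods   : ∀ k i → i < c (at k) → Good k (it (pair (at k) i))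
          size    : entries c ≤ t
          off     : SameOff c c₀
          present : ∀ k x → Ob′ k x → Pending 0 0 c it k x
      open Seeded public

      seeded-none : ∀ {c it} → (∀ k → c (at k) ≡ 0) → SameOff c c₀ → Seeded (λ _ _ → ⊥) 0 c it
      seeded-none z o = seeded (λ k i i< → ⊥-elim (n≮0 (subst (i <_) (z k) i<)))
        (≤-reflexive (S-zero (suc (n + 3)) (λ k _ → z k))) o (λ _ _ ())

      seeded-push : ∀ {Ob₁ Ob₂ t c it k x} → Good k x →
        (∀ k′ x′ → Ob₂ k′ x′ → Ob₁ k′ x′ ⊎ (k′ ≡ k × x′ ≡ x)) → Seeded Ob₁ t c it →
        Seeded Ob₂ (suc t) (Bucket.c′ c it (at k) x) (Bucket.it′ c it (at k) x)
      seeded-push {Ob₁} {Ob₂} {t} {c} {it} {k} {x} gd ⊆ s = seeded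
        (buckets-push {c} {it} (goods s) gd)
        (≤-trans (entries-push c it k x) (s≤s (size s)))
        (off-update {c} {c₀} (off s)) pres
        where
        first : ∀ k i → 0 < k ⊎ (0 ≡ k × 0 ≤ i)
        first zero    i = inj₂ (refl , z≤n)
        first (suc k) i = inj₁ (s≤s z≤n)
        pres : ∀ k′ x′ → Ob₂ k′ x′ → Pending 0 0 (Bucket.c′ c it (at k) x) (Bucket.it′ c it (at k) x) k′ x′
        pres k′ x′ o with ⊆ k′ x′ o
        ... | inj₂ (refl , refl) = c (at k) , subst (c (at k) <_) (sym (Bucket.c-here c it (at k) x)) ≤-refl ,
                                   Bucket.it-new c it (at k) x , first k _
        ... | inj₁ o′ with present s k′ x′ o′
        ...   | i , i< , e , f = i , Bucket.c-grows c it (at k) x i< , trans (Bucket.it-old c it (at k) x i<) e , f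

      seeded-sub : ∀ {Ob₁ Ob₂ t t′ c it} → t ≤ t′ →
        (∀ k x → Ob₂ k x → Ob₁ k x) → Seeded Ob₁ t c it → Seeded Ob₂ t′ c it
      seeded-sub t≤ ⊆ s = seeded (goods s) (≤-trans (size s) t≤) (off s) (λ k x o → present s k x (⊆ k x o))

      seedR : ∀ {σ kk Q Ob₁ t} k x → scalar σ 4 ≡ row → scalar σ 6 ≡ k → scalar σ 7 ≡ x → k ≤ n + 3 → suc t ≤ W →
        Seeded Ob₁ t (array σ 8) (array σ 9) → Q kk (pushed σ row k x) → Run push σ (2 + kk) Q
      seedR {σ} k x e₄ e₆ e₇ k≤ t≤ s h = pushR row k x e₄ e₆ e₇
        (≤-trans (s≤s (≤-trans (entry≤ (array σ 8) k k≤) (size s))) t≤) h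

      startR : ∀ {σ kk Q} {_ : T (weight (pairE (lit g) (var 10)) <ᵇ 1024)} {_ : T (suc g <ᵇ 1024)} → g ≤ 1 →
        scalar σ 10 ≡ u → (∀ k → array σ 8 (at k) ≡ 0) → SameOff (array σ 8) c₀ →
        (∀ σ′ → Frame (start g) σ σ′ → scalar σ′ 4 ≡ row → scalar σ′ 5 ≡ g →
          Seeded (λ k x → k ≡ 0 × x ≡ u) 1 (array σ′ 8) (array σ′ 9) → Q kk σ′) →
        Run (start g) σ (6 + kk) Q
      startR {σ} {kk} {Q} {w} {w′} g≤1 e₁₀ z off h = frameR
        {Q = λ k′ σ′ → k′ ≡ kk × scalar σ′ 4 ≡ row × scalar σ′ 5 ≡ g × Seeded (λ k x → k ≡ 0 × x ≡ u) 1
          (array σ′ 8) (array σ′ 9)}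
        (seqR (assignR row {w} (cong (pair g) e₁₀) (λ _ → row≤)
        (seqR (assignR g {w′} refl (λ _ → ≤-trans g≤1 (≤-trans (m≤m+n 1 _) W≥))
        (seqR (assignR 0 refl (λ _ → z≤n)
        (seqR (assignR u e₁₀ (λ _ → ≤-trans (<⇒≤ u<n) n≤W)
        (seedR 0 u refl refl refl z≤n (≤-trans (m≤m+n 1 _) W≥) s₀
          (refl , refl , refl , seeded-push {it = array σ 9} (u<n , []) (λ k x o → inj₂ o) s₀))))))))))
        (λ { k′ τ fr (refl , e₄ , e₅ , s) → h τ fr e₄ e₅ s })
        where
        s₀ = seeded-none {array σ 8} {array σ 9} z off
        row≤ : row ≤ W
        row≤ = ≤-trans (≤-trans (+-mono-≤ (*-mono-≤ g+u≤n g+u≤n) g≤1)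
          (≤-trans (≤-reflexive (+-comm (n * n) 1))
            (+-mono-≤ {1} {4} (s≤s z≤n) (≤-trans (m≤m+n (n * n) (n * n)) (m≤n+m _ n))))) W≥
          where
          g+u≤n : g + u ≤ n
          g+u≤n = ≤-trans (+-monoˡ-≤ u g≤1) u<n

      -- As the row starts blank, `unlabelled` is the full degree sum, so at most `t + Σdeg g`
      -- entries ever enter the queue.
      finishR : ∀ {σ Q} t k d₀ → t + Σdeg g ≤ W → scalar σ 0 ≡ n → scalar σ 4 ≡ row → scalar σ 5 ≡ g →
        array σ 5 ≡ dg → array σ 6 ≡ ad → (∀ v → array σ 7 (at v) ≡ 0) → SameOff (array σ 7) d₀ →
        Seeded Ob t (array σ 8) (array σ 9) →
        (∀ τ → Frame dial σ τ → Labelled g u Ob (array τ 7) → SameOff (array τ 7) d₀ → SameOff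
          (array τ 8) c₀ → Q k τ) →
        Run dial σ (2 + ((n + 3) * 4 + ((t + Σdeg g) * 7 + (Σdeg g * 6 + k)))) Q
      finishR {σ} {Q} t k d₀ fit e₀ e₄ e₅ a₅ a₆ blank₀ offd s h =
        weakR (≤-reflexive (cong (λ x → 2 + ((n + 3) * 4 + ((t + Σdeg g) * 7 + (x * 6 + k)))) U≡))
          (dialR row g n dg ad Good Ob good-step proj₁ (rows-len rows) (t + Σdeg g) fit cap≤W d₀ c₀ k
            (e₀ , e₄ , e₅ , a₅ , a₆)
            (inv (goods s) (λ v l e → ⊥-elim (1+n≢0 (trans (sym e) (blank₀ v)))) (λ k x o → inj₂ (present s k x o))
                 (λ v l i e → ⊥-elim (1+n≢0 (trans (sym e) (blank₀ v)))) ,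
             +-mono-≤ (size s) (≤-reflexive U≡) , offd , off s)
            (λ { τ fr (I , _ , offd′ , offc′) → h τ fr
              (record { walk = λ v l e → proj₁ (labels I v l e)
                      ; seed = λ l x o l< → reached {d = array τ 7} {array τ 8} {array τ 9} (oblig I l x o) l<
                      ; close = λ v l i e l< i< → reached {d = array τ 7} {array τ 8} {array τ 9}
                        (closed I v l i e i< tt) l< }) offd′ offc′ }))
        where
        U≡ : unlabelled (array σ 7) ≡ Σdeg g
        U≡ = S-cong n (λ v _ → trans (cong (λ y → isZero y * dg (pair g v)) (blank₀ v)) (+-identityʳ _))

    IsSource : ℕ → ℕ → ℕ → Set
    IsSource u k x = k ≡ 0 × x ≡ u

    centerCost : ℕ
    centerCost = 8 + ((n + 3) * 4 + ((1 + Σdeg 0) * 7 + Σdeg 0 * 6))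

    record CentersDone (h : ℕ) (d c : ℕ → ℕ) : Set where
      field
        trees  : ∀ p → p < h → isC p ≡ 1 → Labelled 0 p (IsSource p) d
        later₀ : ∀ u v → h ≤ u → d (pair (pair 0 u) v) ≡ 0 × c (pair (pair 0 u) v) ≡ 0
        rows₁  : ∀ u v → d (pair (pair 1 u) v) ≡ 0 × c (pair (pair 1 u) v) ≡ 0
        blank  : ∀ p v → isC p ≡ 0 → d (pair (pair 0 p) v) ≡ 0
    open CentersDone public

    -- Multiplying the price of a search by the indicator `isC h` lets the sum over all vertices
    -- become the number of centers times that price.
    centersR : ∀ {σ Q} k → scalar σ 0 ≡ n → array σ 4 ≡ isC → array σ 5 ≡ dg → array σ 6 ≡ ad →
      (∀ i → array σ 7 i ≡ 0) → (∀ i → array σ 8 i ≡ 0) →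
      (∀ τ → Frame centers σ τ → CentersDone n (array τ 7) (array τ 8) → Q k τ) →
      Run centers σ (2 + S (λ h → 2 + (2 + isC h * centerCost)) n + k) Q
    centersR {σ} {Q} k s₀ a₄ a₅ a₆ z₇ z₈ done = frameR
      (forR {Q = L n} n (λ h → 2 + isC h * centerCost) L n≤W (λ i k τ _ fr _ → trans (scalarOf fr 0) s₀)
        (refl , record { trees = λ _ () ; later₀ = λ u v _ → z₇ _ , z₈ _ ; rows₁ = λ u v → z₇ _ , z₈ _ ; blank =
          λ _ _ _ → z₇ _ })
        body (λ _ _ _ h → h))
      (λ { k′ τ fr (refl , h) → done τ fr h })
      where
      L : ℕ → ℕ → State → Set
      L h k′ τ = k′ ≡ k × CentersDone h (array τ 7) (array τ 8)
      body : ∀ h k τ → h < n → Frame centers σ τ → L h k τ →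
             Run _ (setScalar 10 h τ) (2 + isC h * centerCost + k) (L (suc h))
      body h k′ τ h<n fr (refl , C) = iteR
        (λ nz → let o = isC≡1 (λ z → nz (trans isC≡ z)) in weakR (enough o) (center o))
        (λ z → weakR (s≤s (m≤n+m k _)) (skipR (refl , idle (trans (sym isC≡) z))))
        where
        d = array τ 7
        c = array τ 8
        isC≡ : array τ 4 h ≡ isC h
        isC≡ = cong (λ f → f h) (trans (arrayOf fr 4) a₄)
        isC≡1 : isC h ≢ 0 → isC h ≡ 1
        isC≡1 ne = ≤-antisym (isC≤1 h) (n≢0⇒n>0 ne)
        lem : ∀ a s k → 6 + (2 + (a * 4 + ((1 + s) * 7 + (s * 6 + k)))) ≡ 8 + (a * 4 + ((1 + s) * 7 + s * 6)) + k
        lem = solve-∀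
        enough : isC h ≡ 1 → 6 + (2 + ((n + 3) * 4 + ((1 + Σdeg 0) * 7 + (Σdeg 0 * 6 + k))))
          ≤ 1 + isC h * centerCost + k
        enough o = ≤-trans (≤-reflexive (trans (lem (n + 3) (Σdeg 0) k)
          (cong (_+ k) (trans (sym (*-identityˡ centerCost)) (cong (_* centerCost) (sym o)))))) (n≤1+n _)
        idle : isC h ≡ 0 → CentersDone (suc h) d c
        idle z = record
          { trees = λ p p< o → trees C p (≤∧≢⇒< (≤-pred p<) (λ { refl → 1+n≢0 (trans (sym o) z) })) o
          ; later₀ = λ u v h< → later₀ C u v (<⇒≤ h<) ; rows₁ = rows₁ C ; blank = blank C }
        open Source 0 h h<n R₀ (IsSource h) c
        fit : 1 + Σdeg 0 ≤ W
        fit = ≤-trans (+-mono-≤ {1} {4} (s≤s z≤n) (≤-trans Σdeg≤ (≤-trans (m≤m+n (n * n) (n * n)) (m≤n+m _ n)))) W≥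
        next : ∀ {d′ c′} → isC h ≡ 1 → Labelled 0 h (IsSource h) d′ → SameOff d′ d → SameOff c′ c → CentersDone
          (suc h) d′ c′
        next {d′} {c′} o L′ offd offc = record
          { trees = tr
          ; later₀ = λ u v h< → trans (offd _ v (other h<)) (proj₁ (later₀ C u v (<⇒≤ h<))) ,
                                trans (offc _ v (other h<)) (proj₂ (later₀ C u v (<⇒≤ h<)))
          ; rows₁ = λ u v → trans (offd _ v (one u)) (proj₁ (rows₁ C u v)) , trans (offc _ v (one u))
            (proj₂ (rows₁ C u v))
          ; blank = λ p v z → trans (offd _ v (λ e → 1+n≢0
            (trans (sym o) (trans (cong isC (sym (pair-inj₂ {0} {p} {0} {h} e))) z)))) (blank C p v z) }
          where
          other : ∀ {u} → h < u → pair 0 u ≢ row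
          other {u} h< e = <⇒≢ h< (sym (pair-inj₂ {0} {u} {0} {h} e))
          one : ∀ u → pair 1 u ≢ row
          one u e = 1+n≢0 (pair-inj₁ {1} {u} {0} {h} e)
          tr : ∀ p → p < suc h → isC p ≡ 1 → Labelled 0 p (IsSource p) d′
          tr p p< o with p ≟ h
          ... | yes refl = L′
          ... | no p≢ = labelled-cong (λ v → offd _ v (λ e → p≢ (pair-inj₂ {0} {p} {0} {h} e)))
                                      (trees C p (≤∧≢⇒< (≤-pred p<) p≢) o)
        center : isC h ≡ 1 → Run (start 0 ⨾ dial) (setScalar 10 h τ)
                   (6 + (2 + ((n + 3) * 4 + ((1 + Σdeg 0) * 7 + (Σdeg 0 * 6 + k))))) (L (suc h))
        center o = seqR (startR z≤n refl (λ v → proj₂ (later₀ C h v ≤-refl)) (λ _ _ _ → refl)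
          (λ σ′ fr′ e₄ e₅ s → finishR 1 k d fit (trans (scalarOf fr′ 0) (trans (scalarOf fr 0) s₀)) e₄ e₅
            (trans (arrayOf fr′ 5) (trans (arrayOf fr 5) a₅)) (trans (arrayOf fr′ 6) (trans (arrayOf fr 6) a₆))
            (λ v → trans (cong (λ f → f _) (arrayOf fr′ 7)) (proj₁ (later₀ C h v ≤-refl)))
            (λ r v _ → cong (λ f → f _) (arrayOf fr′ 7)) s
            (λ τ′ fr″ L′ offd offc → refl , next o L′ offd offc)))

    reach-step : ∀ {g u Ob d} → Rows g n 0 dg ad → Labelled g u Ob d → ∀ {k v x} → v < n → x < n → E g v x ≡ 1 →
      suc k < n + 3 → Reaches d (pair g u) k v → Reaches d (pair g u) (suc k) x
    reach-step {g} {u} {Ob} {d} rows L {k} {v} {x} v<n x<n e k< (l , l≤ , p) with full (before rows v v<n) x x<n e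
    ... | i , i< , refl with close L v l i p (≤-trans (s≤s (s≤s l≤)) k<) i<
    ...   | l′ , l′≤ , p′ = l′ , ≤-trans l′≤ (s≤s l≤) , p′

    -- The label is bounded by the length of every path from the center; `walk` supplies the other
    -- direction, so these labels are exact distances.
    tree-exact : ∀ {p d} → p < n → Labelled 0 p (IsSource p) d → ∀ {v k} → Path A p v k → k < n + 3 →
      Reaches d (pair 0 p) k v
    tree-exact p<n L []      k< = seed L 0 _ (refl , refl) k<
    tree-exact p<n L (_▸_ {v} {x} π e) k< =
      reach-step R₀ L (proj₁ (A< v x e)) (proj₂ (A< v x e)) e k< (tree-exact p<n L π (<-trans (n<1+n _) k<))

    diam<cap : diam < n + 3
    diam<cap = ≤-trans diam<n (m≤m+n n 3)

    -- Searches from unclustered vertices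

    module Sparse (D₀ c₀ : ℕ → ℕ) (C : CentersDone n D₀ c₀) where

      center-dist : ∀ {p v} → isC p ≡ 1 → p < n → v < n →
        Σ[ l ∈ ℕ ] D₀ (pair (pair 0 p) v) ≡ suc l × l ≤ diam × Path A p v l
      center-dist {p} {v} o p<n v<n with conn p v p<n v<n
      ... | k , k≤ , π with tree-exact p<n (trees C p p<n o) π (≤-trans (s≤s k≤) diam<cap)
      ...   | l , l≤ , e = l , e , ≤-trans l≤ k≤ , proj₂ (walk (trees C p p<n o) v l e)

      member< : ∀ {x p} → cen x ≡ suc p → p < n
      member< {x} {p} e = proj₁ (A< p x (proj₂ (member x p e)))

      -- The seeds of the search from u, up to hub w and position j in the list of neighbour i of u.
      data SeedTo (u w i j : ℕ) : ℕ → ℕ → Set where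
        source : SeedTo u w i j 0 u
        hub    : ∀ {x p} → x < w → cen x ≡ suc p → SeedTo u w i j (D₀ (pair (pair 0 p) u)) x
        hop    : ∀ {i′ j′} → i′ < i → j′ < dg (pair 0 (ad (pair (pair 1 u) i′))) →
                 SeedTo u w i j 2 (ad (pair (pair 0 (ad (pair (pair 1 u) i′))) j′))
        last   : ∀ {j′} → j′ < j → SeedTo u w i j 2 (ad (pair (pair 0 (ad (pair (pair 1 u) i))) j′))

      Seed : ℕ → ℕ → ℕ → Set
      Seed u = SeedTo u n (dg (pair 1 u)) 0

      module Search (u : ℕ) (u<n : u < n) (c₁ : ℕ → ℕ) where
        open Source 1 u u<n R₁ (Seed u) c₁

        Ready : State → Set
        Ready τ = scalar τ 0 ≡ n × scalar τ 4 ≡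
          row × scalar τ 5 ≡ 1 × scalar τ 10 ≡ u × array τ 3 ≡ cen × array τ 5 ≡ dg × array τ 6 ≡ ad

        keep : ∀ {p σ τ} → Frame p σ τ → {T (keepsScalar 0 p)}
          → {T (keepsScalar 4 p)} → {T (keepsScalar 5 p)} → {T (keepsScalar 10 p)} →
            {T (keepsArray 3 p)} → {T (keepsArray 5 p)} → {T (keepsArray 6 p)} → Ready σ → Ready τ
        keep fr {h₀} {h₄} {h₅} {h₁₀} {k₃} {k₅} {k₆} (e₀ , e₄ , e₅ , e₁₀ , a₃ , a₅ , a₆) =
          trans (scalarOf fr 0 {h₀}) e₀ , trans (scalarOf fr 4 {h₄}) e₄ , trans (scalarOf fr 5 {h₅}) e₅ , trans
            (scalarOf fr 10 {h₁₀}) e₁₀ ,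
          trans (arrayOf fr 3 {k₃}) a₃ , trans (arrayOf fr 5 {k₅}) a₅ , trans (arrayOf fr 6 {k₆}) a₆

        Has : ℕ → ℕ → ℕ → ℕ → State → Set
        Has w i j t τ = Seeded (SeedTo u w i j) t (array τ 8) (array τ 9)

        d₁ = dg (pair 1 u)
        d₁≤n : d₁ ≤ n
        d₁≤n = rows-len R₁ u

        hubsR : ∀ {σ Q} k → Ready σ → (∀ p → array σ 7 (pair (pair 0 p) u) ≡ D₀ (pair (pair 0 p) u)) →
          Has 0 0 0 1 σ → (∀ τ → Frame hubs σ τ → Has n 0 0 (1 + n) τ → Q k τ) → Run hubs σ (2 + (n * 7 + k)) Q
        hubsR {σ} {Q} k st d≡ H₀ done = frameR
          (forC {Q = L n} n 5 L n≤W (λ i k τ _ fr _ → trans (scalarOf fr 0) (proj₁ st)) (refl , H₀) body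
            (λ _ _ _ h → h))
          (λ { k′ τ fr (refl , h) → done τ fr h })
          where
          L : ℕ → ℕ → State → Set
          L w k′ τ = k′ ≡ k × Has w 0 0 (1 + w) τ
          body : ∀ w k τ → w < n → Frame hubs σ τ → L w k τ → Run _ (setScalar 11 w τ) (5 + k) (L (suc w))
          body w k′ τ w<n fr (refl , H) with keep fr st
          ... | e₀ , e₄ , e₅ , e₁₀ , a₃ , a₅ , a₆ = iteR
            (λ nz → marked (cen w) refl (λ z → nz (trans c≡ z)))
            (λ z → weakR (s≤s (m≤n+m k 3)) (skipR
              (refl , seeded-sub (n≤1+n _) (λ k x → unmarked (trans (sym c≡) z)) H)))
            where
            c≡ : array τ 3 w ≡ cen w
            c≡ = cong (λ f → f w) a₃
            unmarked : cen w ≡ 0 → ∀ {k x} → SeedTo u (suc w) 0 0 k x → SeedTo u w 0 0 k x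
            unmarked z source = source
            unmarked z (hub {x} x< e) = hub (≤∧≢⇒< (≤-pred x<) (λ { refl → 1+n≢0 (trans (sym e) z) })) e
            marked : ∀ c → cen w ≡ c → c ≢ 0 →
              Run ( assign 6 (get 7 (pairE (pairE (lit 0) (bin sub (get 3 (var 11)) (lit 1))) (var 10)))
                  ⨾ assign 7 (var 11) ⨾ push ) (setScalar 11 w τ) (4 + k) (L (suc w))
            marked zero    cw ne = ⊥-elim (ne refl)
            marked (suc p) cw ne with center-dist (proj₁ (member w p cw)) (member< cw) u<n
            ... | l , dl , l≤ , π =
              seqR (assignR t (trans (cong₂ (λ x y → array τ 7 (pair (pair 0 (x ∸ 1)) y)) (trans c≡ cw) e₁₀)
                                (trans (cong (λ f → f _) (arrayOf fr 7)) (d≡ p)))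
                              (λ _ → ≤-trans (≤-reflexive dl) (≤-trans (≤-trans (s≤s l≤) diam<n) n≤W))
              (seqR (assignR w refl (λ _ → ≤-trans (<⇒≤ w<n) n≤W)
              (seedR t w e₄ refl refl (≤-trans (≤-reflexive dl) (≤-trans (s≤s l≤) (≤-trans diam<n (m≤m+n n 3))))
                (≤-trans (s≤s (s≤s (<⇒≤ w<n))) (≤-trans (+-mono-≤ {2} {4} (s≤s (s≤s z≤n)) (m≤m+n n _)) W≥)) H
                (refl , seeded-push {c = array τ 8} {array τ 9} good split H)))))
              where
              t = D₀ (pair (pair 0 p) u)
              good : Good t w
              -- The recorded path runs from the center to u; reversed and prolonged by the edge to
              -- `w` it has exactly the length used as level.
              good = w<n , subst (Path A u w) (sym dl) (path-rev A-sym π ▸ proj₂ (member w p cw))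
              split : ∀ k x → SeedTo u (suc w) 0 0 k x → SeedTo u w 0 0 k x ⊎ (k ≡ t × x ≡ w)
              split _ _ source = inj₁ source
              split _ x (hub x< e) with x ≟ w
              ... | yes refl = inj₂ (cong (λ p → D₀ (pair (pair 0 p) u)) (suc-injective (trans (sym e) cw)) , refl)
              ... | no x≢    = inj₁ (hub (≤∧≢⇒< (≤-pred x<) x≢) e)

        module _ (i : ℕ) (i<d : i < d₁) where
          y = ad (pair (pair 1 u) i)
          dy = dg (pair 0 y)

          -- Each neighbour is charged n whatever its degree. Summed over all sources this gives n
          -- times the degree sum of the sparse graph, still of order n²s.
          hopR : ∀ {σ Q} k → Ready σ → scalar σ 13 ≡ y → Has n i 0 (1 + (n + i * n)) σ →
            (∀ τ → Frame hopP σ τ → Has n (suc i) 0 (1 + (n + suc i * n)) τ → Q k τ) → Run hopP σ (2 + (n * 6 + k)) Q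
          hopR {σ} {Q} k st e₁₃ H₀ done = weakR (s≤s (s≤s (+-monoˡ-≤ k (*-monoˡ-≤ 6 dy≤n)))) (frameR
            (forC {Q = L dy} dy 4 L (≤-trans dy≤n n≤W) bound
              (refl , subst (λ t → Has n i 0 t σ) (sym (+-identityʳ _)) H₀) body (λ _ _ _ h → h))
            (λ { k′ τ fr (refl , h) → done τ fr (seeded-sub size≤ step h) }))
            where
            dy≤n : dy ≤ n
            dy≤n = rows-len R₀ y
            lem : ∀ n x → 1 + (n + x) + n ≡ 1 + (n + (n + x))
            lem = solve-∀
            size≤ : 1 + (n + i * n) + dy ≤ 1 + (n + suc i * n)
            size≤ = ≤-trans (+-monoʳ-≤ (1 + (n + i * n)) dy≤n) (≤-reflexive (lem n (i * n)))
            step : ∀ k x → SeedTo u n (suc i) 0 k x → SeedTo u n i dy k x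
            step _ _ source = source
            step _ _ (hub x< e) = hub x< e
            step _ _ (hop {i′} i< j<) with i′ ≟ i
            ... | yes refl = last j<
            ... | no i≢    = hop (≤∧≢⇒< (≤-pred i<) i≢) j<
            L : ℕ → ℕ → State → Set
            L j k′ τ = k′ ≡ k × Has n i j (1 + (n + i * n) + j) τ
            bound : ∀ j k τ → j ≤ dy → Frame hopP σ τ → L j k τ → array τ 5 (pair 0 (scalar τ 13)) ≡ dy
            bound j k τ _ fr _ with keep fr st
            ... | _ , _ , _ , _ , _ , a₅ , _ = trans (cong (λ f → f _) a₅)
                  (cong (λ z → dg (pair 0 z)) (trans (scalarOf fr 13) e₁₃))
            body : ∀ j k τ → j < dy → Frame hopP σ τ → L j k τ → Run _ (setScalar 12 j τ) (4 + k) (L (suc j))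
            body j k′ τ j<d fr (refl , H) with keep fr st
            ... | e₀ , e₄ , e₅ , e₁₀ , a₃ , a₅ , a₆ =
              seqR (assignR 2 refl (λ _ → ≤-trans (m≤m+n 2 _) W≥)
              (seqR (assignR x (trans (cong (λ f → f _) a₆)
                (cong (λ z → ad (pair (pair 0 z) j)) (trans (scalarOf fr 13) e₁₃)))
                      (λ _ → ≤-trans (<⇒≤ (proj₁ good)) n≤W)
              (seedR 2 x e₄ refl refl (≤-trans (n≤1+n 2) (m≤n+m 3 n)) fit H
                (refl , subst (λ t → Seeded (SeedTo u n i (suc j)) t (Bucket.c′ (array τ 8) (array τ 9) (at 2) x)
                  (Bucket.it′ (array τ 8) (array τ 9) (at 2) x))
                          (sym (+-suc _ j)) (seeded-push {c = array τ 8} {array τ 9} good split H))))))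
              where
              x = ad (pair (pair 0 y) j)
              uy = sound (before R₁ u u<n) i i<d
              yx = sound (before R₀ y (proj₂ uy)) j j<d
              good : Good 2 x
              good = proj₂ yx , ([] ▸ E⇒A 1 u y (proj₁ uy)) ▸ proj₁ yx
              split : ∀ k z → SeedTo u n i (suc j) k z → SeedTo u n i j k z ⊎ (k ≡ 2 × z ≡ x)
              split _ _ source = inj₁ source
              split _ _ (hub x< e) = inj₁ (hub x< e)
              split _ _ (hop i< j<) = inj₁ (hop i< j<)
              split _ _ (last {j′} j<) with j′ ≟ j
              ... | yes refl = inj₂ (refl , refl)
              ... | no j≢    = inj₁ (last (≤∧≢⇒< (≤-pred j<) j≢))
              fit : suc (1 + (n + i * n) + j) ≤ W
              fit = begin
                suc (1 + (n + i * n) + j)  ≡⟨ sym (+-suc (1 + (n + i * n)) j) ⟩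
                1 + (n + i * n) + suc j    ≤⟨ +-monoʳ-≤ (1 + (n + i * n)) (≤-trans j<d dy≤n) ⟩
                1 + (n + i * n) + n        ≡⟨ lem n (i * n) ⟩
                1 + (n + suc i * n)        ≤⟨ +-monoʳ-≤ 1 (+-monoʳ-≤ n (*-monoˡ-≤ n (≤-trans i<d d₁≤n))) ⟩
                1 + (n + n * n)            ≤⟨ +-mono-≤ {1} {4} (s≤s z≤n) (+-monoʳ-≤ n (m≤m+n (n * n) (n * n))) ⟩
                4 + (n + (n * n + n * n))  ≤⟨ W≥ ⟩
                W                          ∎
                where open ≤-Reasoning

        twoHopsR : ∀ {σ Q} k → Ready σ → Has n 0 0 (1 + n) σ →
          (∀ τ → Frame twoHops σ τ → Has n d₁ 0 (1 + (n + d₁ * n)) τ → Q k τ) → Run twoHops σ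
            (2 + (d₁ * (5 + n * 6) + k)) Q
        twoHopsR {σ} {Q} k st H₀ done = frameR
          (forC {Q = L d₁} d₁ (3 + n * 6) L (≤-trans d₁≤n n≤W) bound
            (refl , subst (λ t → Has n 0 0 (suc t) σ) (sym (+-identityʳ n)) H₀) body (λ _ _ _ h → h))
          (λ { k′ τ fr (refl , h) → done τ fr h })
          where
          L : ℕ → ℕ → State → Set
          L i k′ τ = k′ ≡ k × Has n i 0 (1 + (n + i * n)) τ
          bound : ∀ i k τ → i ≤ d₁ → Frame twoHops σ τ → L i k τ → array τ 5 (pair 1 (scalar τ 10)) ≡ d₁
          bound i k τ _ fr _ with keep fr st
          ... | _ , _ , _ , e₁₀ , _ , a₅ , _ = trans (cong (λ f → f _) a₅) (cong (λ z → dg (pair 1 z)) e₁₀)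
          body : ∀ i k τ → i < d₁ → Frame twoHops σ τ → L i k τ → Run _ (setScalar 11 i τ) (3 + n * 6 + k) (L (suc i))
          body i k′ τ i<d fr (refl , H) with keep fr st
          ... | st′@(e₀ , e₄ , e₅ , e₁₀ , a₃ , a₅ , a₆) =
            seqR (assignR (y i i<d) (trans (cong (λ f → f _) a₆) (cong (λ z → ad (pair (pair 1 z) i)) e₁₀))
                   (λ _ → ≤-trans (<⇒≤ (proj₂ (sound (before R₁ u u<n) i i<d))) n≤W)
            (hopR i i<d k st′ refl H (λ τ′ _ H′ → refl , H′)))

      sparseCost : ℕ → ℕ
      sparseCost u = 13 + n * 7 + dg (pair 1 u) * (5 + n * 6)
        + ((n + 3) * 4 + ((1 + (n + dg (pair 1 u) * n) + Σdeg 1) * 7 + Σdeg 1 * 6))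

      -- Seeds refer to the snapshot `D₀` taken after the searches from centers, while the label
      -- array goes on being filled; `kept₀` ties the two together.
      record SparseDone (h : ℕ) (d c : ℕ → ℕ) : Set where
        field
          trees₁ : ∀ u → u < h → cen u ≡ 0 → Labelled 1 u (Seed u) d
          later₁ : ∀ u v → h ≤ u → d (pair (pair 1 u) v) ≡ 0 × c (pair (pair 1 u) v) ≡ 0
          kept₀  : ∀ p v → d (pair (pair 0 p) v) ≡ D₀ (pair (pair 0 p) v)
      open SparseDone public

      sparseSearchR : ∀ {σ Q} k → scalar σ 0 ≡ n → array σ 3 ≡ cen → array σ 5 ≡ dg → array σ 6 ≡ ad →
        array σ 7 ≡ D₀ → array σ 8 ≡ c₀ →
        (∀ τ → Frame sparseSearch σ τ → SparseDone n (array τ 7) (array τ 8) → Q k τ) →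
        Run sparseSearch σ (2 + S (λ u → 2 + sparseCost u) n + k) Q
      sparseSearchR {σ} {Q} k s₀ a₃ a₅ a₆ a₇ a₈ done = frameR
        (forR {Q = L n} n sparseCost L n≤W (λ i k τ _ fr _ → trans (scalarOf fr 0) s₀)
          (refl , subst₂ (SparseDone 0) (sym a₇) (sym a₈)
            (record { trees₁ = λ _ () ; later₁ = λ u v _ → rows₁ C u v ; kept₀ = λ _ _ → refl }))
          body (λ _ _ _ h → h))
        (λ { k′ τ fr (refl , h) → done τ fr h })
        where
        L : ℕ → ℕ → State → Set
        L h k′ τ = k′ ≡ k × SparseDone h (array τ 7) (array τ 8)
        body : ∀ u k τ → u < n → Frame sparseSearch σ τ → L u k τ →
               Run _ (setScalar 10 u τ) (sparseCost u + k) (L (suc u))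
        body u k′ τ u<n fr (refl , P) = weakR (≤-reflexive (lem (n + 3) n (Σdeg 1) (dg (pair 1 u)) k)) (iteR
          (λ nz → weakR (s≤s k≤) (skipR (refl , idle (λ z → nz (trans c≡ z)))))
          (λ z → search (trans (sym c≡) z)))
          where
          d = array τ 7
          c = array τ 8
          c≡ : array τ 3 u ≡ cen u
          c≡ = cong (λ f → f u) (trans (arrayOf fr 3) a₃)
          t = 1 + (n + dg (pair 1 u) * n)
          rest = 2 + ((n + 3) * 4 + ((t + Σdeg 1) * 7 + (Σdeg 1 * 6 + k)))
          k≤ : k ≤ 7 + (n * 7 + (2 + (dg (pair 1 u) * (5 + n * 6) + rest)))
          k≤ = ≤-trans (≤-trans (m≤n+m k (Σdeg 1 * 6))
            (≤-trans (m≤n+m _ ((t + Σdeg 1) * 7)) (≤-trans (m≤n+m _ ((n + 3) * 4)) (m≤n+m _ 2))))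
            (≤-trans (m≤n+m rest (dg (pair 1 u) * (5 + n * 6)))
              (≤-trans (m≤n+m _ 2) (≤-trans (m≤n+m _ (n * 7)) (m≤n+m _ 7))))
          lem : ∀ a n s e k → 1 + (6 + (2 + (n * 7 +
            (2 + (e * (5 + n * 6) + (2 + (a * 4 + ((1 + (n + e * n) + s) * 7 + (s * 6 + k)))))))))
            ≡ 13 + n * 7 + e * (5 + n * 6) + (a * 4 + ((1 + (n + e * n) + s) * 7 + s * 6)) + k
          lem = solve-∀
          idle : cen u ≢ 0 → SparseDone (suc u) d c
          idle ne = record
            { trees₁ = λ v v< z → trees₁ P v (≤∧≢⇒< (≤-pred v<) (λ { refl → ne z })) z
            ; later₁ = λ v x v> → later₁ P v x (<⇒≤ v>) ; kept₀ = kept₀ P }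
          open Source 1 u u<n R₁ (Seed u) c
          open Search u u<n c
          fit : t + Σdeg 1 ≤ W
          fit = ≤-trans (≤-trans (+-mono-≤ (+-mono-≤ {1} {4} (s≤s z≤n) (+-monoʳ-≤ n (*-monoˡ-≤ n d₁≤n))) Σdeg≤)
                  (≤-reflexive (lem′ n (n * n)))) W≥
            where
            lem′ : ∀ n x → 4 + (n + x) + x ≡ 4 + (n + (x + x))
            lem′ = solve-∀
          next : ∀ {d′ c′} → Labelled 1 u (Seed u) d′ → SameOff d′ d → SameOff c′ c → SparseDone (suc u) d′ c′
          next {d′} L′ offd offc = record
            { trees₁ = tr
            ; later₁ = λ v x u< → trans (offd _ x (other u<)) (proj₁ (later₁ P v x (<⇒≤ u<))) ,
                                  trans (offc _ x (other u<)) (proj₂ (later₁ P v x (<⇒≤ u<)))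
            ; kept₀ = λ p x → trans (offd _ x (λ e → 1+n≢0 (sym (pair-inj₁ {0} {p} {1} {u} e)))) (kept₀ P p x) }
            where
            other : ∀ {v} → u < v → pair 1 v ≢ row
            other {v} u< e = <⇒≢ u< (sym (pair-inj₂ {1} {v} {1} {u} e))
            tr : ∀ v → v < suc u → cen v ≡ 0 → Labelled 1 v (Seed v) d′
            tr v v< z with v ≟ u
            ... | yes refl = L′
            ... | no v≢ = labelled-cong (λ x → offd _ x (λ e → v≢ (pair-inj₂ {1} {v} {1} {u} e)))
                                        (trees₁ P v (≤∧≢⇒< (≤-pred v<) v≢) z)
          search : cen u ≡ 0 → Run (start 1 ⨾ hubs ⨾ twoHops ⨾ dial) (setScalar 10 u τ)
                     (6 + (2 + (n * 7 + (2 + (dg (pair 1 u) * (5 + n * 6) + rest))))) (L (suc u))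
          search z = seqR (startR ≤-refl refl (λ v → proj₂ (later₁ P u v ≤-refl)) (λ _ _ _ → refl)
            (λ σ₁ fr₁ e₄ e₅ s → let
                st₁ : Ready σ₁
                st₁ = trans (scalarOf fr₁ 0) (trans (scalarOf fr 0) s₀) , e₄ , e₅ , scalarOf fr₁ 10 ,
                      trans (arrayOf fr₁ 3) (trans (arrayOf fr 3) a₃) ,
                      trans (arrayOf fr₁ 5) (trans (arrayOf fr 5) a₅) , trans (arrayOf fr₁ 6)
                        (trans (arrayOf fr 6) a₆)
              in seqR (hubsR (2 + (dg (pair 1 u) * (5 + n * 6) + rest)) st₁
                (λ p → trans (cong (λ f → f _) (arrayOf fr₁ 7)) (kept₀ P p u))
                (seeded-sub ≤-refl (λ { _ _ source → refl , refl }) s)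
                (λ σ₂ fr₂ H₂ → seqR (twoHopsR rest (keep fr₂ st₁) H₂
                (λ σ₃ fr₃ H₃ → let
                    st₃ = keep fr₃ (keep fr₂ st₁)
                    d₃ : array σ₃ 7 ≡ d
                    d₃ = trans (arrayOf fr₃ 7) (trans (arrayOf fr₂ 7) (arrayOf fr₁ 7))
                  in finishR t k d fit (proj₁ st₃) (proj₁ (proj₂ st₃)) (proj₁ (proj₂ (proj₂ st₃)))
                  (proj₁ (proj₂ (proj₂ (proj₂ (proj₂ (proj₂ st₃))))))
                    (proj₂ (proj₂ (proj₂ (proj₂ (proj₂ (proj₂ st₃))))))
                  (λ v → trans (cong (λ f → f _) d₃) (proj₁ (later₁ P u v ≤-refl)))
                  (λ r v _ → cong (λ f → f _) d₃) H₃
                  (λ τ′ fr′ L′ offd offc → refl , next L′ offd offc)))))))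

      -- Quality of the estimate

      module Estimate {d c : ℕ → ℕ} (P : SparseDone n d c) where

        -- As u is unclustered, its list in the sparse graph contains all its neighbours. The second
        -- step uses the full graph, so it may join two clustered vertices.
        seed-hop : ∀ {u x y} → u < n → cen u ≡ 0 → A u x ≡ 1 → A x y ≡ 1 → Seed u 2 y
        seed-hop {u} {x} {y} u<n cu e f with A< x y f
        ... | x<n , y<n with full (before R₁ u u<n) x x<n (cong₂ _*_ e (cong (λ z → sparseEdge z (cen x)) cu))
        ...   | i , i< , refl with full (before R₀ x x<n) y y<n f
        ...     | j , j< , refl = hop i< j<

        unmarked-edge : ∀ {v x} → A v x ≡ 1 → cen x ≡ 0 → E 1 v x ≡ 1
        unmarked-edge {v} {x} e cx = cong₂ _*_ e (trans (cong (sparseEdge (cen v)) cx) (right (cen v)))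
          where
          right : ∀ c → sparseEdge c 0 ≡ 1
          right zero    = refl
          right (suc _) = refl

        weaken : ∀ {row k k′ x} → k ≤ k′ → Reaches d row k x → Reaches d row k′ x
        weaken k≤ (l , l≤ , e) = l , ≤-trans l≤ k≤ , e

        module _ {u : ℕ} (u<n : u < n) (cu : cen u ≡ 0) where

          private tree = trees₁ P u u<n cu

          -- An edge into a cluster vertex x costs nothing extra beyond the detour over the center of
          -- x, since the distance from the center is exact; all other edges are in the graph 1.
          approx : ∀ {v k} → Path A u v k → k + 2 < n + 3 → Reaches d (pair 1 u) (k + 2) v
          approx [] k< = weaken {pair 1 u} {0} {2} {u} z≤n (seed tree 0 u source (≤-trans (m≤m+n 1 2) (m≤n+m 3 n)))
          approx (_▸_ {v} {x} {k} π e) k< = go (cen x) refl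
            where
            v<n = proj₁ (A< v x e)
            x<n = proj₂ (A< v x e)
            go : ∀ c → cen x ≡ c → Reaches d (pair 1 u) (suc k + 2) x
            go zero    cx = reach-step R₁ tree v<n x<n (unmarked-edge e cx) k< (approx π (<-trans (n<1+n _) k<))
            -- The walk from p over x back to u has length `k + 2`, so x is seeded at level at most
            -- `k + 3`. No label of an earlier vertex of the path enters here: the error restarts at
            -- every clustered vertex and cannot accumulate.
            go (suc p) cx with member x p cx
            ... | o , f with tree-exact (member< cx) (trees C p (member< cx) o)
                  (path-cons A-sym f (path-rev A-sym (π ▸ e)))
                             (≤-trans (s≤s (≤-trans (≤-reflexive (+-comm 2 k)) (n≤1+n _))) k<)
            ... | l , l≤ , dl with seed tree _ x (hub x<n cx)
                  (subst (_< n + 3) (sym dl) (≤-trans (s≤s (s≤s (≤-trans l≤ (≤-reflexive (+-comm 2 k))))) k<))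
            ... | l′ , l′≤ , e′ = l′ , ≤-trans l′≤
                  (≤-trans (≤-reflexive dl) (s≤s (≤-trans l≤ (≤-reflexive (+-comm 2 k))))) , e′

          -- The first edge leaves the unclustered u and the last one enters the unclustered v, so
          -- both lie in the sparse graph. A middle edge of a path of length 3 may be missing, but
          -- the seed two steps from u jumps over it.
          exact : ∀ {v k} → cen v ≡ 0 → k ≤ 3 → Path A u v k → Reaches d (pair 1 u) k v
          exact cv k≤ π = short cv π (≤-trans (s≤s k≤)
            (≤-trans (≤-reflexive (+-comm 1 3))
            (≤-trans (+-monoʳ-≤ 3 (≤-trans (s≤s z≤n) u<n)) (≤-reflexive (+-comm 3 n))))) k≤
            where
            short : ∀ {v k} → cen v ≡ 0 → Path A u v k → k < n + 3 → k ≤ 3 → Reaches d (pair 1 u) k v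
            short cv [] k< _ = seed tree 0 u source k<
            short {v} cv ([] ▸ e) k< _ = reach-step R₁ tree (proj₁ (A< u v e)) (proj₂ (A< u v e))
              (unmarked-edge e cv) k<
              (seed tree 0 u source (<-trans (n<1+n 0) k<))
            short cv ([] ▸ e ▸ f) k< _ = seed tree 2 _ (seed-hop u<n cu e f) k<
            short {v} cv (_▸_ {w} ([] ▸ e ▸ f) g) k< _ = reach-step R₁ tree (proj₁ (A< w v g)) (proj₂ (A< w v g))
              (unmarked-edge g cv) k<
              (seed tree 2 _ (seed-hop u<n cu e f) (<-trans (n<1+n 2) k<))
            short cv (_ ▸ _ ▸ _ ▸ _ ▸ _) k< (s≤s (s≤s (s≤s ())))

        est₀ est₁ : ℕ → ℕ → ℕ
        est₀ u v = d (pair (pair 0 u) v) ∸ 1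
        est₁ u v = d (pair (pair 1 u) v) ∸ 1

        est₁-walk : ∀ {u v} → u < n → v < n → cen u ≡ 0 → Path A u v (est₁ u v)
        est₁-walk {u} {v} u<n v<n cu with conn u v u<n v<n
        ... | k , k≤ , π with approx u<n cu π (subst (_≤ n + 3) (+-suc k 2) (+-monoˡ-≤ 3 (≤-trans k≤ (<⇒≤ diam<n))))
        ...   | l , _ , e = subst (λ z → Path A u v (z ∸ 1)) (sym e) (proj₂ (walk (trees₁ P u u<n cu) v l e))

        -- The guarantee T ≤ d + 2 bounds T ∸ 2, and exactness up to distance 3 bounds min 4 T.
        est₁≤ : ∀ {u v} → u < n → v < n → cen u ≡ 0 → cen v ≡ 0 →
                est₁ u v ∸ 2 ≤ diam × 4 ∸ (4 ∸ est₁ u v) ≤ diam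
        est₁≤ {u} {v} u<n v<n cu cv with conn u v u<n v<n
        ... | k , k≤ , π with approx u<n cu π (subst (_≤ n + 3) (+-suc k 2) (+-monoˡ-≤ 3 (≤-trans k≤ (<⇒≤ diam<n))))
        ...   | l , l≤ , e = ≤-trans (∸-monoˡ-≤ 2 (≤-trans (≤-reflexive (cong (_∸ 1) e)) l≤))
              (≤-trans (≤-reflexive (m+n∸n≡m k 2)) k≤) , small (k ≤? 3)
          where
          small : _ → 4 ∸ (4 ∸ est₁ u v) ≤ diam
          small (no k≰3) = ≤-trans (m∸n≤m 4 (4 ∸ est₁ u v)) (≤-trans (≰⇒> k≰3) k≤)
          small (yes k≤3) with exact u<n cu cv k≤3 π
          ... | l′ , l′≤ , e′ = ≤-trans (m≤n+o⇒m∸n≤o 4 (4 ∸ est₁ u v)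
                (≤-trans (m≤n+m∸n 4 (est₁ u v)) (≤-reflexive (+-comm (est₁ u v) _))))
                                  (≤-trans (≤-reflexive (cong (_∸ 1) e′)) (≤-trans l′≤ k≤))

        est₀≤ : ∀ {p v} → p < n → v < n → est₀ p v ≤ diam
        est₀≤ {p} {v} p<n v<n with isC p ≟ 0
        ... | yes z = ≤-trans (≤-reflexive (cong (_∸ 1) (trans (kept₀ P p v) (blank C p v z)))) z≤n
        ... | no nz with center-dist (≤-antisym (isC≤1 p) (n≢0⇒n>0 nz)) p<n v<n
        ...   | l , e , l≤ , _ = ≤-trans (≤-reflexive (cong (_∸ 1) (trans (kept₀ P p v) e))) l≤

        est₀-walk : ∀ {p v} → isC p ≡ 1 → p < n → v < n → Path A p v (est₀ p v)
        est₀-walk {p} {v} o p<n v<n with center-dist o p<n v<n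
        ... | l , e , _ , π = subst (Path A p v) (sym (cong (_∸ 1) (trans (kept₀ P p v) e))) π

        Covers : ℕ → ℕ → ℕ → Set
        Covers o u v = est₀ u v ≤ o × (cen u ≡ 0 → cen v ≡ 0 → est₁ u v ∸ 2 ≤ o × 4 ∸ (4 ∸ est₁ u v) ≤ o)

        covers-mono : ∀ {o o′ u v} → o ≤ o′ → Covers o u v → Covers o′ u v
        covers-mono h (p , r) = ≤-trans p h , λ cu cv → ≤-trans (proj₁ (r cu cv)) h , ≤-trans (proj₂ (r cu cv)) h

        lower : ∀ {o} → (∀ u v → u < n → v < n → Covers o u v) → ∀ {u v} → u < n → v < n →
                (∀ k → Path A u v k → diam ≤ k) → (4 * diam) / 5 ≤ o
        lower {o} cov {u} {v} u<n v<n far = go (cen u) refl (cen v) refl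
          where
          near : ∀ l → diam ≤ suc l → l ≤ o → (4 * diam) / 5 ≤ o
          -- From D ≤ l + 1 follows 4D < 5(l + 1), so the quotient is at most l.
          near l h l≤ = ≤-trans (≤-pred (m<n*o⇒m/o<n {4 * diam} {suc l} {5}
            (<-≤-trans (≤-<-trans (*-monoʳ-≤ 4 h) (*-monoˡ-< (suc l) {4} {5} ≤-refl))
            (≤-reflexive (*-comm 5 (suc l)))))) l≤
          -- Up to 5 the bound by min(4, D) is enough, and at 5 it is needed in full: the target is
          -- 4 while `D ∸ 2` is 3. From 6 on `D ∸ 2` suffices, with equality of 4·6 + 1 and 5·5 at
          -- the first value.
          far-enough : ∀ D → D ∸ 2 ≤ o → 4 ∸ (4 ∸ D) ≤ o → (4 * D) / 5 ≤ o
          far-enough 0 h₁ h₂ = h₂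
          far-enough 1 h₁ h₂ = ≤-trans z≤n h₂
          far-enough 2 h₁ h₂ = ≤-trans (s≤s z≤n) h₂
          far-enough 3 h₁ h₂ = ≤-trans (s≤s (s≤s z≤n)) h₂
          far-enough 4 h₁ h₂ = ≤-trans (s≤s (s≤s (s≤s z≤n))) h₂
          far-enough 5 h₁ h₂ = h₂
          far-enough (suc (suc (suc (suc (suc (suc D)))))) h₁ _ =
            ≤-trans (≤-pred (m<n*o⇒m/o<n {4 * (6 + D)} {suc (4 + D)} {5}
              (≤-trans (m≤m+n _ D) (≤-reflexive (lem D))))) h₁
            where
            lem : ∀ D → suc (4 * (6 + D)) + D ≡ suc (4 + D) * 5
            lem = solve-∀
          go : ∀ a → cen u ≡ a → ∀ b → cen v ≡ b → (4 * diam) / 5 ≤ o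
          go (suc p) cu _ _ with member u p cu
          ... | i , e = near (est₀ p v) (far _ (path-cons A-sym (trans (A-sym u p) e) (est₀-walk i (member< cu) v<n)))
                          (proj₁ (cov p v (member< cu) v<n))
          go zero cu (suc p) cv with member v p cv
          ... | i , e = near (est₀ p u) (far _ (path-rev A-sym (est₀-walk i (member< cv) u<n) ▸ e))
                          (proj₁ (cov p u (member< cv) u<n))
          go zero cu zero cv with proj₂ (cov u v u<n v<n) cu cv
          ... | h₁ , h₂ = far-enough diam (≤-trans (∸-monoˡ-≤ 2 D≤) h₁) (≤-trans (∸-monoʳ-≤ 4 (∸-monoʳ-≤ 4 D≤)) h₂)
            where
            D≤ : diam ≤ est₁ u v
            D≤ = far _ (est₁-walk u<n v<n cu)

        reportRowR : ∀ {σ Q} u k → u < n → scalar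
          σ 0 ≡ n → scalar σ 10 ≡ u → array σ 3 ≡ cen → array σ 7 ≡ d → scalar σ 2 ≤ diam →
          (∀ τ → scalar τ 2 ≤ diam → scalar σ 2 ≤ scalar τ 2 → (∀ v → v < n → Covers (scalar τ 2) u v) → Q k τ) →
          Run reportRow σ (2 + (n * 8 + k)) Q
        reportRowR {σ} {Q} u k u<n s₀ s₁₀ a₃ a₇ o≤ done =
          forC n 6 L n≤W (λ i k τ _ fr _ → trans (scalarOf fr 0) s₀) (refl , o≤ , ≤-refl , λ _ ()) body
            (λ { k′ τ fr (refl , h₁ , h₂ , h₃) → done (setScalar 11 n τ) h₁ h₂ h₃ })
          where
          L : ℕ → ℕ → State → Set
          L v k′ τ = k′ ≡ k × scalar τ 2 ≤ diam × scalar σ 2 ≤ scalar τ 2 × (∀ x → x < v → Covers (scalar τ 2) u x)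
          max-≤ : ∀ {o e} → o ≤ diam → e ≤ diam → o + (e ∸ o) ≤ diam
          max-≤ {o} {e} h₁ h₂ with ≤-total o e
          ... | inj₁ o≤e = ≤-trans (≤-reflexive (m+[n∸m]≡n o≤e)) h₂
          ... | inj₂ e≤o = ≤-trans (≤-reflexive (trans (cong (o +_) (m≤n⇒m∸n≡0 e≤o)) (+-identityʳ o))) h₁
          body : ∀ v k τ → v < n → Frame reportRow σ τ → L v k τ → Run _ (setScalar 11 v τ) (6 + k) (L (suc v))
          body v k′ τ v<n fr (refl , o≤ , mono , cov) =
            seqR (assignR o₁ (cong (λ z → o + (z ∸ 1 ∸ o)) (d≡ 0)) (λ _ → ≤-trans o₁≤ diam≤W)
            (iteR
              (λ nz → weakR (s≤s (m≤n+m k 3)) (skipR (refl , o₁≤ , ≤-trans mono (m≤m+n o _) ,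
                all (m≤m+n o _) (m≤n+m∸n (est₀ u v) o , λ cu _ → ⊥-elim (nz (trans cu≡ cu))))))
              (λ zu → iteR
                (λ nz → weakR (s≤s (m≤n+m k 2)) (skipR (refl , o₁≤ , ≤-trans mono (m≤m+n o _) ,
                  all (m≤m+n o _) (m≤n+m∸n (est₀ u v) o , λ _ cv → ⊥-elim (nz (trans cv≡ cv))))))
                (λ zv → both (trans (sym cu≡) zu) (trans (sym cv≡) zv)))))
            where
            o = scalar τ 2
            o₁ = o + (est₀ u v ∸ o)
            o₁≤ : o₁ ≤ diam
            o₁≤ = max-≤ o≤ (est₀≤ u<n v<n)
            diam≤W : diam ≤ W
            diam≤W = ≤-trans (<⇒≤ diam<n) n≤W
            d≡ : ∀ g → array τ 7 (pair (pair g (scalar τ 10)) v) ≡ d (pair (pair g u) v)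
            d≡ g = trans (cong (λ f → f _) (trans (arrayOf fr 7) a₇))
              (cong (λ z → d (pair (pair g z) v)) (trans (scalarOf fr 10) s₁₀))
            cu≡ : array τ 3 (scalar τ 10) ≡ cen u
            cu≡ = trans (cong (λ f → f _) (trans (arrayOf fr 3) a₃)) (cong cen (trans (scalarOf fr 10) s₁₀))
            cv≡ : array τ 3 v ≡ cen v
            cv≡ = cong (λ f → f v) (trans (arrayOf fr 3) a₃)
            all : ∀ {o′} → o ≤ o′ → Covers o′ u v → ∀ x → x < suc v → Covers o′ u x
            all h c x x< with x ≟ v
            ... | yes refl = c
            ... | no x≢    = covers-mono h (cov x (≤∧≢⇒< (≤-pred x<) x≢))
            both : cen u ≡ 0 → cen v ≡ 0 → Run _ (setScalar 2 o₁ (setScalar 11 v τ)) (3 + k) (L (suc v))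
            both cu cv = seqR (assignR e (cong (_∸ 1) (d≡ 1))
              (λ B → ≤-trans (m∸n≤m _ 1) (≤-trans (≤-reflexive (sym (d≡ 1))) (array≤ B 7 _)))
              (seqR (assignR o₂ refl (λ _ → ≤-trans o₂≤ diam≤W)
              (assignR o₃ refl (λ _ → ≤-trans o₃≤ diam≤W)
                (refl , o₃≤ , ≤-trans mono o≤o₃ , all o≤o₃
                  (≤-trans (m≤n+m∸n (est₀ u v) o) (≤-trans (m≤m+n o₁ _) (m≤m+n o₂ _)) ,
                  λ _ _ → ≤-trans (m≤n+m∸n (e ∸ 2) o₁) (m≤m+n o₂ _) , m≤n+m∸n (4 ∸ (4 ∸ e)) o₂))))))
              where
              e = est₁ u v
              o₂ = o₁ + (e ∸ 2 ∸ o₁)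
              o₃ = o₂ + (4 ∸ (4 ∸ e) ∸ o₂)
              o₂≤ : o₂ ≤ diam
              o₂≤ = max-≤ o₁≤ (proj₁ (est₁≤ u<n v<n cu cv))
              o₃≤ : o₃ ≤ diam
              o₃≤ = max-≤ o₂≤ (proj₂ (est₁≤ u<n v<n cu cv))
              o≤o₃ : o ≤ o₃
              o≤o₃ = ≤-trans (m≤m+n o _) (≤-trans (m≤m+n o₁ _) (m≤m+n o₂ _))

        reportR : ∀ {σ Q} k → scalar σ 0 ≡ n → array σ 3 ≡ cen → array σ 7 ≡ d → scalar σ 2 ≡ 0 →
          (∀ τ → scalar τ 2 ≤ diam → (∀ u v → u < n → v < n → Covers (scalar τ 2) u v) → Q k τ) →
          Run report σ (2 + (n * (4 + n * 8) + k)) Q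
        reportR {σ} {Q} k s₀ a₃ a₇ s₂ done =
          forC n (2 + n * 8) L n≤W (λ i k τ _ fr _ → trans (scalarOf fr 0) s₀)
            (refl , ≤-trans (≤-reflexive s₂) z≤n , λ _ _ ())
            (λ { u k′ τ u<n fr (refl , o≤ , cov) → reportRowR u k u<n (trans (scalarOf fr 0) s₀) refl
              (trans (arrayOf fr 3) a₃) (trans (arrayOf fr 7) a₇) o≤
              (λ τ′ o≤′ mono c → refl , o≤′ , λ x v x< v< → all mono cov c x v x< v<) })
            (λ { k′ τ fr (refl , h₁ , h₂) → done (setScalar 10 n τ) h₁ h₂ })
          where
          L : ℕ → ℕ → State → Set
          L u k′ τ = k′ ≡ k × scalar τ 2 ≤ diam × (∀ x v → x < u → v < n → Covers (scalar τ 2) x v)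
          all : ∀ {o o′ u} → o ≤ o′ → (∀ x v → x < u → v < n → Covers o x v) → (∀ v → v < n → Covers o′ u v) →
                ∀ x v → x < suc u → v < n → Covers o′ x v
          all {u = u} h old new x v x< v< with x ≟ u
          ... | yes refl = new v v<
          ... | no x≢    = covers-mono h (old x v (≤∧≢⇒< (≤-pred x<) x≢) v<)

-- Graphs

lookup-injective : ∀ {X : Set} {R : X → X → Set} {xs : List X} → (∀ {x} → ¬ R x x) → AllPairs R xs →
  ∀ i j → lookup xs i ≡ lookup xs j → i ≡ j
lookup-injective irr (r ∷ rs) Fin.zero Fin.zero e = refl
lookup-injective {R = R} irr (r ∷ rs) Fin.zero (Fin.suc j) e = ⊥-elim
  (irr (subst (R _) (sym e) (All.lookup r (∈-lookup j))))
lookup-injective {R = R} irr (r ∷ rs) (Fin.suc i) Fin.zero e = ⊥-elim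
  (irr (subst (R _) e (All.lookup r (∈-lookup i))))
lookup-injective irr (r ∷ rs) (Fin.suc i) (Fin.suc j) e = cong Fin.suc (lookup-injective irr rs i j e)

endpoints-∈ : ∀ {n} (es : List (Fin n × Fin n)) i → i < length es →
  Σ[ u ∈ Fin n ] Σ[ v ∈ Fin n ] (u , v) ∈ es × endpoints es i ≡ (toℕ u , toℕ v)
endpoints-∈ ((u , v) ∷ es) zero    _ = u , v , here refl , refl
endpoints-∈ (_ ∷ es)       (suc i) (s≤s i<) with endpoints-∈ es i i<
... | u , v , m , e = u , v , there m , e

∈-endpoints : ∀ {n} {es : List (Fin n × Fin n)} {u v} → (u , v) ∈ es →
  Σ[ i ∈ ℕ ] i < length es × endpoints es i ≡ (toℕ u , toℕ v)
∈-endpoints (here refl) = 0 , s≤s z≤n , refl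
∈-endpoints {es = e ∷ es} (there m) with ∈-endpoints m
... | i , i< , p = suc i , s≤s i< , p

endpoints≤ : ∀ {n} (es : List (Fin n × Fin n)) i → proj₁ (endpoints es i) ≤ n × proj₂ (endpoints es i) ≤ n
endpoints≤ []             i       = z≤n , z≤n
endpoints≤ ((u , v) ∷ es) zero    = <⇒≤ (toℕ<n u) , <⇒≤ (toℕ<n v)
endpoints≤ (_ ∷ es)       (suc i) = endpoints≤ es i

module GraphFacts {n : ℕ} (G : Graph n) where

  edgeCount≤ : edgeCount G ≤ n * n
  edgeCount≤ = injective⇒≤ {f = λ i → combine (proj₁ (edge i)) (proj₂ (edge i))} λ {i} {j} e →
    lookup-injective (λ h → proj₁ h refl) (distinct G) i j
      (let p , r = combine-injective (proj₁ (edge i)) (proj₂ (edge i)) (proj₁ (edge j)) (proj₂ (edge j)) e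
       in cong₂ _,_ p r)
    where edge = lookup (edges G)

  Near : ℕ → ℕ → Set
  Near v x = Σ[ u ∈ Fin n ] Σ[ w ∈ Fin n ] toℕ u ≡ v × toℕ w ≡ x × Adj G u w

  near-sym : ∀ {v x} → Near v x → Near x v
  near-sym (u , w , p , r , inj₁ m) = w , u , r , p , inj₂ m
  near-sym (u , w , p , r , inj₂ m) = w , u , r , p , inj₁ m

  end₀ end₁ : ℕ → ℕ
  end₀ i = proj₁ (endpoints (edges G) i)
  end₁ i = proj₂ (endpoints (edges G) i)

  near-edge : ∀ i → i < edgeCount G → Near (end₀ i) (end₁ i)
  near-edge i i< with endpoints-∈ (edges G) i i<
  ... | u , v , m , e = u , v , sym (cong proj₁ e) , sym (cong proj₂ e) , inj₁ m

  walk-snoc : ∀ {u v w k} → Walk G u v k → Adj G v w → Walk G u w (suc k)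
  walk-snoc []       a = a ∷ []
  walk-snoc (b ∷ ws) a = b ∷ walk-snoc ws a

  walk-++ : ∀ {u v w k l} → Walk G u v k → Walk G v w l → Walk G u w (k + l)
  walk-++ []       ys = ys
  walk-++ (a ∷ xs) ys = a ∷ walk-++ xs ys

  walk-split : ∀ {u v k} i → i ≤ k → Walk G u v k → Σ[ x ∈ Fin n ] Walk G u x i × Walk G x v (k ∸ i)
  walk-split zero    _        w       = _ , [] , w
  walk-split (suc i) (s≤s i≤) (a ∷ w) with walk-split i i≤ w
  ... | x , w₁ , w₂ = x , a ∷ w₁ , w₂

  -- A shortest walk of length D passes D + 1 different vertices: between two visits of the same
  -- vertex it could be cut short.
  diameter< : ∀ {D} → IsDiameter G D → D < n
  diameter< {D} (_ , u , v , w , least) = injective⇒≤ {f = λ i → proj₁ (cut i)} λ {i} {j} e →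
    toℕ-injective (≤-antisym (order j i (sym e)) (order i j e))
    where
    cut : ∀ (i : Fin (suc D)) → Σ[ x ∈ Fin n ] Walk G u x (toℕ i) × Walk G x v (D ∸ toℕ i)
    cut i = walk-split (toℕ i) (≤-pred (toℕ<n i)) w
    order : ∀ i j → proj₁ (cut i) ≡ proj₁ (cut j) → toℕ j ≤ toℕ i
    order i j e = +-cancelʳ-≤ (D ∸ toℕ j) (toℕ j) (toℕ i)
      (≤-trans (≤-reflexive (m+[n∸m]≡n (≤-pred (toℕ<n j))))
        (least _ (walk-++ (subst (λ x → Walk G u x (toℕ i)) e (proj₁ (proj₂ (cut i)))) (proj₂ (proj₂ (cut j))))))

  module Paths (A : ℕ → ℕ → ℕ) (A-sym : ∀ v x → A v x ≡ A x v)
    (A⇒near : ∀ v x → A v x ≡ 1 → Near v x) (near⇒A : ∀ {u w} → Adj G u w → A (toℕ u) (toℕ w) ≡ 1) where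

    walk⇒path : ∀ {u v k} → Walk G u v k → Path A (toℕ u) (toℕ v) k
    walk⇒path []      = []
    walk⇒path (a ∷ w) = path-cons A-sym (near⇒A a) (walk⇒path w)

    path⇒walk : ∀ {u x k} → Path A (toℕ u) x k → Σ[ v ∈ Fin n ] toℕ v ≡ x × Walk G u v k
    path⇒walk []      = _ , refl , []
    path⇒walk (_▸_ {v} {x} π e) with path⇒walk π | A⇒near v x e
    ... | v′ , refl , w | u₁ , w₁ , p , r , a = w₁ , r , walk-snoc w (subst (λ z → Adj G z w₁) (toℕ-injective p) a)

    module _ {D : ℕ} (diam : IsDiameter G D) where

      connected : ∀ u v → u < n → v < n → Σ[ k ∈ ℕ ] k ≤ D × Path A u v k
      connected u v u<n v<n with proj₁ diam (fromℕ< u<n) (fromℕ< v<n)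
      ... | k , (w , _) , k≤ = k , k≤ , subst₂ (λ x y → Path A x y k) (toℕ-fromℕ< u<n) (toℕ-fromℕ< v<n) (walk⇒path w)

      furthest : Σ[ u ∈ ℕ ] Σ[ v ∈ ℕ ] u < n × v < n × (∀ k → Path A u v k → D ≤ k)
      furthest with proj₂ diam
      ... | u , v , _ , least = toℕ u , toℕ v , toℕ<n u , toℕ<n v , λ k π → far k (path⇒walk π)
        where
        far : ∀ k → (Σ[ v′ ∈ Fin n ] toℕ v′ ≡ toℕ v × Walk G u v′ k) → D ≤ k
        far k (v′ , e , w) = least k (subst (λ z → Walk G u z k) (toℕ-injective e) w)

      -- Serves the inequality `n ≤ m + m`, through which terms such as n² are absorbed by m^(2/3)
      -- n^(4/3).
      neighbour : 2 ≤ n → ∀ v → v < n → Σ[ x ∈ ℕ ] A v x ≡ 1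
      neighbour 2≤n v v<n = first _ (proj₂ (proj₂ (connected v w v<n (proj₁ (proj₂ other))))) (proj₂ (proj₂ other))
        where
        differs : ∀ v → Σ[ w ∈ ℕ ] w < n × v ≢ w
        differs zero    = 1 , 2≤n , λ ()
        differs (suc _) = 0 , <-trans (s≤s z≤n) 2≤n , λ ()
        other = differs v
        w = proj₁ other
        first : ∀ {x} k → Path A v x k → v ≢ x → Σ[ y ∈ ℕ ] A v y ≡ 1
        first _ [] ne = ⊥-elim (ne refl)
        first _ (_▸_ {y} {x} π e) ne with v ≟ y
        ... | yes refl = x , e
        ... | no v≢    = first _ π v≢

-- Arithmetic of the time bound

cube-mono : ∀ {a b} → a ≤ b → a ^ 3 ≤ b ^ 3
cube-mono h = ^-monoˡ-≤ 3 h

-- If r is positive then s ≤ 2r, hence s³n ≤ 8r³n < 8m by minimality of s. If r is zero then s is 1.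
-- In both cases n ≤ 2m supplies the missing factor m.
dense-cube : ∀ n m s r → s ≡ suc r → 1 ≤ n → n ≤ m + m → (r ≡ 0 ⊎ r * r * r * n < m) →
             (n * n * s) ^ 3 ≤ 16 * (m ^ 2 * n ^ 4)
dense-cube n m s r refl 1≤n n≤ (inj₁ refl) = begin
  (n * n * 1) ^ 3               ≡⟨ e₁ n ⟩
  n ^ 4 * (n * n)               ≤⟨ *-monoʳ-≤ (n ^ 4) (*-mono-≤ n≤ n≤) ⟩
  n ^ 4 * ((m + m) * (m + m))   ≡⟨ e₂ m (n ^ 4) ⟩
  4 * (m ^ 2 * n ^ 4)           ≤⟨ *-monoˡ-≤ (m ^ 2 * n ^ 4) (m≤m+n 4 12) ⟩
  16 * (m ^ 2 * n ^ 4)          ∎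
  where
  open ≤-Reasoning
  e₁ : ∀ n → ((n * n * 1) * ((n * n * 1) * ((n * n * 1) * 1))) ≡ (n * (n * (n * (n * 1)))) * (n * n)
  e₁ = solve-∀
  e₂ : ∀ m x → x * ((m + m) * (m + m)) ≡ 4 * ((m * (m * 1)) * x)
  e₂ = solve-∀
dense-cube n m s zero refl 1≤n n≤ (inj₂ h) = dense-cube n m s zero refl 1≤n n≤ (inj₁ refl)
dense-cube n m s (suc r) refl 1≤n n≤ (inj₂ h) = begin
  (n * n * suc (suc r)) ^ 3                ≤⟨ cube-mono (*-monoʳ-≤ (n * n) (s≤s (s≤s (m≤m+n r r)))) ⟩
  (n * n * suc (suc (r + r))) ^ 3          ≡⟨ e₁ n r ⟩
  8 * n ^ 5 * (suc r * suc r * suc r * n)  ≤⟨ *-monoʳ-≤ (8 * n ^ 5) (<⇒≤ h) ⟩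
  8 * n ^ 5 * m                            ≡⟨ e₂ n m ⟩
  8 * (m * n ^ 4) * n                      ≤⟨ *-monoʳ-≤ (8 * (m * n ^ 4)) n≤ ⟩
  8 * (m * n ^ 4) * (m + m)                ≡⟨ e₃ m (n ^ 4) ⟩
  16 * (m ^ 2 * n ^ 4)                     ∎
  where
  open ≤-Reasoning
  e₁ : ∀ n r → ((n * n * suc (suc (r + r))) * ((n * n * suc (suc (r + r))) * ((n * n * suc (suc (r + r))) * 1)))
    ≡ 8 * (n * (n * (n * (n * (n * 1))))) * (suc r * suc r * suc r * n)
  e₁ = solve-∀
  e₂ : ∀ n m → 8 * (n * (n * (n * (n * (n * 1))))) * m ≡ 8 * (m * (n * (n * (n * (n * 1))))) * n
  e₂ = solve-∀
  e₃ : ∀ m x → 8 * (m * x) * (m + m) ≡ 16 * ((m * (m * 1)) * x)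
  e₃ = solve-∀

-- One of the three factors m is traded for s³n; its s³ then combines with h³ to the cube of
-- `h * s`, which is at most n³.
center-cube : ∀ n m s h → h * s ≤ n → m ≤ s * s * s * n → (h * m) ^ 3 ≤ 16 * (m ^ 2 * n ^ 4)
center-cube n m s h hs≤ m≤ = begin
  (h * m) ^ 3                                ≡⟨ e₁ h m ⟩
  m ^ 2 * (h * h * h) * m                    ≤⟨ *-monoʳ-≤ (m ^ 2 * (h * h * h)) m≤ ⟩
  m ^ 2 * (h * h * h) * (s * s * s * n)      ≡⟨ e₂ (m ^ 2) h s n ⟩
  m ^ 2 * (h * s) ^ 3 * n                    ≤⟨ *-monoˡ-≤ n (*-monoʳ-≤ (m ^ 2) (cube-mono hs≤)) ⟩
  m ^ 2 * n ^ 3 * n                          ≡⟨ e₃ (m ^ 2) n ⟩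
  1 * (m ^ 2 * n ^ 4)                        ≤⟨ *-monoˡ-≤ (m ^ 2 * n ^ 4) (m≤m+n 1 15) ⟩
  16 * (m ^ 2 * n ^ 4)                       ∎
  where
  open ≤-Reasoning
  e₁ : ∀ h m → ((h * m) * ((h * m) * ((h * m) * 1))) ≡ (m * (m * 1)) * (h * h * h) * m
  e₁ = solve-∀
  e₂ : ∀ x h s n → x * (h * h * h) * (s * s * s * n) ≡ x * ((h * s) * ((h * s) * ((h * s) * 1))) * n
  e₂ = solve-∀
  e₃ : ∀ x n → x * (n * (n * (n * 1))) * n ≡ 1 * (x * (n * (n * (n * (n * 1)))))
  e₃ = solve-∀

-- Doubling costs a factor 8, which gives 8·16 = 128; 6³ is the first cube above it, and only a cube
-- can later be merged into the constant of the time bound.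
double-cube : ∀ {B} Z → Z ^ 3 ≤ 16 * B → (Z + Z) ^ 3 ≤ 6 ^ 3 * B
double-cube {B} Z h = begin
  (Z + Z) ^ 3     ≡⟨ e₁ Z ⟩
  8 * Z ^ 3       ≤⟨ *-monoʳ-≤ 8 h ⟩
  8 * (16 * B)    ≡⟨ sym (*-assoc 8 16 B) ⟩
  128 * B         ≤⟨ *-monoˡ-≤ B (m≤m+n 128 88) ⟩
  6 ^ 3 * B       ∎
  where
  open ≤-Reasoning
  e₁ : ∀ Z → ((Z + Z) * ((Z + Z) * ((Z + Z) * 1))) ≡ 8 * (Z * (Z * (Z * 1)))
  e₁ = solve-∀

sum-cube : ∀ {X Y B} → X ^ 3 ≤ 16 * B → Y ^ 3 ≤ 16 * B → (X + Y) ^ 3 ≤ 6 ^ 3 * B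
sum-cube {X} {Y} {B} hX hY with ≤-total X Y
... | inj₁ X≤Y = ≤-trans (cube-mono (+-monoˡ-≤ Y X≤Y)) (double-cube {B} Y hY)
... | inj₂ Y≤X = ≤-trans (cube-mono (+-monoʳ-≤ X Y≤X)) (double-cube {B} X hX)

product-cube : ∀ a b {X B t} → t ≤ a * X → X ^ 3 ≤ b ^ 3 * B → t ^ 3 ≤ (a * b) ^ 3 * B
product-cube a b {X} {B} {t} h hX = begin
  t ^ 3             ≤⟨ cube-mono h ⟩
  (a * X) ^ 3       ≡⟨ e₁ a X ⟩
  a ^ 3 * X ^ 3     ≤⟨ *-monoʳ-≤ (a ^ 3) hX ⟩
  a ^ 3 * (b ^ 3 * B) ≡⟨ e₂ a b B ⟩
  (a * b) ^ 3 * B   ∎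
  where
  open ≤-Reasoning
  e₁ : ∀ a X → ((a * X) * ((a * X) * ((a * X) * 1))) ≡ (a * (a * (a * 1))) * (X * (X * (X * 1)))
  e₁ = solve-∀
  e₂ : ∀ a b B → (a * (a * (a * 1))) * ((b * (b * (b * 1))) * B) ≡ ((a * b) * ((a * b) * ((a * b) * 1))) * B
  e₂ = solve-∀

-- The constant is 15 + 59 + 48 + 10 + 52, the coefficients of the terms absorbed by n²s; the
-- coefficient 61 of `h * m` is rounded up to it. Inside the part for the centers, n ≤ 2m makes a
-- single search linear in m.
cost-bound : ∀ n m s h σ₀ σ₁ → 1 ≤ n → 1 ≤ s → 1 ≤ m → m ≤ n * n → n ≤ m + m →
  σ₀ ≤ m + m → σ₁ ≤ n * s + n * s →
  3 + (n * 4 + (2 + (m * 4 + (2 + (n * (9 + n * 9) + (2 + (n * (4 + n * 9) + 0)))))))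
  + (2 + (n * 4 + h * (27 + n * 4 + σ₀ * 13))
    + (2 + (n * (34 + n * 18 + σ₁ * 13) + σ₁ * (5 + n * 13)) + (2 + (n * (4 + n * 8) + 0))))
  ≤ 184 * (n * n * s + h * m)
cost-bound n m s h σ₀ σ₁ 1≤n 1≤s 1≤m m≤ n≤ σ₀≤ σ₁≤ = begin
  3 + (n * 4 + (2 + (m * 4 + (2 + (n * (9 + n * 9) + (2 + (n * (4 + n * 9) + 0)))))))
  + (2 + (n * 4 + h * (27 + n * 4 + σ₀ * 13))
    + (2 + (n * (34 + n * 18 + σ₁ * 13) + σ₁ * (5 + n * 13)) + (2 + (n * (4 + n * 8) + 0))))
    ≡⟨ e₁ n m h σ₀ σ₁ ⟩
  15 + 59 * n + 44 * (n * n) + 4 * m + (26 * n + 5) * σ₁ + h * (27 + n * 4 + σ₀ * 13)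
    ≤⟨ +-mono-≤ (+-mono-≤ (+-monoʳ-≤ (15 + 59 * n + 44 * (n * n)) (*-monoʳ-≤ 4 m≤)) (*-monoʳ-≤ (26 * n + 5) σ₁≤))
         (*-monoʳ-≤ h (+-mono-≤ (+-mono-≤ (*-monoʳ-≤ 27 1≤m) (*-monoˡ-≤ 4 n≤)) (*-monoˡ-≤ 13 σ₀≤))) ⟩
  15 + 59 * n + 44 * (n * n) + 4 * (n * n) + (26 * n + 5) * (n * s + n * s) + h *
    (27 * m + (m + m) * 4 + (m + m) * 13)
    ≡⟨ e₂ n m s h ⟩
  15 * 1 + 59 * n + 48 * (n * n) + 10 * (n * s) + 52 * X + 61 * (h * m)
    ≤⟨ +-mono-≤ (+-monoˡ-≤ (52 * X) (+-mono-≤ (+-mono-≤ (+-mono-≤ (*-monoʳ-≤ 15 1≤X) (*-monoʳ-≤ 59 n≤X))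
      (*-monoʳ-≤ 48 nn≤X)) (*-monoʳ-≤ 10 ns≤X)))
         (*-monoˡ-≤ (h * m) (m≤m+n 61 123)) ⟩
  15 * X + 59 * X + 48 * X + 10 * X + 52 * X + 184 * (h * m)
    ≡⟨ e₃ X (h * m) ⟩
  184 * (X + h * m) ∎
  where
  open ≤-Reasoning
  X = n * n * s
  grow : ∀ {a b} → 1 ≤ b → a ≤ a * b
  grow {a} {b} 1≤b = ≤-trans (≤-reflexive (sym (*-identityʳ a))) (*-monoʳ-≤ a 1≤b)
  nn≤X : n * n ≤ X
  nn≤X = grow 1≤s
  n≤X : n ≤ X
  n≤X = ≤-trans (grow 1≤n) nn≤X
  1≤X : 1 ≤ X
  1≤X = ≤-trans 1≤n n≤X
  ns≤X : n * s ≤ X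
  ns≤X = *-monoˡ-≤ s (grow {n} 1≤n)
  e₁ : ∀ n m h σ₀ σ₁ →
    3 + (n * 4 + (2 + (m * 4 + (2 + (n * (9 + n * 9) + (2 + (n * (4 + n * 9) + 0)))))))
    + (2 + (n * 4 + h * (27 + n * 4 + σ₀ * 13))
      + (2 + (n * (34 + n * 18 + σ₁ * 13) + σ₁ * (5 + n * 13)) + (2 + (n * (4 + n * 8) + 0))))
    ≡ 15 + 59 * n + 44 * (n * n) + 4 * m + (26 * n + 5) * σ₁ + h * (27 + n * 4 + σ₀ * 13)
  e₁ = solve-∀
  e₂ : ∀ n m s h →
    15 + 59 * n + 44 * (n * n) + 4 * (n * n) + (26 * n + 5) * (n * s + n * s) + h *
      (27 * m + (m + m) * 4 + (m + m) * 13)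
    ≡ 15 * 1 + 59 * n + 48 * (n * n) + 10 * (n * s) + 52 * (n * n * s) + 61 * (h * m)
  e₂ = solve-∀
  e₃ : ∀ x y → 15 * x + 59 * x + 48 * x + 10 * x + 52 * x + 184 * y ≡ 184 * (x + y)
  e₃ = solve-∀

-- The complete algorithm on a given graph

prepare solve algorithm : Program
prepare   = threshold ⨾ matrix ⨾ clusters ⨾ lists
solve     = centers ⨾ sparseSearch ⨾ report
algorithm = prepare ⨾ solve

matrix-01 : ∀ {n R t a} → Matrix n R t a → ∀ v x → a (pair v x) ≡ 0 ⊎ a (pair v x) ≡ 1
matrix-01 M v x with entry M v x
... | inj₁ z       = inj₁ z
... | inj₂ (o , _) = inj₂ o

module Main {n : ℕ} (G : Graph n) {D : ℕ} (diam : IsDiameter G D)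
  (q : ℕ) (1≤q : 1 ≤ q) (unit : ℕ) (unit≥ : 1024 * suc q ≤ unit) (W≥ : 4 + (n + (n * n + n * n)) ≤ 2 ^ q) where

  open Logic q 1≤q unit unit≥
  open Phases q 1≤q unit unit≥ using (thresholdR; matrixR; clustersR)
  open GraphFacts G

  m : ℕ
  m = edgeCount G

  D<n : D < n
  D<n = diameter< diam

  1≤n : 1 ≤ n
  1≤n = ≤-trans (s≤s z≤n) D<n

  n<W : suc n ≤ W
  n<W = ≤-trans (+-mono-≤ {1} {4} (s≤s z≤n) (m≤m+n n _)) W≥

  m≤W : m ≤ W
  m≤W = ≤-trans edgeCount≤ (≤-trans (≤-trans (m≤m+n (n * n) (n * n)) (≤-trans (m≤n+m _ n) (m≤n+m _ 4))) W≥)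

  -- The searches are analysed for fixed matrix, clustering and lists. These exist only once the
  -- first half has run, so they are packed here and unpacked as module parameters of the second
  -- half.
  record Prepared (τ : State) : Set where
    field
      {s}        : ℕ
      {a cen isC} : ℕ → ℕ
      bound      : Threshold n m s
      adjacency  : Matrix n Near (m + m) a
      every-edge : ∀ i → i < m → a (pair (end₀ i) (end₁ i)) ≡ 1 × a (pair (end₁ i) (end₀ i)) ≡ 1
      clustering : Clustering n s (λ v x → a (pair v x)) n cen isC
      rows₀      : Lists.Rows n (λ v x → a (pair v x)) (matrix-01 adjacency) cen 0 n 0 (array τ 5) (array τ 6)
      rows₁      : Lists.Rows n (λ v x → a (pair v x)) (matrix-01 adjacency) cen 1 n 0 (array τ 5) (array τ 6)
      size       : scalar τ 0 ≡ n
      result     : scalar τ 2 ≡ 0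
      members    : array τ 3 ≡ cen
      heads      : array τ 4 ≡ isC
      labels₀    : ∀ i → array τ 7 i ≡ 0
      counts₀    : ∀ i → array τ 8 i ≡ 0

  prepareCost : ℕ
  prepareCost = 3 + (n * 4 + (2 + (m * 4 + (2 + (n * (9 + n * 9) + (2 + (n * (4 + n * 9) + 0)))))))

  prepareR : Run prepare (input G) prepareCost (λ _ → Prepared)
  prepareR =
    seqR (thresholdR n m _ refl refl 1≤n edgeCount≤ n<W λ τ₁ f₁ thr →
    seqR (matrixR n m _ Near end₀ end₁ (scalarOf f₁ 1) (arrayOf f₁ 0) (arrayOf f₁ 1)
      (λ i → cong (λ f → f i) (arrayOf f₁ 2))
           near-edge near-sym m≤W (≤-trans (s≤s z≤n) n<W) λ τ₂ f₂ M every →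
    seqR (clustersR n (scalar τ₁ 3) (array τ₂ 2) (matrix-01 M) n<W _
           (trans (scalarOf f₂ 0) (scalarOf f₁ 0)) (scalarOf f₂ 3) refl
           (λ i → cong (λ f → f i) (trans (arrayOf f₂ 3) (arrayOf f₁ 3)))
           (λ i → cong (λ f → f i) (trans (arrayOf f₂ 4) (arrayOf f₁ 4))) λ τ₃ f₃ C →
    ListsRun.listsR q 1≤q unit unit≥ n (array τ₂ 2) (matrix-01 M) (array τ₃ 3) n<W _
           (trans (scalarOf f₃ 0) (trans (scalarOf f₂ 0) (scalarOf f₁ 0))) (arrayOf f₃ 2) refl
           (λ i → cong (λ f → f i) (trans (arrayOf f₃ 5) (trans (arrayOf f₂ 5) (arrayOf f₁ 5)))) λ τ₄ f₄ R →
    record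
      { bound = thr ; adjacency = M ; every-edge = every ; clustering = C ; rows₀ = proj₁ R ; rows₁ = proj₂ R
      ; size = trans (scalarOf f₄ 0) (trans (scalarOf f₃ 0) (trans (scalarOf f₂ 0) (scalarOf f₁ 0)))
      ; result = trans (scalarOf f₄ 2) (trans (scalarOf f₃ 2) (trans (scalarOf f₂ 2) (scalarOf f₁ 2)))
      ; members = arrayOf f₄ 3 ; heads = arrayOf f₄ 4
      ; labels₀ = λ i → cong (λ f → f i) (trans (arrayOf f₄ 7)
        (trans (arrayOf f₃ 7) (trans (arrayOf f₂ 7) (arrayOf f₁ 7))))
      ; counts₀ = λ i → cong (λ f → f i) (trans (arrayOf f₄ 8)
        (trans (arrayOf f₃ 8) (trans (arrayOf f₂ 8) (arrayOf f₁ 8)))) })))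

  module Solve {τ : State} (P : Prepared τ) where
    open Prepared P

    A : ℕ → ℕ → ℕ
    A v x = a (pair v x)

    A01 : ∀ v x → A v x ≡ 0 ⊎ A v x ≡ 1
    A01 = matrix-01 adjacency

    A⇒near : ∀ v x → A v x ≡ 1 → Near v x
    A⇒near v x e with entry adjacency v x
    ... | inj₁ z       = ⊥-elim (1+n≢0 (trans (sym e) z))
    ... | inj₂ (_ , r) = r

    near⇒A : ∀ {u w} → Adj G u w → A (toℕ u) (toℕ w) ≡ 1
    near⇒A (inj₁ e) with ∈-endpoints e
    ... | i , i< , p = subst₂ (λ x y → A x y ≡ 1) (cong proj₁ p) (cong proj₂ p) (proj₁ (every-edge i i<))
    near⇒A (inj₂ e) with ∈-endpoints e
    ... | i , i< , p = subst₂ (λ x y → A x y ≡ 1) (cong proj₂ p) (cong proj₁ p) (proj₂ (every-edge i i<))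

    A-swap : ∀ v x → A v x ≡ 1 → A x v ≡ 1
    A-swap v x e with near-sym (A⇒near v x e)
    ... | _ , _ , refl , refl , r = near⇒A r

    A-sym : ∀ v x → A v x ≡ A x v
    A-sym v x with A01 v x | A01 x v
    ... | inj₂ o | _      = trans o (sym (A-swap v x o))
    ... | inj₁ z | inj₁ y = trans z (sym y)
    ... | inj₁ z | inj₂ o = ⊥-elim (1+n≢0 (trans (sym (A-swap x v o)) z))

    A< : ∀ v x → A v x ≡ 1 → v < n × x < n
    A< v x e with A⇒near v x e
    ... | u , w , refl , refl , _ = toℕ<n u , toℕ<n w

    open Paths A A-sym A⇒near near⇒A
    open Lists n A A01 cen using (rows-sum; sparse-sum)

    dg ad : ℕ → ℕ
    dg = array τ 5
    ad = array τ 6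

    open Tasks q 1≤q unit unit≥ n a A01 cen isC dg ad
      renaming (Σdeg to Σdeg′; centersR to centersR′; centerCost to centerCost′; module Sparse to Sparse′)
      using ()

    Σdeg : ℕ → ℕ
    Σdeg = Σdeg′ A< A-sym rows₀ rows₁ (member clustering) (isC≤1 clustering) D D<n (connected diam) W≥

    centerCost : ℕ
    centerCost = centerCost′ A< A-sym rows₀ rows₁ (member clustering) (isC≤1 clustering) D D<n (connected diam) W≥

    sparseCost : ℕ → ℕ
    sparseCost u = 13 + n * 7 + dg (pair 1 u) * (5 + n * 6)
        + ((n + 3) * 4 + ((1 + (n + dg (pair 1 u) * n) + Σdeg 1) * 7 + Σdeg 1 * 6))

    solveCost : ℕ
    solveCost = 2 + S (λ h → 2 + (2 + isC h * centerCost)) n +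
      (2 + S (λ u → 2 + sparseCost u) n + (2 + (n * (4 + n * 8) + 0)))

    solveR : Run solve τ solveCost (λ _ τ′ → (4 * D) / 5 ≤ output τ′ × output τ′ ≤ D)
    solveR =
      seqR (centersR′ A< A-sym rows₀ rows₁ (member clustering) (isC≤1 clustering) D D<n (connected diam) W≥ _
             size heads refl refl labels₀ counts₀ λ τ₁ f₁ C →
      let module Sp = Sparse′ A< A-sym rows₀ rows₁ (member clustering) (isC≤1 clustering) D D<n (connected diam) W≥ (array τ₁ 7) (array τ₁ 8) C in
      seqR (Sp.sparseSearchR _ (trans (scalarOf f₁ 0) size) (trans (arrayOf f₁ 3) members) (arrayOf f₁ 5)
        (arrayOf f₁ 6) refl refl λ τ₂ f₂ P₂ →
      let module Est = Sp.Estimate P₂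
          (u , v , u<n , v<n , far) = furthest diam in
      Est.reportR _ (trans (scalarOf f₂ 0) (trans (scalarOf f₁ 0) size))
        (trans (arrayOf f₂ 3) (trans (arrayOf f₁ 3) members)) refl
        (trans (scalarOf f₂ 2) (trans (scalarOf f₁ 2) result))
        λ τ₃ out≤ cov → Est.lower cov u<n v<n far , out≤))

    heads≤ : S isC n * s ≤ n
    heads≤ = ≤-trans (few clustering) (≤-trans (S-≤-const 1 n (λ x _ → isPos≤1 (cen x)))
      (≤-reflexive (*-identityʳ n)))
      where
      isPos≤1 : ∀ c → isPos c ≤ 1
      isPos≤1 zero    = z≤n
      isPos≤1 (suc _) = ≤-refl

    Σdeg₀≤ : Σdeg 0 ≤ m + m
    Σdeg₀≤ = ≤-trans (≤-reflexive (rows-sum rows₀)) (total adjacency)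

    Σdeg₁≤ : Σdeg 1 ≤ n * s + n * s
    Σdeg₁≤ = ≤-trans (≤-reflexive (rows-sum rows₁)) (sparse-sum s A-sym (sparse clustering))

    n≤2m : 2 ≤ n → n ≤ m + m
    n≤2m 2≤n = begin
      n                                   ≡⟨ sym (*-identityʳ n) ⟩
      n * 1                               ≡⟨ sym (S-const 1 n) ⟩
      S (λ _ → 1) n                       ≤⟨ S-mono n row≥1 ⟩
      S² n a                              ≤⟨ total adjacency ⟩
      m + m                               ∎
      where
      open ≤-Reasoning
      row≥1 : ∀ v → v < n → 1 ≤ S (λ x → A v x) n
      row≥1 v v<n with neighbour diam 2≤n v v<n
      ... | x , e = ≤-trans (≤-reflexive (sym e)) (S-term (A v) (proj₂ (A< v x e)))

    solveCost≡ : solveCost ≡ 2 + (n * 4 + S isC n * (27 + n * 4 + Σdeg 0 * 13))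
      + (2 + (n * (34 + n * 18 + Σdeg 1 * 13) + Σdeg 1 * (5 + n * 13)) + (2 + (n * (4 + n * 8) + 0)))
    solveCost≡ = cong₂ (λ x y → 2 + x + (2 + y + (2 + (n * (4 + n * 8) + 0)))) fromCenters fromOthers
      where
      e₁ : ∀ n σ → 8 + ((n + 3) * 4 + ((1 + σ) * 7 + σ * 6)) ≡ 27 + n * 4 + σ * 13
      e₁ = solve-∀
      fromCenters : S (λ h → 2 + (2 + isC h * centerCost)) n ≡ n * 4 + S isC n * (27 + n * 4 + Σdeg 0 * 13)
      fromCenters = trans (S-+ (λ _ → 4) (λ h → isC h * centerCost) n)
        (cong₂ _+_ (S-const 4 n) (trans (S-*ʳ isC centerCost n) (cong (S isC n *_) (e₁ n (Σdeg 0)))))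
      e₂ : ∀ n e σ → 2 + (13 + n * 7 + e * (5 + n * 6) + ((n + 3) * 4 + ((1 + (n + e * n) + σ) * 7 + σ * 6)))
           ≡ 34 + n * 18 + σ * 13 + e * (5 + n * 13)
      e₂ = solve-∀
      fromOthers : S (λ u → 2 + sparseCost u) n ≡ n * (34 + n * 18 + Σdeg 1 * 13) + Σdeg 1 * (5 + n * 13)
      fromOthers = trans (S-cong n (λ u _ → e₂ n (dg (pair 1 u)) (Σdeg 1)))
        (trans (S-+ (λ _ → 34 + n * 18 + Σdeg 1 * 13) (λ u → dg (pair 1 u) * (5 + n * 13)) n)
          (cong₂ _+_ (S-const (34 + n * 18 + Σdeg 1 * 13) n) (S-*ʳ (λ u → dg (pair 1 u)) (5 + n * 13) n)))

    time≤ : 2 ≤ n → ∀ {t} → t ≤ (prepareCost + solveCost) * unit → t ^ 3 ≤ (184 * unit * 6) ^ 3 * (m ^ 2 * n ^ 4)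
    time≤ 2≤n {t} t≤ with bound
    ... | r , s≡ , m≤s³n , minimal = product-cube (184 * unit) 6
      (≤-trans t≤ (≤-trans (*-monoˡ-≤ unit cost≤′) (≤-reflexive (e₁ unit (n * n * s + S isC n * m)))))
      (sum-cube {n * n * s} {S isC n * m} {m ^ 2 * n ^ 4} (dense-cube n m s r s≡ 1≤n (n≤2m 2≤n) minimal)
        (center-cube n m s (S isC n) heads≤ m≤s³n))
      where
      e₁ : ∀ u x → 184 * x * u ≡ 184 * u * x
      e₁ = solve-∀
      1≤m : ∀ m → n ≤ m + m → 1 ≤ m
      1≤m zero    h = ⊥-elim (<⇒≱ 1≤n h)
      1≤m (suc _) h = s≤s z≤n
      cost≤′ : prepareCost + solveCost ≤ 184 * (n * n * s + S isC n * m)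
      cost≤′ = ≤-trans (≤-reflexive (cong (prepareCost +_) solveCost≡))
        (cost-bound n m s (S isC n) (Σdeg 0) (Σdeg 1) 1≤n (subst (1 ≤_) (sym s≡) (s≤s z≤n)) (1≤m m (n≤2m 2≤n))
          edgeCount≤ (n≤2m 2≤n) Σdeg₀≤ Σdeg₁≤)

  input-bounded : Bounded (input G)
  input-bounded = bounded scalars arrays
    where
    scalars : ∀ x → scalar (input G) x ≤ W
    scalars 0 = ≤-trans (n≤1+n n) n<W
    scalars 1 = m≤W
    scalars (suc (suc _)) = z≤n
    arrays : ∀ a i → array (input G) a i ≤ W
    arrays 0 i = ≤-trans (proj₁ (endpoints≤ (edges G) i)) (≤-trans (n≤1+n n) n<W)
    arrays 1 i = ≤-trans (proj₂ (endpoints≤ (edges G) i)) (≤-trans (n≤1+n n) n<W)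
    arrays (suc (suc _)) i = z≤n

  Correct : Set
  Correct = Σ[ t ∈ ℕ ] Σ[ σ ∈ State ] (algorithm ▷ input G ⇓[ t ] σ)
    × (2 ≤ n → t ^ 3 ≤ (184 * unit * 6) ^ 3 * (m ^ 2 * n ^ 4)) × (4 * D) / 5 ≤ output σ × output σ ≤ D

  algorithm-correct : Correct
  algorithm-correct = first (exec prepareR input-bounded)
    where
    first : (Σ[ t ∈ ℕ ] Σ[ τ ∈ State ] Σ[ k ∈ ℕ ]
              (prepare ▷ input G ⇓[ t ] τ) × t + k * unit ≤ prepareCost * unit × Bounded τ × Prepared τ) → Correct
    first (t₁ , τ₁ , k₁ , d₁ , l₁ , B₁ , P) = second (exec (Solve.solveR P) B₁)
      where
      second : (Σ[ t ∈ ℕ ] Σ[ τ ∈ State ] Σ[ k ∈ ℕ ]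
                 (solve ▷ τ₁ ⇓[ t ] τ) × t + k * unit ≤ Solve.solveCost P * unit × Bounded τ
                 × (4 * D) / 5 ≤ output τ × output τ ≤ D) → Correct
      second (t₂ , τ₂ , k₂ , d₂ , l₂ , _ , low , high) =
        t₁ + t₂ , τ₂ , seq⇓ d₁ d₂ ,
        (λ 2≤n → Solve.time≤ P 2≤n (≤-trans (+-mono-≤ (≤-trans (m≤m+n t₁ _) l₁) (≤-trans (m≤m+n t₂ _) l₂))
          (≤-reflexive (sym (*-distribʳ-+ unit prepareCost (Solve.solveCost P)))))) ,
        low , high

-- Word length and the logarithmic factor

word : ℕ → ℕ
word n = suc ⌊log₂ n ⌋ + suc ⌊log₂ n ⌋ + 2

n<2^[1+log] : ∀ n → n < 2 ^ suc ⌊log₂ n ⌋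
n<2^[1+log] n = ≰⇒> λ h → <⇒≱ (n<1+n ⌊log₂ n ⌋)
  (≤-trans (≤-reflexive (sym (⌊log₂[2^n]⌋≡n (suc ⌊log₂ n ⌋)))) (⌊log₂⌋-mono-≤ h))

-- Each of the four summands is at most y², where y is the first power of 2 above n (and y is 2 for
-- n = 0); the two extra bits in `word` provide the factor 4.
word-fits : ∀ n → 4 + (n + (n * n + n * n)) ≤ 2 ^ word n
word-fits n = begin
  4 + (n + (n * n + n * n))             ≤⟨ +-mono-≤ (*-mono-≤ 2≤y 2≤y) (+-mono-≤ n≤yy (+-mono-≤ nn≤ nn≤)) ⟩
  y * y + (y * y + (y * y + y * y))     ≡⟨ e₁ (y * y) ⟩
  y * y * 4                             ≡⟨ cong (_* 4) (sym (^-distribˡ-+-* 2 (suc ⌊log₂ n ⌋) (suc ⌊log₂ n ⌋))) ⟩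
  2 ^ (suc ⌊log₂ n ⌋ + suc ⌊log₂ n ⌋) * 2 ^ 2 ≡⟨ sym (^-distribˡ-+-* 2 (suc ⌊log₂ n ⌋ + suc ⌊log₂ n ⌋) 2) ⟩
  2 ^ word n                            ∎
  where
  open ≤-Reasoning
  y = 2 ^ suc ⌊log₂ n ⌋
  2≤y : 2 ≤ y
  2≤y = ^-monoʳ-≤ 2 {1} {suc ⌊log₂ n ⌋} (s≤s z≤n)
  n≤y : n ≤ y
  n≤y = <⇒≤ (n<2^[1+log] n)
  nn≤ : n * n ≤ y * y
  nn≤ = *-mono-≤ n≤y n≤y
  n≤yy : n ≤ y * y
  n≤yy = ≤-trans n≤y (≤-trans (≤-reflexive (sym (*-identityʳ y))) (*-monoʳ-≤ y (<⇒≤ 2≤y)))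
  e₁ : ∀ z → z + (z + (z + z)) ≡ z * 4
  e₁ = solve-∀

-- With l = ⌊log₂ n⌋ the length `suc (word n)` is 2l + 5, and 2l + 5 ≤ 7l as soon as l is positive.
unit-log : ∀ n → 2 ≤ n → 184 * (1024 * suc (word n)) * 6 ≤ 184 * 1024 * 6 * 7 * ⌊log₂ n ⌋ ^ 1
unit-log n 2≤n = go 184 1024 6 ⌊log₂ n ⌋ (≤-trans (≤-reflexive (sym (⌊log₂[2^n]⌋≡n 1))) (⌊log₂⌋-mono-≤ 2≤n))
  where
  open ≤-Reasoning
  e₁ : ∀ a b c l → a * (b * suc (suc l + suc l + 2)) * c ≡ a * b * c * (l + l + 5)
  e₁ = solve-∀
  e₂ : ∀ a b c l → a * b * c * (l + l + 5 * l) ≡ a * b * c * 7 * (l * 1)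
  e₂ = solve-∀
  go : ∀ a b c l → 1 ≤ l → a * (b * suc (suc l + suc l + 2)) * c ≤ a * b * c * 7 * l ^ 1
  go a b c l 1≤l = begin
    a * (b * suc (suc l + suc l + 2)) * c ≡⟨ e₁ a b c l ⟩
    a * b * c * (l + l + 5)               ≤⟨ *-monoʳ-≤ (a * b * c) (+-monoʳ-≤ (l + l) (*-monoʳ-≤ 5 1≤l)) ⟩
    a * b * c * (l + l + 5 * l)           ≡⟨ e₂ a b c l ⟩
    a * b * c * 7 * l ^ 1                 ∎

theorem5 : Σ[ P ∈ Program ] Σ[ c ∈ ℕ ] Σ[ k ∈ ℕ ]
    (∀ (n : ℕ) (G : Graph n) (D : ℕ) → IsDiameter G D →
    ∃[ t ] ∃[ σ ]
    ( (P ▷ input G ⇓[ t ] σ)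
    × (2 ≤ n → TimeBound c k n (edgeCount G) t)
    × (4 * D) / 5 ≤ output σ
    × output σ ≤ D ))
-- The factors come from the number of credits, the weight limit of expressions, the cube root of
-- the arithmetic constant, and the logarithm. The only logarithmic factor is the one due to bit
-- lengths, hence the exponent 1.
theorem5 = algorithm , 184 * 1024 * 6 * 7 , 1 , λ n G D diam →
  let t , σ , runs , time , low , high =
        Main.algorithm-correct G diam (word n) (s≤s z≤n) (1024 * suc (word n)) ≤-refl (word-fits n)
  in t , σ , runs ,
     (λ 2≤n → ≤-trans (time 2≤n) (*-monoˡ-≤ (edgeCount G ^ 2 * n ^ 4) (cube-mono (unit-log n 2≤n)))) ,
     low , high
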